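{- For every positive integer $k$, in $\mathbb C[[\mathbf t]]$, \[ \sum_{n\ge0}\sum_{\underline\mu\vdash n}\frac{\mathrm{roots}_k^{\prime B_n}(\underline\mu)}{|Z_{\underline\mu}|}\mathbf t^{\mathbf c(\underline\mu)}=\exp\Big(\sum_{j,\theta}\sum_{\substack{h\mid k\\ \gcd(h,j)=1}}\frac{ -(-t_{j,\theta})^{jk/h}}{2jk/h}\,\mathrm{roots}_h^{\mathbb Z_2}(\theta)\Big) \] and \[ \sum_{n\ge0}\sum_{\underline\mu\vdash n}\frac{\mathrm{sroots}_k^{\prime B_n}(\underline\mu)}{|Z_{\underline\mu}|}\mathbf t^{\mathbf c(\underline\mu)}=\exp\Big(\sum_{j,\theta}\sum_{\substack{h\mid k\\ \gcd(h,j)=1}}\frac{ -(-t_{j,\theta})^{jk/h}}{2jk/h}\,\mathrm{sroots}_h^{\mathbb Z_2}(\theta)\Big), \] where $h$ runs over positive divisors of $k$, $j\ge1$ and $\theta\in\mathbb Z_2$.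
   Context: $B_n$ is the group of bijections $w$ of $\{\pm1,\dots,\pm n\}$ with $w(-i)=-w(i)$. $\chi(w)=\prod_{i=1}^n\mathrm{sign}(w(i))$ and $\chi'(w)=\mathrm{sign}(|w|)$, the sign of the permutation $|w|(i)=|w(i)|$ in $S_n$. Define $\mathrm{roots}_k^{\prime B_n}(y)=\sum_{x\in B_n,\,x^k=y}\chi'(x)$ and $\mathrm{sroots}_k^{\prime B_n}(y)=\sum_{x\in B_n,\,x^k=y}\chi(x)\chi'(x)$. Cycles: if $c$ is a cycle of $w$ on $\{\pm1,\dots,\pm n\}$ of length $\ell$, so is $\bar c$ (negated entries); if $c\ne\bar c$, $c\bar c$ is a cycle of length $\ell$ and class $+1$; if $c=\bar c$, a cycle of length $\ell/2$ and class $-1$. Conjugacy classes are indexed by bipartitions $\underline\mu=(\mu^+,\mu^-)\vdash n$ ($\mu^\theta$ = lengths of cycles of class $\theta$); $b_{j,\theta}$ = number of parts $j$ of $\mu^\theta$; $\mathbf t^{\mathbf c(\underline\mu)}=\prod t_{j,\theta}^{jb_{j,\theta}}$. Values at $\underline\mu$ mean values at an element of that class, $|Z_{\underline\mu}|$ its centralizer order. $\mathbb Z_2=\{\pm1\}$, $\mathrm{roots}_h^{\mathbb Z_2}(\theta)=|\{\varepsilon:\varepsilon^h=\theta\}|$, $\mathrm{sroots}_h^{\mathbb Z_2}(\theta)=\sum_{\varepsilon^h=\theta}\varepsilon$. -}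

module Defs where

open import Data.Bool using (Bool; true; false; if_then_else_; _∧_; not)
open import Data.Nat as ℕ using (ℕ; zero; suc; _∸_)
open import Data.Nat.Divisibility using (_∣?_)
open import Data.Nat.GCD using (gcd)
open import Data.Nat using (_!)
open import Data.Integer as ℤ using (ℤ; +_; _◃_)
open import Data.Rational as ℚ using (ℚ; 0ℚ; 1ℚ)
open import Data.Sign as Sign using (Sign)
open import Data.Fin as Fin using (Fin; toℕ; lower₁; _↑ˡ_; _↑ʳ_)
open import Data.Fin.Properties as FinP using ()
open import Data.Product using (_×_; _,_; proj₁; proj₂)
import Data.Product.Properties as ProdP
open import Data.List as List using (List; []; _∷_; filterᵇ; upTo; allFin; concatMap; replicate; cartesianProduct; length)
open import Data.Vec as Vec using (Vec; []; _∷_; tabulate; lookup; zipWith; _++_; toList)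
import Data.Vec.Properties as VecP
open import Relation.Nullary using (does; yes; no; Dec)
open import Relation.Binary.PropositionalEquality using (_≡_)
open import Data.Bool.ListAction using (any; all)
import Data.Nat.Properties as ℕP

sumℤ : List ℤ → ℤ
sumℤ = List.foldr ℤ._+_ (+ 0)

sumℚ : List ℚ → ℚ
sumℚ = List.foldr ℚ._+_ 0ℚ

toℚ : ℤ → ℚ
toℚ z = z ℚ./ 1

-- 1/n for n ≥ 1 (only ever applied to positive arguments: factorials,
-- centralizer orders, and the positive numbers 2jk/h)
recip : ℕ → ℚ
recip zero    = 0ℚ
recip (suc n) = + 1 ℚ./ suc n

negOnePow : ℕ → ℤ
negOnePow zero    = + 1
negOnePow (suc p) = ℤ.- negOnePow p

signℤ : Sign → ℤ
signℤ s = s ◃ 1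

signPow : Sign → ℕ → Sign
signPow ε zero    = Sign.+
signPow ε (suc h) = ε Sign.* signPow ε h

Z2 : List Sign
Z2 = Sign.+ ∷ Sign.- ∷ []

rootsZ2 : ℕ → Sign → ℤ
rootsZ2 h θ = + length (filterᵇ (λ ε → does (signPow ε h Sign.≟ θ)) Z2)

srootsZ2 : ℕ → Sign → ℤ
srootsZ2 h θ = sumℤ (List.map signℤ (filterᵇ (λ ε → does (signPow ε h Sign.≟ θ)) Z2))

-- The hyperoctahedral group B_n.
-- A signed permutation w of {±1,…,±n} is stored as a vector v of length n
-- with  v[i] = (s , p)  meaning  w(i+1) = s·(p+1)  (0-based i, p);
-- then w(-(i+1)) = -w(i+1) automatically.

SPerm : ℕ → Set
SPerm n = Vec (Sign × Fin n) n

absPerm : ∀ {n} → SPerm n → Vec (Fin n) n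
absPerm = Vec.map proj₂

distinctᵇ : ∀ {n} → List (Fin n) → Bool
distinctᵇ []       = true
distinctᵇ (x ∷ xs) = not (any (λ y → does (x Fin.≟ y)) xs) ∧ distinctᵇ xs

allVecs : ∀ {A : Set} → List A → (m : ℕ) → List (Vec A m)
allVecs as zero    = [] ∷ []
allVecs as (suc m) = concatMap (λ a → List.map (a ∷_) (allVecs as m)) as

-- The list of all elements of B_n (each exactly once): all vectors whose
-- underlying map on {1..n} is injective (hence bijective).
Bn : (n : ℕ) → List (SPerm n)
Bn n = filterᵇ (λ v → distinctᵇ (toList (absPerm v)))
               (allVecs (cartesianProduct Z2 (allFin n)) n)

idB : ∀ {n} → SPerm n
idB = tabulate (λ i → (Sign.+ , i))

_∘B_ : ∀ {n} → SPerm n → SPerm n → SPerm n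
x ∘B y = Vec.map (λ sp → (proj₁ sp Sign.* proj₁ (lookup x (proj₂ sp)) , proj₂ (lookup x (proj₂ sp)))) y

_^B_ : ∀ {n} → SPerm n → ℕ → SPerm n
x ^B zero  = idB
x ^B suc k = x ∘B (x ^B k)

_≟B_ : ∀ {n} → (x y : SPerm n) → Dec (x ≡ y)
_≟B_ = VecP.≡-dec (ProdP.≡-dec Sign._≟_ Fin._≟_)

χ : ∀ {n} → SPerm n → ℤ
χ v = signℤ (Vec.foldr _ Sign._*_ Sign.+ (Vec.map proj₁ v))

inversions : ∀ {n} → List (Fin n) → ℕ
inversions []       = 0
inversions (x ∷ xs) = length (filterᵇ (λ y → does (y Fin.<? x)) xs) ℕ.+ inversions xs

χ' : ∀ {n} → SPerm n → ℤ
χ' v = negOnePow (inversions (toList (absPerm v)))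

rootsWith : ∀ {n} → (SPerm n → ℤ) → ℕ → SPerm n → ℤ
rootsWith {n} f k y = sumℤ (List.map f (filterᵇ (λ x → does ((x ^B k) ≟B y)) (Bn n)))

roots' : ∀ {n} → ℕ → SPerm n → ℤ
roots' = rootsWith χ'

sroots' : ∀ {n} → ℕ → SPerm n → ℤ
sroots' = rootsWith (λ x → χ x ℤ.* χ' x)

centralizerOrder : ∀ {n} → SPerm n → ℕ
centralizerOrder {n} w = length (filterᵇ (λ x → does ((x ∘B w) ≟B (w ∘B x))) (Bn n))

-- Canonical representative of the class of a bipartition.
-- A cycle (j' , θ) stands for a cycle of length j = suc j' and class θ.
-- It acts on a block of j consecutive letters a_1,…,a_j as
--   a_1 ↦ a_2 ↦ … ↦ a_j ↦ θ·a_1 ,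
-- which for θ = + gives the two cycles c, c̄ of length j (class +1), and for
-- θ = - the single cycle c = c̄ of length 2j (class -1, length j).

size : List (ℕ × Sign) → ℕ
size []             = 0
size ((j' , _) ∷ cs) = suc j' ℕ.+ size cs

blockEntry : ∀ {j'} → Sign → Fin (suc j') → Sign × Fin (suc j')
blockEntry {j'} θ i with j' ℕ.≟ toℕ i
... | yes _ = (θ , Fin.zero)
... | no ne = (Sign.+ , Fin.suc (lower₁ i ne))

rep : (cs : List (ℕ × Sign)) → SPerm (size cs)
rep []              = []
rep ((j' , θ) ∷ cs) =
  Vec.map (λ sp → (proj₁ sp , proj₂ sp ↑ˡ size cs)) (tabulate (blockEntry {j'} θ))
  ++ Vec.map (λ sp → (proj₁ sp , suc j' ↑ʳ proj₂ sp)) (rep cs)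

-- Formal power series in the 2N variables t_{j,θ}, 1 ≤ j ≤ N, θ ∈ {±}.
-- A monomial is a vector whose i-th entry (a , b) records the exponents of
-- t_{i+1,+} and t_{i+1,-}.

Mon : ℕ → Set
Mon N = Vec (ℕ × ℕ) N

_≟M_ : ∀ {N} → (x y : Mon N) → Dec (x ≡ y)
_≟M_ = VecP.≡-dec (ProdP.≡-dec ℕ._≟_ ℕ._≟_)

Ser : ℕ → Set
Ser N = Mon N → ℚ

below : ∀ {N} → Mon N → List (Mon N)
below []             = [] ∷ []
below ((a , b) ∷ e) =
  concatMap (λ a' → concatMap (λ b' → List.map ((a' , b') ∷_) (below e)) (upTo (suc b))) (upTo (suc a))

monSub : ∀ {N} → Mon N → Mon N → Mon N
monSub = zipWith (λ p q → (proj₁ p ∸ proj₁ q , proj₂ p ∸ proj₂ q))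

deg : ∀ {N} → Mon N → ℕ
deg = Vec.foldr _ (λ p r → proj₁ p ℕ.+ proj₂ p ℕ.+ r) 0

zeroMon : ∀ {N} → Mon N
zeroMon = Vec.replicate _ (0 , 0)

oneS : ∀ {N} → Ser N
oneS e = if does (e ≟M zeroMon) then 1ℚ else 0ℚ

_*S_ : ∀ {N} → Ser N → Ser N → Ser N
(f *S g) e = sumℚ (List.map (λ d → f d ℚ.* g (monSub e d)) (below e))

_^S_ : ∀ {N} → Ser N → ℕ → Ser N
f ^S zero  = oneS
f ^S suc m = f *S (f ^S m)

-- exp(S) = Σ_{m ≥ 0} S^m / m!, for S without constant term: the
-- coefficient of e only receives contributions from m ≤ deg e.
expS : ∀ {N} → Ser N → Ser N
expS S e = sumℚ (List.map (λ m → (S ^S m) e ℚ.* recip (m !)) (upTo (suc (deg e))))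

monoS : ∀ {N} → ℚ → Mon N → Ser N
monoS c m e = if does (m ≟M e) then c else 0ℚ

varPow : ∀ {N} → Fin N → Sign → ℕ → Mon N
varPow i Sign.+ p = tabulate (λ i' → if does (i Fin.≟ i') then (p , 0) else (0 , 0))
varPow i Sign.- p = tabulate (λ i' → if does (i Fin.≟ i') then (0 , p) else (0 , 0))

-- k / h for h ≥ 1 (only used for positive divisors h)
_div_ : ℕ → ℕ → ℕ
k div zero  = 0
k div suc h = k ℕ./ suc h

divisors : ℕ → List ℕ
divisors k = filterᵇ (λ h → does (h ∣? k)) (List.map suc (upTo k))

exponentS : ∀ {N} → (ℕ → Sign → ℤ) → ℕ → Ser N
exponentS {N} r k e =
  sumℚ (List.map (λ i →
    sumℚ (List.map (λ θ →
      let j = suc (toℕ i) in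
      sumℚ (List.map (λ h →
        let p = j ℕ.* (k div h) in
        monoS (toℚ (ℤ.- (negOnePow p ℤ.* r h θ)) ℚ.* recip (2 ℕ.* p)) (varPow i θ p) e)
        (filterᵇ (λ h → does (gcd h j ℕ.≟ 1)) (divisors k)))) Z2)) (List.allFin N))

rhsCoeff : ∀ {N} → (ℕ → Sign → ℤ) → ℕ → Mon N → ℚ
rhsCoeff r k e = expS (exponentS r k) e

-- Left hand side: Σ_n Σ_{μ ⊢ n} f_k(μ)/|Z_μ| t^{c(μ)}.
-- t^{c(μ)} = Π t_{j,θ}^{j b_{j,θ}}, so the monomial e equals t^{c(μ)} for a
-- (necessarily unique) bipartition μ iff every exponent of t_{j,θ} is
-- divisible by j; then b_{j,θ} = e_{j,θ}/j and n = deg e.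

isCycleTypeᵇ : ∀ {N} → Mon N → Bool
isCycleTypeᵇ {N} e = all (λ i → does (suc (toℕ i) ∣? proj₁ (lookup e i))
                                   ∧ does (suc (toℕ i) ∣? proj₂ (lookup e i)))
                              (List.allFin N)

cyclesOf : ∀ {N} → Mon N → List (ℕ × Sign)
cyclesOf {N} e = concatMap (λ i →
    replicate (proj₁ (lookup e i) ℕ./ suc (toℕ i)) (toℕ i , Sign.+)
    List.++ replicate (proj₂ (lookup e i) ℕ./ suc (toℕ i)) (toℕ i , Sign.-))
  (List.allFin N)

lhsCoeff : ∀ {N} → (∀ {n} → ℕ → SPerm n → ℤ) → ℕ → Mon N → ℚ
lhsCoeff f k e =
  if isCycleTypeᵇ e
  then toℚ (f k (rep (cyclesOf e))) ℚ.* recip (centralizerOrder (rep (cyclesOf e)))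
  else 0ℚ

{-# OPTIONS --safe #-}
module Submission where

-- Counting pairs (g , x) with x ^ k = g y g⁻¹ gives |Bₙ| · roots(y) = |Z y| · Σ { f x | x ^ k has the cycle type of y },
-- where f is χ' or χ χ': f is a class function, and elements with the same cycle type are conjugate. The left-hand
-- coefficient at t^c(μ) is therefore 1/|Bₙ| times the sum of f over the x whose k-th power has cycle type μ. The monomial
-- t^c(μ) is the product over all letters of the variable of the cycle containing the letter, and a cycle of x of length l
-- and class ε becomes in x ^ k cycles of length j = l / g and class ε ^ h, where g = gcd l k and h = k / g.
--
-- Removing the cycle of a fixed letter gives a recursion for these sums: if a is the series and n the total degree, then
-- 2 n a is the sum over l and ε of (-1)^(l-1) ϕ(ε) t_{j,ε^h}^l times a, where ϕ(ε) is 1 for χ' and ε for χ χ'. As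
-- l = j k / h for exactly one pair (j , h) with h ∣ k and gcd h j = 1, this is the equation D F = (D E) F, with D the
-- Euler operator, satisfied by F = exp E.

open import Defs
open import Data.Nat as ℕ using (ℕ; zero; suc; _≤_; _<_; _∸_; z≤n; s≤s; _!)
import Data.Nat.Properties as ℕP
import Data.Nat.DivMod as DivMod
open import Data.Nat.Divisibility as Div using (_∣_; divides; _∣?_)
open import Data.Nat.GCD as GCD using (gcd)
import Data.Nat.Coprimality as Coprimality
open import Data.Bool as Bool using (Bool; true; false; if_then_else_; not; _∧_; T)
open import Data.Bool.ListAction using (any; all)
open import Data.Integer as ℤ using (ℤ)
import Data.Integer.Properties as ℤP
open import Data.Rational as ℚ using (ℚ; 0ℚ; 1ℚ; _+_; _*_; -_)
import Data.Rational.Unnormalised as ℚᵘ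
import Data.Rational.Unnormalised.Properties as ℚᵘP
import Data.Rational.Properties as ℚP
import Data.Rational.Solver as ℚS
open import Data.Sign as Sign using (Sign)
import Data.Sign.Properties as SignP
open import Data.Fin as Fin using (Fin; toℕ)
import Data.Fin.Properties as FinP
open import Data.Maybe as Maybe using (Maybe; just; nothing; maybe′; _>>=_)
open import Data.Product using (_×_; _,_; proj₁; proj₂; ∃)
open import Data.Sum using (_⊎_; inj₁; inj₂)
open import Data.Vec as Vec using (Vec; []; _∷_; lookup; tabulate; toList)
import Data.Vec.Properties as VecP
open import Data.List as List using (List; []; _∷_; filterᵇ; _++_; map; concatMap; length; cartesianProduct; cartesianProductWith; filter; allFin; replicate; upTo)
import Data.List.Properties as ListP
open import Data.List.Relation.Unary.Any using (here; there)
open import Data.List.Membership.Propositional using (_∈_; _∉_)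
open import Data.List.Membership.Propositional.Properties.WithK using (unique∧set⇒bag)
import Data.List.Membership.Propositional.Properties as ∈P
open import Data.List.Relation.Unary.Unique.Propositional using (Unique; []; _∷_)
import Data.List.Relation.Unary.Unique.Propositional.Properties as UniqueP
open import Data.List.Relation.Unary.AllPairs as AllPairs using ()
import Data.List.Relation.Unary.All as All
open import Data.List.Relation.Binary.Permutation.Propositional as ↭ using (_↭_; ↭-refl; ↭-sym; ↭-trans)
import Data.List.Relation.Binary.Permutation.Propositional.Properties as ↭P
open import Data.List.Relation.Binary.BagAndSetEquality using (∼bag⇒↭)
open import Function using (_∘_; id; mk⇔)
open import Relation.Nullary using (Dec; yes; no; does; ¬_; contradiction; ¬?; _×-dec_)
open import Relation.Nullary.Decidable as DecP using (dec-true; dec-false)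
open import Relation.Binary.Definitions using (tri<; tri≈; tri>)
open import Relation.Binary.PropositionalEquality hiding ([_])
import Data.List.Membership.DecPropositional as DecMem
import Data.Integer.Solver as ℤS

-- No bijection relates the two sides: both series satisfy the same equation, which with the
-- constant term fixes every coefficient by induction on the degree. The shape of that equation
-- comes from insertions. Putting a new letter in front of one of n letters, with either sign, can
-- be done in 2 n ways, and 2 n is also the quotient of the orders of Bₙ and Bₙ₋₁. Hence division by
-- the group order absorbs all the counts that arise while a cycle is stripped letter by letter, and
-- each length keeps only a sign. Letters carry the data: a cycle of length l is recorded l times.
-- This matches the exponents j b in t^c(μ) and turns the passage to k-th powers into a letterwise
-- map, so that the splitting of cycles needs no count of pieces. Multiplication by a power of one
-- variable is a partial shift of exponents, and both recursions are stated with such shifts instead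
-- of Cauchy products. One point remains outside this scheme: where a monomial is no t^c(μ) the left
-- side is 0 by definition, and the right side must be shown to vanish. It does because each
-- exponent j k / h is a multiple of j.

private
  variable
    m n N : ℕ
    A B : Set

-- Rational sums over lists

toℚᵘ-toℚ : ∀ z → ℚ.toℚᵘ (toℚ z) ℚᵘ.≃ ℚᵘ.mkℚᵘ z 0
toℚᵘ-toℚ z = ℚP.toℚᵘ-fromℚᵘ (ℚᵘ.mkℚᵘ z 0)

toℚ-+ : ∀ a b → toℚ (a ℤ.+ b) ≡ toℚ a + toℚ b
toℚ-+ a b = ℚP.toℚᵘ-injective (ℚᵘP.≃-trans (toℚᵘ-toℚ (a ℤ.+ b))
  (ℚᵘP.≃-sym (ℚᵘP.≃-trans (ℚP.toℚᵘ-homo-+ (toℚ a) (toℚ b))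
    (ℚᵘP.≃-trans (ℚᵘP.+-cong (toℚᵘ-toℚ a) (toℚᵘ-toℚ b))
      (ℚᵘ.*≡* (cong₂ ℤ._*_ (cong₂ ℤ._+_ (ℤP.*-identityʳ a) (ℤP.*-identityʳ b)) refl))))))

toℚ-* : ∀ a b → toℚ (a ℤ.* b) ≡ toℚ a * toℚ b
toℚ-* a b = ℚP.toℚᵘ-injective (ℚᵘP.≃-trans (toℚᵘ-toℚ (a ℤ.* b))
  (ℚᵘP.≃-sym (ℚᵘP.≃-trans (ℚP.toℚᵘ-homo-* (toℚ a) (toℚ b))
    (ℚᵘP.*-cong (toℚᵘ-toℚ a) (toℚᵘ-toℚ b)))))

toℚ-neg : ∀ a → toℚ (ℤ.- a) ≡ - toℚ a
toℚ-neg a = ℚP.toℚᵘ-injective (ℚᵘP.≃-trans (toℚᵘ-toℚ (ℤ.- a))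
  (ℚᵘP.≃-sym (ℚᵘP.≃-trans (ℚP.toℚᵘ-homo‿- (toℚ a)) (ℚᵘP.-‿cong (toℚᵘ-toℚ a)))))

toℚ-injective : ∀ {a b} → toℚ a ≡ toℚ b → a ≡ b
toℚ-injective {a} {b} eq = trans (sym (ℤP.*-identityʳ a))
  (trans (ℚᵘP.drop-*≡* (ℚᵘP.≃-trans (ℚᵘP.≃-sym (toℚᵘ-toℚ a)) (ℚᵘP.≃-trans (ℚP.toℚᵘ-cong eq) (toℚᵘ-toℚ b)))) (ℤP.*-identityʳ b))

abstract
  -- Kept abstract, so that numerals are handled only through the homomorphism laws below and
  -- rational normal forms never unfold.
  fromℕ : ℕ → ℚ
  fromℕ n = toℚ (ℤ.+ n)

  fromℕ-toℚ : ∀ n → fromℕ n ≡ toℚ (ℤ.+ n)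
  fromℕ-toℚ n = refl

  fromℕ-0 : fromℕ 0 ≡ 0ℚ
  fromℕ-0 = refl

  fromℕ-1 : fromℕ 1 ≡ 1ℚ
  fromℕ-1 = refl

  fromℕ-+ : ∀ a b → fromℕ (a ℕ.+ b) ≡ fromℕ a + fromℕ b
  fromℕ-+ a b = toℚ-+ (ℤ.+ a) (ℤ.+ b)

  fromℕ-* : ∀ a b → fromℕ (a ℕ.* b) ≡ fromℕ a * fromℕ b
  fromℕ-* a b = trans (cong toℚ (ℤP.pos-* a b)) (toℚ-* (ℤ.+ a) (ℤ.+ b))

  fromℕ-suc : ∀ n → fromℕ (suc n) ≡ 1ℚ + fromℕ n
  fromℕ-suc n = fromℕ-+ 1 n

  fromℕ-injective : ∀ {a b} → fromℕ a ≡ fromℕ b → a ≡ b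
  fromℕ-injective eq = ℤP.+-injective (toℚ-injective eq)

  recip-inverse : ∀ n → 1 ≤ n → recip n * fromℕ n ≡ 1ℚ
  recip-inverse (suc n) _ = ℚP.toℚᵘ-injective (ℚᵘP.≃-trans (ℚP.toℚᵘ-homo-* (recip (suc n)) (fromℕ (suc n)))
     (ℚᵘP.≃-trans (ℚᵘP.*-cong (ℚP.toℚᵘ-fromℚᵘ (ℚᵘ.mkℚᵘ (ℤ.+ 1) n)) (toℚᵘ-toℚ (ℤ.+ suc n)))
       (ℚᵘ.*≡* (trans (ℤP.*-identityʳ _) (sym (trans (ℤP.*-identityˡ _) (trans (cong ℤ.+_ (ℕP.*-identityʳ (suc n))) (sym (ℤP.*-identityˡ (ℤ.+ suc n))))))))))
  
-- Identities with denominators are proved after multiplication by a positive integer; this lemma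
-- takes the factor away again.
*-cancelˡ : ∀ n → 1 ≤ n → ∀ {a b} → fromℕ n * a ≡ fromℕ n * b → a ≡ b
*-cancelˡ n 1≤n {a} {b} eq = trans (sym (undo a)) (trans (cong (recip n *_) eq) (undo b))
  where
  undo : ∀ c → recip n * (fromℕ n * c) ≡ c
  undo c = trans (sym (ℚP.*-assoc (recip n) _ c)) (trans (cong (_* c) (recip-inverse n 1≤n)) (ℚP.*-identityˡ c))

∑ : List A → (A → ℚ) → ℚ
∑ xs f = sumℚ (map f xs)

-- The Iverson bracket. It turns a sum over a filtered list into a sum over the whole list, where
-- the order of summation can be exchanged.
⟦_⟧ : Bool → ℚ
⟦ b ⟧ = if b then 1ℚ else 0ℚ

∑-cong-∈ : ∀ (xs : List A) {f g : A → ℚ} → (∀ x → x ∈ xs → f x ≡ g x) → ∑ xs f ≡ ∑ xs g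
∑-cong-∈ [] h = refl
∑-cong-∈ (x ∷ xs) h = cong₂ _+_ (h x (here refl)) (∑-cong-∈ xs (λ y m → h y (there m)))

∑-cong : ∀ (xs : List A) {f g : A → ℚ} → (∀ x → f x ≡ g x) → ∑ xs f ≡ ∑ xs g
∑-cong xs h = ∑-cong-∈ xs (λ x _ → h x)

∑-zero : ∀ (xs : List A) → ∑ xs (λ _ → 0ℚ) ≡ 0ℚ
∑-zero [] = refl
∑-zero (x ∷ xs) = trans (ℚP.+-identityˡ _) (∑-zero xs)

∑-zero-∈ : ∀ (xs : List A) {f : A → ℚ} → (∀ x → x ∈ xs → f x ≡ 0ℚ) → ∑ xs f ≡ 0ℚ
∑-zero-∈ xs h = trans (∑-cong-∈ xs h) (∑-zero xs)

∑-++ : ∀ (xs ys : List A) (f : A → ℚ) → ∑ (xs ++ ys) f ≡ ∑ xs f + ∑ ys f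
∑-++ [] ys f = sym (ℚP.+-identityˡ _)
∑-++ (x ∷ xs) ys f = trans (cong (λ z → f x + z) (∑-++ xs ys f)) (sym (ℚP.+-assoc (f x) _ _))

+-interchange : ∀ a b c d → (a + b) + (c + d) ≡ (a + c) + (b + d)
+-interchange = solve 4 (λ a b c d → (a :+ b) :+ (c :+ d) := (a :+ c) :+ (b :+ d)) refl
  where open ℚS.+-*-Solver

*-exchange : ∀ a b c → a * (b * c) ≡ b * (a * c)
*-exchange = solve 3 (λ a b c → a :* (b :* c) := b :* (a :* c)) refl
  where open ℚS.+-*-Solver

∑-+ : ∀ (xs : List A) (f g : A → ℚ) → ∑ xs (λ x → f x + g x) ≡ ∑ xs f + ∑ xs g
∑-+ [] f g = refl
∑-+ (x ∷ xs) f g = trans (cong (λ z → (f x + g x) + z) (∑-+ xs f g)) (+-interchange (f x) (g x) _ _)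

∑-*ˡ : ∀ (xs : List A) (c : ℚ) (f : A → ℚ) → ∑ xs (λ x → c * f x) ≡ c * ∑ xs f
∑-*ˡ [] c f = sym (ℚP.*-zeroʳ c)
∑-*ˡ (x ∷ xs) c f = trans (cong (λ z → c * f x + z) (∑-*ˡ xs c f)) (sym (ℚP.*-distribˡ-+ c (f x) _))

∑-*ʳ : ∀ (xs : List A) (c : ℚ) (f : A → ℚ) → ∑ xs (λ x → f x * c) ≡ ∑ xs f * c
∑-*ʳ xs c f = trans (∑-cong xs (λ x → ℚP.*-comm (f x) c)) (trans (∑-*ˡ xs c f) (ℚP.*-comm c _))

∑-swap : ∀ (xs : List A) (ys : List B) (f : A → B → ℚ) →
  ∑ xs (λ x → ∑ ys (f x)) ≡ ∑ ys (λ y → ∑ xs (λ x → f x y))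
∑-swap [] ys f = sym (∑-zero ys)
∑-swap (x ∷ xs) ys f = trans (cong (λ z → ∑ ys (f x) + z) (∑-swap xs ys f)) (sym (∑-+ ys (f x) _))

∑-map : ∀ (g : A → B) (xs : List A) (f : B → ℚ) → ∑ (map g xs) f ≡ ∑ xs (f ∘ g)
∑-map g [] f = refl
∑-map g (x ∷ xs) f = cong (λ z → f (g x) + z) (∑-map g xs f)

∑-concatMap : ∀ (g : A → List B) (xs : List A) (f : B → ℚ) → ∑ (concatMap g xs) f ≡ ∑ xs (λ x → ∑ (g x) f)
∑-concatMap g [] f = refl
∑-concatMap g (x ∷ xs) f = trans (∑-++ (g x) (concatMap g xs) f) (cong (λ z → ∑ (g x) f + z) (∑-concatMap g xs f))

∑-cartesianProductWith : ∀ {C : Set} (g : A → B → C) (xs : List A) (ys : List B) (f : C → ℚ) →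
  ∑ (cartesianProductWith g xs ys) f ≡ ∑ xs (λ x → ∑ ys (λ y → f (g x y)))
∑-cartesianProductWith g [] ys f = refl
∑-cartesianProductWith g (x ∷ xs) ys f =
  trans (∑-++ (map (g x) ys) _ f) (cong₂ _+_ (∑-map (g x) ys f) (∑-cartesianProductWith g xs ys f))

∑-↭ : ∀ {xs ys : List A} (f : A → ℚ) → xs ↭ ys → ∑ xs f ≡ ∑ ys f
∑-↭ f ↭.refl = refl
∑-↭ f (↭.prep x p) = cong (λ z → f x + z) (∑-↭ f p)
∑-↭ f (↭.swap {xs} {ys} x y p) = trans (cong (λ z → f x + (f y + z)) (∑-↭ f p)) (rearrange (f x) (f y) (∑ ys f))
  where
  open ℚS.+-*-Solver
  rearrange : ∀ a b c → a + (b + c) ≡ b + (a + c)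
  rearrange = solve 3 (λ a b c → a :+ (b :+ c) := b :+ (a :+ c)) refl
∑-↭ f (↭.trans p q) = trans (∑-↭ f p) (∑-↭ f q)

∑-filterᵇ : ∀ (p : A → Bool) (xs : List A) (f : A → ℚ) → ∑ (filterᵇ p xs) f ≡ ∑ xs (λ x → ⟦ p x ⟧ * f x)
∑-filterᵇ p [] f = refl
∑-filterᵇ p (x ∷ xs) f with p x
... | true = cong₂ _+_ (sym (ℚP.*-identityˡ (f x))) (∑-filterᵇ p xs f)
... | false = trans (∑-filterᵇ p xs f) (sym (trans (cong₂ _+_ (ℚP.*-zeroˡ (f x)) refl) (ℚP.+-identityˡ _)))

∑-single : ∀ {xs : List A} {a : A} (f : A → ℚ) → Unique xs → a ∈ xs →
  (∀ x → x ∈ xs → x ≢ a → f x ≡ 0ℚ) → ∑ xs f ≡ f a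
∑-single {xs = x ∷ xs} f (x∉ AllPairs.∷ u) (here refl) h =
  trans (cong (λ z → f x + z) (∑-zero-∈ xs (λ y m → h y (there m) (λ { refl → All.lookup x∉ m refl })))) (ℚP.+-identityʳ (f x))
∑-single {xs = x ∷ xs} f (x∉ AllPairs.∷ u) (there m) h =
  trans (cong₂ _+_ (h x (here refl) (λ { refl → All.lookup x∉ m refl })) (∑-single f u m (λ y m' → h y (there m')))) (ℚP.+-identityˡ _)

∑-length : ∀ (xs : List A) (c : ℚ) → ∑ xs (λ _ → c) ≡ fromℕ (length xs) * c
∑-length [] c = sym (trans (cong (_* c) fromℕ-0) (ℚP.*-zeroˡ c))
∑-length (x ∷ xs) c = trans (cong (c +_) (∑-length xs c))
  (sym (trans (cong (_* c) (fromℕ-suc (length xs)))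
    (trans (ℚP.*-distribʳ-+ c 1ℚ (fromℕ (length xs))) (cong₂ _+_ (ℚP.*-identityˡ c) refl))))

toℚ-sumℤ : ∀ (xs : List A) (f : A → ℤ) → toℚ (sumℤ (map f xs)) ≡ ∑ xs (λ x → toℚ (f x))
toℚ-sumℤ [] f = refl
toℚ-sumℤ (x ∷ xs) f = trans (toℚ-+ (f x) _) (cong (λ z → toℚ (f x) + z) (toℚ-sumℤ xs f))

-- The source of the reindexings: a bijection between finite sets becomes a permutation of
-- duplicate-free lists.
unique∧set⇒↭ : ∀ {xs ys : List A} → Unique xs → Unique ys →
  (∀ x → x ∈ xs → x ∈ ys) → (∀ x → x ∈ ys → x ∈ xs) → xs ↭ ys
unique∧set⇒↭ u v h h' = ∼bag⇒↭ (unique∧set⇒bag u v (λ {x} → mk⇔ (h x) (h' x)))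

does-cong : ∀ {P Q : Set} (p : Dec P) (q : Dec Q) → (P → Q) → (Q → P) → does p ≡ does q
does-cong p q f g = DecP.does-⇔ (mk⇔ f g) p q

-- Signed permutations

perm : SPerm n → Fin n → Fin n
perm x i = proj₂ (lookup x i)

sgn : SPerm n → Fin n → Sign
sgn x i = proj₁ (lookup x i)

-- The pair `(s , p)` is the signed letter s·p, so this is the element as a map of all ± letters,
-- and composition becomes composition of these maps.
act : SPerm n → Sign × Fin n → Sign × Fin n
act x (s , p) = s Sign.* sgn x p , perm x p

-- Membership in Bₙ as a usable property: an injective self-map of a finite set is bijective.
Good : SPerm n → Set
Good x = ∀ {i j} → perm x i ≡ perm x j → i ≡ j

≡-lookup : ∀ {A : Set} {x y : Vec A n} → (∀ i → lookup x i ≡ lookup y i) → x ≡ y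
≡-lookup {x = x} {y} h = trans (sym (VecP.tabulate∘lookup x)) (trans (VecP.tabulate-cong h) (VecP.tabulate∘lookup y))

lookup-∘B : ∀ (x y : SPerm n) i → lookup (x ∘B y) i ≡ act x (lookup y i)
lookup-∘B x y i = VecP.lookup-map i _ y

lookup-idB : ∀ (i : Fin n) → lookup idB i ≡ (Sign.+ , i)
lookup-idB i = VecP.lookup∘tabulate _ i

act-∘B : ∀ (x y : SPerm n) l → act (x ∘B y) l ≡ act x (act y l)
act-∘B x y (s , p) rewrite lookup-∘B x y p = cong (_, _) (sym (SignP.*-assoc s _ _))

∘B-assoc : ∀ (x y z : SPerm n) → (x ∘B y) ∘B z ≡ x ∘B (y ∘B z)
∘B-assoc x y z = ≡-lookup λ i → trans (lookup-∘B (x ∘B y) z i)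
  (trans (act-∘B x y (lookup z i)) (sym (trans (lookup-∘B x (y ∘B z) i) (cong (act x) (lookup-∘B y z i)))))

∘B-identityˡ : ∀ (x : SPerm n) → idB ∘B x ≡ x
∘B-identityˡ x = ≡-lookup λ i → trans (lookup-∘B idB x i)
  (trans (cong (λ z → proj₁ (lookup x i) Sign.* proj₁ z , proj₂ z) (lookup-idB (proj₂ (lookup x i)))) (cong (_, perm x i) (SignP.*-identityʳ _)))

∘B-identityʳ : ∀ (x : SPerm n) → x ∘B idB ≡ x
∘B-identityʳ x = ≡-lookup λ i → trans (lookup-∘B x idB i) (cong (act x) (lookup-idB i))

perm-∘B : ∀ (x y : SPerm n) i → perm (x ∘B y) i ≡ perm x (perm y i)
perm-∘B x y i = cong proj₂ (lookup-∘B x y i)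

sgn-∘B : ∀ (x y : SPerm n) i → sgn (x ∘B y) i ≡ sgn y i Sign.* sgn x (perm y i)
sgn-∘B x y i = cong proj₁ (lookup-∘B x y i)

Good-∘B : ∀ {x y : SPerm n} → Good x → Good y → Good (x ∘B y)
Good-∘B {x = x} {y} gx gy {i} {j} eq = gy (gx (trans (sym (perm-∘B x y i)) (trans eq (perm-∘B x y j))))

-- Enumeration of Bₙ and its decomposition along the letter 0

any-false : ∀ {m} (a : Fin m) (u : Vec (Fin m) n) → (∀ j → a ≢ lookup u j) →
  any (λ y → does (a Fin.≟ y)) (toList u) ≡ false
any-false a [] h = refl
any-false a (b ∷ u) h with a Fin.≟ b
... | yes eq = contradiction eq (h Fin.zero)
... | no _ = any-false a u (λ j → h (Fin.suc j))

any-false⁻ : ∀ {m} (a : Fin m) (u : Vec (Fin m) n) → any (λ y → does (a Fin.≟ y)) (toList u) ≡ false →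
  ∀ j → a ≢ lookup u j
any-false⁻ a (b ∷ u) h j with a Fin.≟ b
any-false⁻ a (b ∷ u) () j | yes eq
any-false⁻ a (b ∷ u) h Fin.zero | no a≢b = a≢b
any-false⁻ a (b ∷ u) h (Fin.suc j) | no a≢b = any-false⁻ a u h j

distinctᵇ-true : ∀ {m} (u : Vec (Fin m) n) → (∀ {i j} → lookup u i ≡ lookup u j → i ≡ j) →
  T (distinctᵇ (toList u))
distinctᵇ-true [] inj = _
distinctᵇ-true (a ∷ u) inj rewrite any-false a u (λ j eq → FinP.0≢1+n (inj {Fin.zero} {Fin.suc j} eq)) =
  distinctᵇ-true u (λ eq → FinP.suc-injective (inj eq))

distinctᵇ-true⁻ : ∀ {m} (u : Vec (Fin m) n) → T (distinctᵇ (toList u)) →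
  ∀ i j → lookup u i ≡ lookup u j → i ≡ j
distinctᵇ-true⁻ (a ∷ u) t i j eq with any (λ y → does (a Fin.≟ y)) (toList u) in eqa
distinctᵇ-true⁻ (a ∷ u) t Fin.zero Fin.zero eq | false = refl
distinctᵇ-true⁻ (a ∷ u) t Fin.zero (Fin.suc j) eq | false = contradiction eq (any-false⁻ a u eqa j)
distinctᵇ-true⁻ (a ∷ u) t (Fin.suc i) Fin.zero eq | false = contradiction (sym eq) (any-false⁻ a u eqa i)
distinctᵇ-true⁻ (a ∷ u) t (Fin.suc i) (Fin.suc j) eq | false = cong Fin.suc (distinctᵇ-true⁻ u t i j eq)

concatMap-cartesianProductWith : ∀ {A B C : Set} (f : A → B → C) (xs : List A) (ys : List B) →
  concatMap (λ a → map (f a) ys) xs ≡ cartesianProductWith f xs ys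
concatMap-cartesianProductWith f [] ys = refl
concatMap-cartesianProductWith f (x ∷ xs) ys = cong (map (f x) ys ++_) (concatMap-cartesianProductWith f xs ys)

∈-allVecs : ∀ {A : Set} {as : List A} → (∀ a → a ∈ as) → (v : Vec A n) → v ∈ allVecs as n
∈-allVecs h [] = here refl
∈-allVecs {n = suc n} {as = as} h (a ∷ v) = subst (a ∷ v ∈_) (sym (concatMap-cartesianProductWith _∷_ as (allVecs as n)))
  (∈P.∈-cartesianProductWith⁺ _∷_ (h a) (∈-allVecs h v))

allVecs-unique : ∀ {A : Set} {as : List A} → Unique as → ∀ n → Unique (allVecs as n)
allVecs-unique u zero = All.[] AllPairs.∷ AllPairs.[]
allVecs-unique {as = as} u (suc n) = subst Unique (sym (concatMap-cartesianProductWith _∷_ as (allVecs as n)))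
  (UniqueP.cartesianProductWith⁺ _∷_ VecP.∷-injective u (allVecs-unique u n))

∈-Z2 : ∀ s → s ∈ Z2
∈-Z2 Sign.+ = here refl
∈-Z2 Sign.- = there (here refl)

Z2-unique : Unique Z2
Z2-unique = ((λ ()) All.∷ All.[]) AllPairs.∷ (All.[] AllPairs.∷ AllPairs.[])

∈-Bn : ∀ {x : SPerm n} → Good x → x ∈ Bn n
∈-Bn {x = x} g = ∈P.∈-filter⁺ _ (∈-allVecs (λ { (s , i) → ∈P.∈-cartesianProduct⁺ (∈-Z2 s) (∈P.∈-allFin i) }) x)
  (distinctᵇ-true (absPerm x) (λ {i} {j} eq → g (trans (sym (VecP.lookup-map i proj₂ x)) (trans eq (VecP.lookup-map j proj₂ x)))))

Good-Bn : ∀ {x : SPerm n} → x ∈ Bn n → Good x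
Good-Bn {n = n} {x = x} m {i} {j} eq = distinctᵇ-true⁻ (absPerm x)
  (proj₂ (∈P.∈-filter⁻ (λ v → Bool.T? (distinctᵇ (toList (absPerm v)))) {xs = allVecs (cartesianProduct Z2 (allFin n)) n} m)) i j
  (trans (VecP.lookup-map i proj₂ x) (trans eq (sym (VecP.lookup-map j proj₂ x))))

Bn-unique : ∀ n → Unique (Bn n)
Bn-unique n = UniqueP.filter⁺ _ (allVecs-unique (UniqueP.cartesianProduct⁺ Z2-unique (UniqueP.allFin⁺ n)) n)

-- In cycle notation fixHead s x adds the cycle of 0 alone, with sign s, and insertHead s i x inserts 0 in front of i
-- (the letters of x being renamed by suc). The sign s on the arrow 0 → i is compensated on the arrow entering 0,
-- so that inserting lengthens the cycle of i by one and keeps its class.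
fixHead : Sign → SPerm n → SPerm (suc n)
fixHead s x = (s , Fin.zero) ∷ Vec.map (λ p → proj₁ p , Fin.suc (proj₂ p)) x

bend : Sign → Fin n → Sign × Fin n → Sign × Fin (suc n)
bend s i (r , m) = if does (m Fin.≟ i) then (r Sign.* s , Fin.zero) else (r , Fin.suc m)

insertHead : Sign → Fin n → SPerm n → SPerm (suc n)
insertHead s i x = (s , Fin.suc i) ∷ Vec.map (bend s i) x

-- The pair of `s` and the index in `Fin (suc n)` is exactly the signed image of the letter 0.
-- Fixing it leaves a free element of Bₙ, which gives both the order of the group and the recursion.
decode : Sign × (Fin (suc n) × SPerm n) → SPerm (suc n)
decode (s , Fin.zero , x) = fixHead s x
decode (s , Fin.suc i , x) = insertHead s i x

bend-≡ : ∀ s (i : Fin n) r {m} → m ≡ i → bend s i (r , m) ≡ (r Sign.* s , Fin.zero)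
bend-≡ s i r refl rewrite dec-true (i Fin.≟ i) refl = refl

bend-≢ : ∀ s (i : Fin n) r {m} → m ≢ i → bend s i (r , m) ≡ (r , Fin.suc m)
bend-≢ s i r {m} ne rewrite dec-false (m Fin.≟ i) ne = refl

bend-injective : ∀ s (i : Fin n) {p q} → bend s i p ≡ bend s i q → p ≡ q
bend-injective s i {r , m} {r' , m'} eq with m Fin.≟ i | m' Fin.≟ i
... | yes refl | yes refl = cong (_, m) (SignP.*-cancelʳ-≡ s r r' (cong proj₁ eq))
... | yes refl | no _ = contradiction (cong proj₂ eq) FinP.0≢1+n
... | no _ | yes refl = contradiction (sym (cong proj₂ eq)) FinP.0≢1+n
... | no _ | no _ = cong₂ _,_ (cong proj₁ eq) (FinP.suc-injective (cong proj₂ eq))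

bend-proj₂-injective : ∀ s (i : Fin n) {p q} → proj₂ (bend s i p) ≡ proj₂ (bend s i q) → proj₂ p ≡ proj₂ q
bend-proj₂-injective s i {r , m} {r' , m'} eq with m Fin.≟ i | m' Fin.≟ i
... | yes refl | yes refl = refl
... | yes refl | no _ = contradiction eq FinP.0≢1+n
... | no _ | yes refl = contradiction (sym eq) FinP.0≢1+n
... | no _ | no _ = FinP.suc-injective eq

Vec-map-injective : ∀ {A B : Set} {f : A → B} → (∀ {a b} → f a ≡ f b → a ≡ b) →
  ∀ {n} {x y : Vec A n} → Vec.map f x ≡ Vec.map f y → x ≡ y
Vec-map-injective inj {x = []} {[]} eq = refl
Vec-map-injective inj {x = a ∷ x} {b ∷ y} eq = cong₂ _∷_ (inj (VecP.∷-injectiveˡ eq)) (Vec-map-injective inj (VecP.∷-injectiveʳ eq))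

decode-injective : ∀ {c d : Sign × (Fin (suc n) × SPerm n)} → decode c ≡ decode d → c ≡ d
decode-injective {c = s , Fin.zero , x} {t , Fin.zero , y} eq with cong proj₁ (VecP.∷-injectiveˡ eq)
... | refl = cong (λ z → s , Fin.zero , z)
  (Vec-map-injective (λ e → cong₂ _,_ (cong proj₁ e) (FinP.suc-injective (cong proj₂ e))) (VecP.∷-injectiveʳ eq))
decode-injective {c = s , Fin.zero , x} {t , Fin.suc j , y} eq = contradiction (cong proj₂ (VecP.∷-injectiveˡ eq)) FinP.0≢1+n
decode-injective {c = s , Fin.suc i , x} {t , Fin.zero , y} eq = contradiction (sym (cong proj₂ (VecP.∷-injectiveˡ eq))) FinP.0≢1+n
decode-injective {c = s , Fin.suc i , x} {t , Fin.suc j , y} eq with cong proj₁ (VecP.∷-injectiveˡ eq) | FinP.suc-injective (cong proj₂ (VecP.∷-injectiveˡ eq))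
... | refl | refl = cong (λ z → s , Fin.suc i , z) (Vec-map-injective (bend-injective s i) (VecP.∷-injectiveʳ eq))

fixHead-suc : ∀ s (x : SPerm n) j → lookup (fixHead s x) (Fin.suc j) ≡ (sgn x j , Fin.suc (perm x j))
fixHead-suc s x j = VecP.lookup-map j _ x

insertHead-suc : ∀ s i (x : SPerm n) j → lookup (insertHead s i x) (Fin.suc j) ≡ bend s i (lookup x j)
insertHead-suc s i x j = VecP.lookup-map j _ x

bend-≢suc : ∀ s (i : Fin n) p → proj₂ (bend s i p) ≢ Fin.suc i
bend-≢suc s i (r , m) eq with m Fin.≟ i
... | yes _ = contradiction eq FinP.0≢1+n
... | no ne = ne (FinP.suc-injective eq)

Good-decode : ∀ s i {x : SPerm n} → Good x → Good (decode (s , i , x))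
Good-decode s Fin.zero g {Fin.zero} {Fin.zero} eq = refl
Good-decode s Fin.zero {x} g {Fin.zero} {Fin.suc j} eq = contradiction (trans eq (cong proj₂ (fixHead-suc s x j))) FinP.0≢1+n
Good-decode s Fin.zero {x} g {Fin.suc j} {Fin.zero} eq = contradiction (trans (sym eq) (cong proj₂ (fixHead-suc s x j))) FinP.0≢1+n
Good-decode s Fin.zero {x} g {Fin.suc j} {Fin.suc j'} eq = cong Fin.suc (g (FinP.suc-injective
  (trans (sym (cong proj₂ (fixHead-suc s x j))) (trans eq (cong proj₂ (fixHead-suc s x j'))))))
Good-decode s (Fin.suc i) g {Fin.zero} {Fin.zero} eq = refl
Good-decode s (Fin.suc i) {x} g {Fin.zero} {Fin.suc j} eq =
  contradiction (sym (trans eq (cong proj₂ (insertHead-suc s i x j)))) (bend-≢suc s i (lookup x j))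
Good-decode s (Fin.suc i) {x} g {Fin.suc j} {Fin.zero} eq =
  contradiction (trans (sym (cong proj₂ (insertHead-suc s i x j))) eq) (bend-≢suc s i (lookup x j))
Good-decode s (Fin.suc i) {x} g {Fin.suc j} {Fin.suc j'} eq = cong Fin.suc (g (bend-proj₂-injective s i {lookup x j} {lookup x j'}
  (trans (sym (cong proj₂ (insertHead-suc s i x j))) (trans eq (cong proj₂ (insertHead-suc s i x j'))))))

Good-decode⁻ : ∀ s i {x : SPerm n} → Good (decode (s , i , x)) → Good x
Good-decode⁻ s Fin.zero {x} g {j} {j'} eq = FinP.suc-injective (g
  (trans (cong proj₂ (fixHead-suc s x j)) (trans (cong Fin.suc eq) (sym (cong proj₂ (fixHead-suc s x j'))))))
Good-decode⁻ s (Fin.suc i) {x} g {j} {j'} eq = FinP.suc-injective (g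
  (trans (cong proj₂ (insertHead-suc s i x j)) (trans (bend-cong (lookup x j) (lookup x j') eq) (sym (cong proj₂ (insertHead-suc s i x j'))))))
  where
  bend-cong : ∀ p q → proj₂ p ≡ proj₂ q → proj₂ (bend s i p) ≡ proj₂ (bend s i q)
  bend-cong (r , m) (r' , .m) refl with m Fin.≟ i
  ... | yes _ = refl
  ... | no _ = refl

-- The value at zero is junk: fixHead never sends suc j to zero.
unfix : Sign × Fin (suc n) → Fin n → Sign × Fin n
unfix (r , Fin.zero) j = r , j
unfix (r , Fin.suc m) j = r , m

-- The head of `y` names the signed image of 0, and deleting 0 from its cycle gives `x`. Injectivity
-- excludes that another letter shares that image, so every remaining entry can be renamed.
decode-surjective : ∀ {y : SPerm (suc n)} → Good y → ∃ λ c → decode c ≡ y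
decode-surjective {y = (s , Fin.zero) ∷ v} g = (s , Fin.zero , x) , cong ((s , Fin.zero) ∷_) (≡-lookup pointwise)
  where
  x : SPerm _
  x = tabulate (λ j → unfix (lookup v j) j)
  unfix-suc : ∀ p j → proj₂ p ≢ Fin.zero → (proj₁ (unfix p j) , Fin.suc (proj₂ (unfix p j))) ≡ p
  unfix-suc (r , Fin.zero) j ne = contradiction refl ne
  unfix-suc (r , Fin.suc m) j ne = refl
  pointwise : ∀ j → lookup (Vec.map (λ p → proj₁ p , Fin.suc (proj₂ p)) x) j ≡ lookup v j
  pointwise j = trans (VecP.lookup-map j _ x) (trans (cong (λ p → proj₁ p , Fin.suc (proj₂ p)) (VecP.lookup∘tabulate _ j))
    (unfix-suc (lookup v j) j (λ eq → FinP.0≢1+n (g {Fin.zero} {Fin.suc j} (sym eq)))))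
decode-surjective {n = n} {y = (s , Fin.suc i) ∷ v} g = (s , Fin.suc i , x) , cong ((s , Fin.suc i) ∷_) (≡-lookup pointwise)
  where
  unbend : Sign × Fin (suc n) → Sign × Fin n
  -- The arrow into 0 is prolonged to `i`, the image of 0; its sign picks up the sign `s` of the
  -- second arrow.
  unbend (r , Fin.zero) = r Sign.* s , i
  unbend (r , Fin.suc m) = r , m
  x : SPerm _
  x = Vec.map unbend v
  bend-unbend : ∀ p → proj₂ p ≢ Fin.suc i → bend s i (unbend p) ≡ p
  bend-unbend (r , Fin.zero) ne = trans (bend-≡ s i (r Sign.* s) refl)
    (cong (_, Fin.zero) (trans (SignP.*-assoc r s s) (trans (cong (r Sign.*_) (SignP.s*s≡+ s)) (SignP.*-identityʳ r))))
  bend-unbend (r , Fin.suc m) ne = bend-≢ s i r (λ eq → ne (cong Fin.suc eq))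
  pointwise : ∀ j → lookup (Vec.map (bend s i) x) j ≡ lookup v j
  pointwise j = trans (VecP.lookup-map j _ x) (trans (cong (bend s i) (VecP.lookup-map j unbend v))
    (bend-unbend (lookup v j) (λ eq → FinP.0≢1+n (g {Fin.zero} {Fin.suc j} (sym eq)))))

Bn-decode : ∀ n → Bn (suc n) ↭ map decode (cartesianProduct Z2 (cartesianProduct (allFin (suc n)) (Bn n)))
Bn-decode n = unique∧set⇒↭ (Bn-unique (suc n))
  (UniqueP.map⁺ decode-injective (UniqueP.cartesianProduct⁺ Z2-unique (UniqueP.cartesianProduct⁺ (UniqueP.allFin⁺ (suc n)) (Bn-unique n))))
  to from
  where
  to : ∀ y → y ∈ Bn (suc n) → y ∈ map decode (cartesianProduct Z2 (cartesianProduct (allFin (suc n)) (Bn n)))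
  to y m with decode-surjective {y = y} (Good-Bn {x = y} m)
  ... | (s , i , x) , refl = ∈P.∈-map⁺ decode (∈P.∈-cartesianProduct⁺ (∈-Z2 s)
    (∈P.∈-cartesianProduct⁺ (∈P.∈-allFin i) (∈-Bn (Good-decode⁻ s i {x} (Good-Bn {x = y} m)))))
  from : ∀ y → y ∈ map decode (cartesianProduct Z2 (cartesianProduct (allFin (suc n)) (Bn n))) → y ∈ Bn (suc n)
  from y m with ∈P.∈-map⁻ decode m
  ... | (s , i , x) , m' , refl = ∈-Bn (Good-decode s i {x} (Good-Bn {x = x}
    (proj₂ (∈P.∈-cartesianProduct⁻ (allFin (suc n)) (Bn n) (proj₂ (∈P.∈-cartesianProduct⁻ Z2 _ m'))))))

-- Cycle types

iterPerm : SPerm n → ℕ → Fin n → Fin n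
iterPerm x zero i = i
iterPerm x (suc m) i = perm x (iterPerm x m i)

iterSgn : SPerm n → ℕ → Fin n → Sign
iterSgn x zero i = Sign.+
iterSgn x (suc m) i = iterSgn x m i Sign.* sgn x (iterPerm x m i)

lookup-^B : ∀ (x : SPerm n) m i → lookup (x ^B m) i ≡ (iterSgn x m i , iterPerm x m i)
lookup-^B x zero i = lookup-idB i
lookup-^B x (suc m) i = trans (lookup-∘B x (x ^B m) i) (cong (act x) (lookup-^B x m i))

iterPerm-+ : ∀ (x : SPerm n) a b i → iterPerm x (a ℕ.+ b) i ≡ iterPerm x a (iterPerm x b i)
iterPerm-+ x zero b i = refl
iterPerm-+ x (suc a) b i = cong (perm x) (iterPerm-+ x a b i)

iterSgn-+ : ∀ (x : SPerm n) a b i → iterSgn x (a ℕ.+ b) i ≡ iterSgn x b i Sign.* iterSgn x a (iterPerm x b i)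
iterSgn-+ x zero b i = sym (SignP.*-identityʳ _)
iterSgn-+ x (suc a) b i = trans (cong₂ (λ s j → s Sign.* sgn x j) (iterSgn-+ x a b i) (iterPerm-+ x a b i)) (SignP.*-assoc (iterSgn x b i) _ _)

iterPerm-suc : ∀ (x : SPerm n) m i → iterPerm x (suc m) i ≡ iterPerm x m (perm x i)
iterPerm-suc x m i = trans (cong (λ q → iterPerm x q i) (ℕP.+-comm 1 m)) (iterPerm-+ x m 1 i)

iterPerm-injective : ∀ {x : SPerm n} → Good x → ∀ m {i j} → iterPerm x m i ≡ iterPerm x m j → i ≡ j
iterPerm-injective {x = x} g zero eq = eq
iterPerm-injective {x = x} g (suc m) eq = iterPerm-injective {x = x} g m (g eq)

iterPerm-* : ∀ (x : SPerm n) l i → iterPerm x l i ≡ i → ∀ m → iterPerm x (m ℕ.* l) i ≡ i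
iterPerm-* x l i eq zero = refl
iterPerm-* x l i eq (suc m) = trans (iterPerm-+ x l (m ℕ.* l) i) (trans (cong (iterPerm x l) (iterPerm-* x l i eq m)) eq)

iterSgn-* : ∀ (x : SPerm n) l i → iterPerm x l i ≡ i → ∀ m → iterSgn x (m ℕ.* l) i ≡ signPow (iterSgn x l i) m
iterSgn-* x l i eq zero = refl
iterSgn-* x l i eq (suc m) = trans (iterSgn-+ x l (m ℕ.* l) i)
  (trans (cong₂ (λ s j → s Sign.* iterSgn x l j) (iterSgn-* x l i eq m) (iterPerm-* x l i eq m)) (SignP.*-comm (signPow _ m) _))

iterPerm-^B : ∀ (x : SPerm n) k m i → iterPerm (x ^B k) m i ≡ iterPerm x (m ℕ.* k) i
iterPerm-^B x k zero i = refl
iterPerm-^B x k (suc m) i = trans (cong (perm (x ^B k)) (iterPerm-^B x k m i))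
  (trans (cong proj₂ (lookup-^B x k _)) (sym (iterPerm-+ x k (m ℕ.* k) i)))

iterSgn-^B : ∀ (x : SPerm n) k m i → iterSgn (x ^B k) m i ≡ iterSgn x (m ℕ.* k) i
iterSgn-^B x k zero i = refl
iterSgn-^B x k (suc m) i = trans (cong₂ Sign._*_ (iterSgn-^B x k m i)
    (trans (cong (sgn (x ^B k)) (iterPerm-^B x k m i)) (cong proj₁ (lookup-^B x k _))))
  (sym (iterSgn-+ x k (m ℕ.* k) i))

-- Bounded search: the first number is fuel, the second the current candidate, which is returned
-- when the fuel runs out.
findFirst : (ℕ → Bool) → ℕ → ℕ → ℕ
findFirst p zero m = m
findFirst p (suc f) m = if p m then m else findFirst p f (suc m)

findFirst-before : ∀ (p : ℕ → Bool) f m q → m ≤ q → q < findFirst p f m → p q ≡ false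
findFirst-before p zero m q m≤q q<m = contradiction q<m (ℕP.≤⇒≯ m≤q)
findFirst-before p (suc f) m q m≤q q< with p m in eq
... | true = contradiction q< (ℕP.≤⇒≯ m≤q)
... | false with m ℕ.≟ q
...   | yes refl = eq
...   | no ne = findFirst-before p f (suc m) q (ℕP.≤∧≢⇒< m≤q ne) q<

findFirst-true : ∀ (p : ℕ → Bool) f m q → m ≤ q → q < m ℕ.+ f → p q ≡ true → p (findFirst p f m) ≡ true
findFirst-true p zero m q m≤q q< _ = contradiction (subst (q <_) (ℕP.+-identityʳ m) q<) (ℕP.≤⇒≯ m≤q)
findFirst-true p (suc f) m q m≤q q< pq with p m in eq
... | true = eq
... | false with m ℕ.≟ q
...   | yes refl = contradiction (trans (sym eq) pq) λ ()
...   | no ne = findFirst-true p f (suc m) q (ℕP.≤∧≢⇒< m≤q ne) (subst (q <_) (ℕP.+-suc m f) q<) pq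

-- As in Defs, (l , ε) encodes a cycle of length suc l and class ε.
Type : Set
Type = ℕ × Sign

returns : SPerm n → Fin n → ℕ → Bool
returns x i m = does (iterPerm x (suc m) i Fin.≟ i)

-- Fuel `n` is enough by `recurrence`. The class is the sign collected in one full turn: it is +
-- when the signed letter itself returns, and - when its negative does.
type : SPerm n → Fin n → Type
type {n} x i = l , iterSgn x (suc l) i
  where l = findFirst (returns x i) n 0

-- Characterises the type without the search; types are computed by exhibiting this and appealing to
-- uniqueness.
IsType : SPerm n → Fin n → Type → Set
IsType x i (l , ε) = iterPerm x (suc l) i ≡ i × iterSgn x (suc l) i ≡ ε × (∀ m → m < l → iterPerm x (suc m) i ≢ i)

-- Among the first n + 1 iterates two coincide by the pigeonhole principle, and injectivity cancels
-- the steps common to both.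
recurrence : ∀ {x : SPerm n} → Good x → ∀ i → ∃ λ m → m < n × iterPerm x (suc m) i ≡ i
recurrence {n} {x} g i with FinP.pigeonhole {n} {suc n} (ℕP.n<1+n n) (λ a → iterPerm x (toℕ a) i)
... | a , b , a<b , eq = d , d<n , iterPerm-injective {x = x} g (toℕ a) (trans (sym (iterPerm-+ x (toℕ a) (suc d) i)) (trans (cong (λ q → iterPerm x q i) ad) (sym eq)))
  where
  d : ℕ
  d = toℕ b ∸ suc (toℕ a)
  ad : toℕ a ℕ.+ suc d ≡ toℕ b
  ad = trans (ℕP.+-suc (toℕ a) d) (ℕP.m+[n∸m]≡n a<b)
  d<n : d < n
  d<n = ℕP.≤-trans (subst (suc d ≤_) ad (ℕP.m≤n+m (suc d) (toℕ a))) (FinP.toℕ≤pred[n] b)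

does⇒ : ∀ {P : Set} (p : Dec P) → does p ≡ true → P
does⇒ (yes p) _ = p
does⇒ (no _) ()

type-isType : ∀ {x : SPerm n} → Good x → ∀ i → IsType x i (type x i)
type-isType {n} {x} g i with recurrence {x = x} g i
... | q , q<n , eq = does⇒ (iterPerm x (suc (proj₁ (type x i))) i Fin.≟ i) (findFirst-true (returns x i) n 0 q z≤n q<n (dec-true (iterPerm x (suc q) i Fin.≟ i) eq)) , refl ,
  λ m m< eq' → contradiction (trans (sym (dec-true (iterPerm x (suc m) i Fin.≟ i) eq')) (findFirst-before (returns x i) n 0 m z≤n m<)) λ ()

isType-unique : ∀ {x : SPerm n} {i t u} → IsType x i t → IsType x i u → t ≡ u
isType-unique {t = l , ε} {l' , ε'} (p , e , h) (p' , e' , h') with ℕP.<-cmp l l'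
... | tri< lt _ _ = contradiction p (h' l lt)
... | tri≈ _ refl _ = cong (l ,_) (trans (sym e) e')
... | tri> _ _ gt = contradiction p' (h l' gt)

type-≡ : ∀ {x : SPerm n} → Good x → ∀ {i t} → IsType x i t → type x i ≡ t
type-≡ {x = x} g {i} {t} p = isType-unique {x = x} {i = i} (type-isType {x = x} g i) p

-- The remainder of a return time modulo the period is again a return time; being smaller than the
-- minimal one, it is 0.
isType-∣ : ∀ {x : SPerm n} {i l ε} → IsType x i (l , ε) → ∀ m → iterPerm x m i ≡ i → suc l ∣ m
isType-∣ {x = x} {i} {l} (p , _ , h) m eq with m DivMod.% suc l in eqr
... | zero = Div.m%n≡0⇒n∣m m (suc l) eqr
... | suc r = contradiction (trans (cong (λ z → iterPerm x z i) (sym eqr)) eq') (h r (ℕP.≤-pred (subst (_< suc l) eqr (DivMod.m%n<n m (suc l)))))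
  where
  eq' : iterPerm x (m DivMod.% suc l) i ≡ i
  eq' = trans (cong (iterPerm x (m DivMod.% suc l)) (sym (iterPerm-* x (suc l) i p (m DivMod./ suc l))))
    (trans (sym (iterPerm-+ x (m DivMod.% suc l) _ i))
      (trans (cong (λ z → iterPerm x z i) (sym (DivMod.m≡m%n+[m/n]*n m (suc l)))) eq))

-- The signed map sending i to s(i)·q(i) carries `y` to `z`. Conjugation, a fixed letter added in
-- front, and the blocks of a direct sum are all of this kind.
module _ {n m : ℕ} (z : SPerm m) (y : SPerm n) (q : Fin n → Fin m) (s : Fin n → Sign)
  (h : ∀ i → perm z (q i) ≡ q (perm y i)) (hs : ∀ i → s i Sign.* sgn z (q i) ≡ sgn y i Sign.* s (perm y i)) where

  iterPerm-intertwined : ∀ k i → iterPerm z k (q i) ≡ q (iterPerm y k i)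
  iterPerm-intertwined zero i = refl
  iterPerm-intertwined (suc k) i = trans (cong (perm z) (iterPerm-intertwined k i)) (h _)

  iterSgn-intertwined : ∀ k i → s i Sign.* iterSgn z k (q i) ≡ iterSgn y k i Sign.* s (iterPerm y k i)
  iterSgn-intertwined zero i = SignP.*-comm (s i) Sign.+
  iterSgn-intertwined (suc k) i = begin
    s i Sign.* (iterSgn z k (q i) Sign.* sgn z (iterPerm z k (q i)))         ≡⟨ SignP.*-assoc (s i) _ _ ⟨
    (s i Sign.* iterSgn z k (q i)) Sign.* sgn z (iterPerm z k (q i))         ≡⟨ cong₂ (λ a b → a Sign.* sgn z b) (iterSgn-intertwined k i) (iterPerm-intertwined k i) ⟩
    (iterSgn y k i Sign.* s (iterPerm y k i)) Sign.* sgn z (q (iterPerm y k i)) ≡⟨ SignP.*-assoc (iterSgn y k i) _ _ ⟩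
    iterSgn y k i Sign.* (s (iterPerm y k i) Sign.* sgn z (q (iterPerm y k i))) ≡⟨ cong (iterSgn y k i Sign.*_) (hs _) ⟩
    iterSgn y k i Sign.* (sgn y (iterPerm y k i) Sign.* s (iterPerm y (suc k) i)) ≡⟨ SignP.*-assoc (iterSgn y k i) _ _ ⟨
    iterSgn y (suc k) i Sign.* s (iterPerm y (suc k) i) ∎
    where open ≡-Reasoning

  -- On a closed orbit the relabelling sign occurs once at the start and once at the end, at the
  -- same letter, so it cancels and the class is kept.
  isType-intertwined : (∀ {i j} → q i ≡ q j → i ≡ j) → ∀ {i t} → IsType y i t → IsType z (q i) t
  isType-intertwined q-injective {i} {l , ε} (p , e , mini) =
    trans (iterPerm-intertwined (suc l) i) (cong q p) ,
    trans (SignP.*-cancelˡ-≡ (s i) _ _ (trans (iterSgn-intertwined (suc l) i)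
      (trans (cong (λ j → iterSgn y (suc l) i Sign.* s j) p) (SignP.*-comm _ (s i))))) e ,
    λ m m<l eq → mini m m<l (q-injective (trans (sym (iterPerm-intertwined (suc m) i)) eq))

type-conjugate : ∀ {z g y : SPerm n} → Good z → Good g → Good y → z ∘B g ≡ g ∘B y → ∀ i → type z (perm g i) ≡ type y i
type-conjugate {z = z} {g} {y} gz gg gy eq i = type-≡ {x = z} gz (isType-intertwined z y (perm g) (sgn g)
  (λ j → trans (sym (perm-∘B z g j)) (trans (cong (λ w → perm w j) eq) (perm-∘B g y j)))
  (λ j → trans (sym (sgn-∘B z g j)) (trans (cong (λ w → sgn w j) eq) (sgn-∘B g y j)))
  gg (type-isType {x = y} gy i))

Good-^B : ∀ {x : SPerm n} → Good x → ∀ k → Good (x ^B k)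
Good-^B {x = x} g k {i} {j} eq = iterPerm-injective {x = x} g k
  (trans (sym (cong proj₂ (lookup-^B x k i))) (trans eq (cong proj₂ (lookup-^B x k j))))

-- The type of the cycles into which the k-th power splits a cycle of the given type.
powerType : ℕ → Type → Type
powerType k (l , ε) = ℕ.pred (suc l div gcd (suc l) k) , signPow ε (k div gcd (suc l) k)

-- Quotients by the gcd as witnesses with equations. Coprimality gives minimality of the period of a
-- power, and later places the pair among the summation indices on the right side.
record GcdSplit (k l : ℕ) : Set where
  field
    j' h : ℕ
    l-eq : suc l ≡ suc j' ℕ.* gcd (suc l) k
    k-eq : k ≡ h ℕ.* gcd (suc l) k
    pow : ∀ ε → powerType k (l , ε) ≡ (j' , signPow ε h)
    jg : suc l div gcd (suc l) k ≡ suc j'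
    hg : k div gcd (suc l) k ≡ h
    cop : Coprimality.Coprime (suc j') h

gcdSplit : ∀ k l → GcdSplit k l
gcdSplit k l with gcd (suc l) k in eqg | GCD.gcd[m,n]∣m (suc l) k | GCD.gcd[m,n]∣n (suc l) k
... | zero | divides q eq | _ = contradiction (trans eq (ℕP.*-zeroʳ q)) λ ()
... | suc g | divides zero () | _
... | suc g | divides (suc j') eql | divides h eqk = record
  { j' = j' ; h = h
  ; l-eq = trans eql (cong (suc j' ℕ.*_) (sym eqg))
  ; k-eq = trans eqk (cong (h ℕ.*_) (sym eqg))
  ; pow = λ ε → cong₂ (λ a b → ℕ.pred a , signPow ε b) (trans (cong (suc l div_) eqg) jg) (trans (cong (k div_) eqg) hg)
  ; jg = trans (cong (suc l div_) eqg) jg ; hg = trans (cong (k div_) eqg) hg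
  ; cop = λ {d} → λ { (divides a ea , divides b eb) → coprime d a b ea eb } }
  where
  jg : suc l div suc g ≡ suc j'
  jg = trans (DivMod./-congˡ {o = suc g} eql) (DivMod.m*n/n≡m (suc j') (suc g))
  hg : k div suc g ≡ h
  hg = trans (DivMod./-congˡ {o = suc g} eqk) (DivMod.m*n/n≡m h (suc g))
  -- If d divides both quotients, then d times the gcd is a common divisor, hence divides the gcd,
  -- and d = 1.
  coprime : ∀ d a b → suc j' ≡ a ℕ.* d → h ≡ b ℕ.* d → d ≡ 1
  coprime d a b ea eb = ℕP.*-cancelʳ-≡ d 1 (suc g) (Div.∣-antisym
    (subst (d ℕ.* suc g ∣_) (trans eqg (sym (ℕP.*-identityˡ (suc g)))) (GCD.gcd-greatest
      (divides a (trans eql (trans (cong (ℕ._* suc g) ea) (ℕP.*-assoc a d (suc g)))))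
      (divides b (trans eqk (trans (cong (ℕ._* suc g) eb) (ℕP.*-assoc b d (suc g)))))))
    (divides d (cong (d ℕ.*_) (sym (ℕP.*-identityˡ (suc g))))))

-- With g the gcd, j k = h l: j steps of the power are h full turns of the original cycle, whence
-- the class ε^h. An earlier return after m steps would make l divide m k, so j divide h m, and by
-- coprimality j divide m.
isType-^B : ∀ {x : SPerm n} k {i t} → IsType x i t → IsType (x ^B k) i (powerType k t)
isType-^B {x = x} k {i} {l , ε} isT@(p , e , mini) = subst (IsType (x ^B k) i) (sym (pow ε)) (
  trans (iterPerm-^B x k (suc j') i) (trans (cong (λ q → iterPerm x q i) jk) (iterPerm-* x (suc l) i p h)) ,
  trans (iterSgn-^B x k (suc j') i) (trans (cong (λ q → iterSgn x q i) jk)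
    (trans (iterSgn-* x (suc l) i p h) (cong (λ s → signPow s h) e))) ,
  λ m m<j' eq → ℕP.<⇒≱ (s≤s m<j') (Div.∣⇒≤ (Coprimality.coprime-divisor cop (j∣mh m
    (isType-∣ {x = x} {i = i} isT (suc m ℕ.* k) (trans (sym (iterPerm-^B x k (suc m) i)) eq)))))
  )
  where
  open GcdSplit (gcdSplit k l)
  G = gcd (suc l) k
  jk : suc j' ℕ.* k ≡ h ℕ.* suc l
  jk = begin
    suc j' ℕ.* k ≡⟨ cong (suc j' ℕ.*_) k-eq ⟩
    suc j' ℕ.* (h ℕ.* G) ≡⟨ cong (suc j' ℕ.*_) (ℕP.*-comm h G) ⟩
    suc j' ℕ.* (G ℕ.* h) ≡⟨ ℕP.*-assoc (suc j') G h ⟨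
    (suc j' ℕ.* G) ℕ.* h ≡⟨ cong (ℕ._* h) l-eq ⟨
    suc l ℕ.* h ≡⟨ ℕP.*-comm (suc l) h ⟩
    h ℕ.* suc l ∎
    where open ≡-Reasoning
  j∣mh : ∀ m → suc l ∣ suc m ℕ.* k → suc j' ∣ h ℕ.* suc m
  j∣mh m d = Div.*-cancelʳ-∣ G {{ℕ.>-nonZero G>0}} (subst₂ _∣_ l-eq (trans (cong (suc m ℕ.*_) k-eq)
    (trans (sym (ℕP.*-assoc (suc m) h G)) (cong (ℕ._* G) (ℕP.*-comm (suc m) h)))) d)
    where
    G>0 : 0 < G
    G>0 = ℕP.n≢0⇒n>0 (λ eq → contradiction (trans l-eq (trans (cong (suc j' ℕ.*_) eq) (ℕP.*-zeroʳ (suc j')))) λ ())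

type-^B : ∀ {x : SPerm n} → Good x → ∀ k i → type (x ^B k) i ≡ powerType k (type x i)
type-^B {x = x} g k i = type-≡ {x = x ^B k} (Good-^B {x = x} g k) (isType-^B {x = x} k (type-isType {x = x} g i))

-- Inverses, orbits and the multiset of letter types

inverse : SPerm n → SPerm n
inverse x = tabulate (λ i → iterSgn x (suc (proj₁ (type x i))) i Sign.* iterSgn x (proj₁ (type x i)) i , iterPerm x (proj₁ (type x i)) i)

-- The predecessor of a letter is its last iterate before the return. The sign chosen in `inverse`
-- makes the sign of a full turn appear twice, hence cancel.
inverseʳ : ∀ {x : SPerm n} → Good x → x ∘B inverse x ≡ idB
inverseʳ {x = x} g = ≡-lookup λ i → trans (lookup-∘B x (inverse x) i)
  (trans (cong (act x) (VecP.lookup∘tabulate _ i)) (trans (cong₂ _,_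
     (trans (SignP.*-assoc (iterSgn x (suc (proj₁ (type x i))) i) _ _) (SignP.s*s≡+ (iterSgn x (suc (proj₁ (type x i))) i)))
     (proj₁ (type-isType {x = x} g i))) (sym (lookup-idB i))))

Good-inverse : ∀ {x : SPerm n} → Good x → Good (inverse x)
Good-inverse {x = x} g {i} {j} eq = trans (sym (right i)) (trans (cong (perm x) eq) (right j))
  where
  right : ∀ i → perm x (perm (inverse x) i) ≡ i
  right i = trans (sym (perm-∘B x (inverse x) i)) (trans (cong (λ w → perm w i) (inverseʳ {x = x} g)) (cong proj₂ (lookup-idB i)))

∘B-cancelˡ : ∀ {x : SPerm n} → Good x → ∀ {y z} → x ∘B y ≡ x ∘B z → y ≡ z
∘B-cancelˡ {x = x} g {y} {z} eq = ≡-lookup λ i → act-injective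
  (trans (sym (lookup-∘B x y i)) (trans (cong (λ w → lookup w i) eq) (lookup-∘B x z i)))
  where
  act-injective : ∀ {p q} → act x p ≡ act x q → p ≡ q
  act-injective {s , i} {s' , j} e with g (cong proj₂ e)
  ... | refl = cong (_, i) (SignP.*-cancelʳ-≡ (sgn x i) s s' (cong proj₁ e))

inverseˡ : ∀ {x : SPerm n} → Good x → inverse x ∘B x ≡ idB
inverseˡ {x = x} g = ∘B-cancelˡ {x = x} g (begin
  x ∘B (inverse x ∘B x) ≡⟨ ∘B-assoc x (inverse x) x ⟨
  (x ∘B inverse x) ∘B x ≡⟨ cong (_∘B x) (inverseʳ {x = x} g) ⟩
  idB ∘B x ≡⟨ ∘B-identityˡ x ⟩
  x ≡⟨ ∘B-identityʳ x ⟨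
  x ∘B idB ∎)
  where open ≡-Reasoning

-- A cycle of length l contributes l equal entries, just as it contributes the l-th power of a
-- variable to the monomial.
types : SPerm n → List Type
types {n} x = map (type x) (allFin n)

orbit : SPerm n → Fin n → List (Fin n)
orbit x i = map (λ m → iterPerm x m i) (upTo (suc (proj₁ (type x i))))

_∈ᶠ?_ : ∀ (i : Fin n) xs → Dec (i ∈ xs)
_∈ᶠ?_ = DecMem._∈?_ Fin._≟_

outsideOrbit : SPerm n → Fin n → List (Fin n)
outsideOrbit {n} x i = filter (λ j → ¬? (j ∈ᶠ? orbit x i)) (allFin n)

otherTypes : SPerm n → Fin n → List Type
otherTypes x i = map (type x) (outsideOrbit x i)

type-perm : ∀ {x : SPerm n} → Good x → ∀ i → type x (perm x i) ≡ type x i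
type-perm {x = x} g i = type-conjugate {z = x} {x} {x} g g g refl i

type-iterPerm : ∀ {x : SPerm n} → Good x → ∀ i m → type x (iterPerm x m i) ≡ type x i
type-iterPerm g i zero = refl
type-iterPerm {x = x} g i (suc m) = trans (type-perm {x = x} g _) (type-iterPerm {x = x} g i m)

map-const-∈ : ∀ {A B : Set} (f : A → B) (b : B) xs → (∀ a → a ∈ xs → f a ≡ b) → map f xs ≡ replicate (length xs) b
map-const-∈ f b [] h = refl
map-const-∈ f b (x ∷ xs) h = cong₂ _∷_ (h x (here refl)) (map-const-∈ f b xs (λ a m → h a (there m)))

orbit-types : ∀ {x : SPerm n} → Good x → ∀ i → map (type x) (orbit x i) ≡ replicate (suc (proj₁ (type x i))) (type x i)
orbit-types {x = x} g i = trans (map-const-∈ (type x) (type x i) (orbit x i) const)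
  (cong (λ q → replicate q (type x i)) (trans (ListP.length-map _ (upTo L)) (ListP.length-upTo L)))
  where
  L = suc (proj₁ (type x i))
  const : ∀ a → a ∈ orbit x i → type x a ≡ type x i
  const a m with ∈P.∈-map⁻ (λ q → iterPerm x q i) {xs = upTo (suc (proj₁ (type x i)))} m
  ... | q , _ , refl = type-iterPerm {x = x} g i q

∈-orbit : ∀ {x : SPerm n} → Good x → ∀ i m → iterPerm x m i ∈ orbit x i
∈-orbit {x = x} g i m = subst (_∈ orbit x i) eq (∈P.∈-map⁺ (λ q → iterPerm x q i) (∈P.∈-upTo⁺ (DivMod.m%n<n m L)))
  where
  L = suc (proj₁ (type x i))
  eq : iterPerm x (m DivMod.% L) i ≡ iterPerm x m i
  eq = trans (cong (iterPerm x (m DivMod.% L)) (sym (iterPerm-* x L i (proj₁ (type-isType {x = x} g i)) (m DivMod./ L))))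
    (trans (sym (iterPerm-+ x (m DivMod.% L) _ i)) (cong (λ z → iterPerm x z i) (sym (DivMod.m≡m%n+[m/n]*n m L))))

-- After the `a` steps from `j` to `i`, another `a * l` steps make `a` full turns of length l + 1,
-- ending at `j`.
reverse-orbit : ∀ {x : SPerm n} → Good x → ∀ i j a → iterPerm x a j ≡ i → ∃ λ b → iterPerm x b i ≡ j
reverse-orbit {x = x} g i j a refl = a ℕ.* l , trans (sym (iterPerm-+ x (a ℕ.* l) a j))
  (trans (cong (λ q → iterPerm x q j) (trans (ℕP.+-comm (a ℕ.* l) a) (sym (ℕP.*-suc a l))))
    (iterPerm-* x (suc l) j (proj₁ (type-isType {x = x} g j)) a))
  where l = proj₁ (type x j)

applyUpTo-unique : ∀ {A : Set} (f : ℕ → A) L → (∀ a b → a < b → b < L → f a ≢ f b) → Unique (map f (upTo L))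
applyUpTo-unique f L h = subst Unique (sym (ListP.map-upTo f L)) (UniqueP.applyUpTo⁺₁ f L (λ {i} {j} i<j j<L → h i j i<j j<L))

orbit-unique : ∀ {x : SPerm n} → Good x → ∀ i → Unique (orbit x i)
orbit-unique {x = x} g i = applyUpTo-unique (λ m → iterPerm x m i) L distinct
  where
  L = suc (proj₁ (type x i))
  distinct : ∀ a b → a < b → b < L → iterPerm x a i ≢ iterPerm x b i
  distinct a b a<b b<L eq = proj₂ (proj₂ (type-isType {x = x} g i)) d
    (ℕP.≤-trans (subst (suc d ≤_) ad (ℕP.m≤n+m (suc d) a)) (ℕP.≤-pred b<L))
    (iterPerm-injective {x = x} g a (trans (sym (iterPerm-+ x a (suc d) i)) (trans (cong (λ q → iterPerm x q i) ad) (sym eq))))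
    where
    d : ℕ
    d = b ∸ suc a
    ad : a ℕ.+ suc d ≡ b
    ad = trans (ℕP.+-suc a d) (ℕP.m+[n∸m]≡n a<b)

↭-filter-¬ : ∀ {A : Set} {P : A → Set} (P? : ∀ a → Dec (P a)) xs →
  xs ↭ filter P? xs ++ filter (λ a → ¬? (P? a)) xs
↭-filter-¬ P? [] = ↭-refl
↭-filter-¬ P? (x ∷ xs) with P? x
... | yes _ = ↭.prep x (↭-filter-¬ P? xs)
... | no _ = ↭-trans (↭.prep x (↭-filter-¬ P? xs)) (↭-sym (↭P.shift x (filter P? xs) _))

orbit-filter : ∀ {x : SPerm n} → Good x → ∀ i → filter (_∈ᶠ? orbit x i) (allFin n) ↭ orbit x i
orbit-filter {n} {x} g i = unique∧set⇒↭ (UniqueP.filter⁺ (_∈ᶠ? orbit x i) (UniqueP.allFin⁺ n)) (orbit-unique {x = x} g i)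
  (λ j m → proj₂ (∈P.∈-filter⁻ (_∈ᶠ? orbit x i) {xs = allFin n} m))
  (λ j m → ∈P.∈-filter⁺ (_∈ᶠ? orbit x i) (∈P.∈-allFin j) m)

types-split : ∀ {x : SPerm n} → Good x → ∀ i →
  types x ↭ replicate (suc (proj₁ (type x i))) (type x i) ++ otherTypes x i
types-split {n} {x} g i = ↭-trans (↭P.map⁺ (type x) (↭-trans (↭-filter-¬ (_∈ᶠ? orbit x i) (allFin n)) (↭P.++⁺ʳ _ (orbit-filter {x = x} g i))))
  (↭.↭-reflexive (trans (ListP.map-++ (type x) (orbit x i) _) (cong (_++ otherTypes x i) (orbit-types {x = x} g i))))

map-perm-↭ : ∀ {g : SPerm n} → Good g → map (perm g) (allFin n) ↭ allFin n
map-perm-↭ {n} {g} gg = unique∧set⇒↭ (UniqueP.map⁺ gg (UniqueP.allFin⁺ n)) (UniqueP.allFin⁺ n) (λ j _ → ∈P.∈-allFin j)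
  (λ j _ → subst (_∈ map (perm g) (allFin n)) (proj₁ (type-isType {x = g} gg j)) (∈P.∈-map⁺ (perm g) (∈P.∈-allFin _)))

types-conjugate : ∀ {z g y : SPerm n} → Good z → Good g → Good y → z ∘B g ≡ g ∘B y → types z ↭ types y
types-conjugate {n} {z} {g} {y} gz gg gy eq = ↭-trans (↭-sym (↭P.map⁺ (type z) (map-perm-↭ {g = g} gg)))
  (↭.↭-reflexive (trans (sym (ListP.map-∘ (allFin n))) (ListP.map-cong (type-conjugate {z = z} {g} {y} gz gg gy eq) (allFin n))))

++-cancelˡ-↭ : ∀ {A : Set} (xs : List A) {ys zs} → xs ++ ys ↭ xs ++ zs → ys ↭ zs
++-cancelˡ-↭ [] p = p
++-cancelˡ-↭ (x ∷ xs) p = ++-cancelˡ-↭ xs (↭P.drop-∷ p)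

-- Both full multisets agree, and so do the parts belonging to the chosen cycle; cancelling these
-- compares the complements.
otherTypes-conjugate : ∀ {z g y : SPerm n} → Good z → Good g → Good y → z ∘B g ≡ g ∘B y → ∀ i →
  otherTypes z (perm g i) ↭ otherTypes y i
otherTypes-conjugate {z = z} {g} {y} gz gg gy eq i = ++-cancelˡ-↭ (replicate (suc (proj₁ (type y i))) (type y i))
  (↭-trans (subst (λ t → replicate (suc (proj₁ t)) t ++ otherTypes z (perm g i) ↭ types z) (type-conjugate {z = z} {g} {y} gz gg gy eq i)
     (↭-sym (types-split {x = z} gz (perm g i))))
    (↭-trans (types-conjugate {z = z} {g} {y} gz gg gy eq) (types-split {x = y} gy i)))

map-filter-map : ∀ {A B C : Set} {P : B → Set} {Q : A → Set} (P? : ∀ b → Dec (P b)) (Q? : ∀ a → Dec (Q a))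
  (f : A → B) (t : B → C) (u : A → C) → (∀ a → P (f a) → Q a) → (∀ a → Q a → P (f a)) → (∀ a → Q a → t (f a) ≡ u a) →
  ∀ xs → map t (filter P? (map f xs)) ≡ map u (filter Q? xs)
map-filter-map P? Q? f t u h h' e [] = refl
map-filter-map P? Q? f t u h h' e (x ∷ xs) with P? (f x) | Q? x
... | yes _ | yes q = cong₂ _∷_ (e x q) (map-filter-map P? Q? f t u h h' e xs)
... | no _ | no _ = map-filter-map P? Q? f t u h h' e xs
... | yes p | no ¬q = contradiction (h x p) ¬q
... | no ¬p | yes q = contradiction (h' x q) ¬p

allFin-suc : ∀ n → allFin (suc n) ≡ Fin.zero ∷ map Fin.suc (allFin n)
allFin-suc n = cong (Fin.zero ∷_) (sym (ListP.map-tabulate id Fin.suc))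

-- Types after a letter has been added

module FixHead {n} (s : Sign) {x : SPerm n} (g : Good x) where
  private
    y = fixHead s x
    gy : Good y
    gy = Good-decode s Fin.zero {x} g

  type-suc : ∀ j → type y (Fin.suc j) ≡ type x j
  type-suc j = type-≡ {x = y} gy (isType-intertwined y x Fin.suc (λ _ → Sign.+)
    (λ i → cong proj₂ (fixHead-suc s x i)) (λ i → trans (cong proj₁ (fixHead-suc s x i)) (sym (SignP.*-identityʳ _)))
    FinP.suc-injective (type-isType {x = x} g j))

  types-fixHead : types y ≡ (0 , s) ∷ types x
  types-fixHead = trans (cong (map (type y)) (allFin-suc n)) (cong ((0 , s) ∷_)
    (trans (sym (ListP.map-∘ (allFin n))) (ListP.map-cong type-suc (allFin n))))

  otherTypes-zero : otherTypes y Fin.zero ↭ types x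
  otherTypes-zero = ↭P.drop-∷ (↭-trans (↭-sym (types-split {x = y} gy Fin.zero)) (↭.↭-reflexive types-fixHead))

module InsertHead {n} (s : Sign) (i : Fin n) {x : SPerm n} (g : Good x) where
  private
    y = insertHead s i x
    gy : Good y
    gy = Good-decode s (Fin.suc i) {x} g
    l = proj₁ (type x i)
    ε = proj₂ (type x i)
    isT : IsType x i (l , ε)
    isT = type-isType {x = x} g i

  lookup-suc-≢ : ∀ j → perm x j ≢ i → lookup y (Fin.suc j) ≡ (sgn x j , Fin.suc (perm x j))
  lookup-suc-≢ j ne = trans (insertHead-suc s i x j) (bend-≢ s i (sgn x j) ne)

  lookup-suc-≡ : ∀ j → perm x j ≡ i → lookup y (Fin.suc j) ≡ (sgn x j Sign.* s , Fin.zero)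
  lookup-suc-≡ j eq = trans (insertHead-suc s i x j) (bend-≡ s i (sgn x j) eq)

  -- The orbit of 0 follows that of `i` one step behind. The diverted arrow is the one returning to
  -- `i`, and minimality of the period keeps it away until the last step.
  iterPerm-zero : ∀ q → q ≤ l → iterPerm y (suc q) Fin.zero ≡ Fin.suc (iterPerm x q i)
  iterPerm-zero zero _ = refl
  iterPerm-zero (suc q) q<l = trans (cong (perm y) (iterPerm-zero q (ℕP.<⇒≤ q<l)))
    (cong proj₂ (lookup-suc-≢ (iterPerm x q i) (proj₂ (proj₂ isT) q q<l)))

  iterSgn-zero : ∀ q → q ≤ l → iterSgn y (suc q) Fin.zero ≡ s Sign.* iterSgn x q i
  iterSgn-zero zero _ = sym (SignP.*-identityʳ s)
  iterSgn-zero (suc q) q<l = trans (cong₂ (λ a b → a Sign.* sgn y b) (iterSgn-zero q (ℕP.<⇒≤ q<l)) (iterPerm-zero q (ℕP.<⇒≤ q<l)))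
    (trans (cong (λ z → (s Sign.* iterSgn x q i) Sign.* proj₁ z) (lookup-suc-≢ (iterPerm x q i) (proj₂ (proj₂ isT) q q<l)))
      (SignP.*-assoc s (iterSgn x q i) _))

  type-zero : type y Fin.zero ≡ (suc l , ε)
  type-zero = type-≡ {x = y} gy (
    trans (cong (perm y) (iterPerm-zero l ℕP.≤-refl)) (cong proj₂ last) ,
    trans (cong₂ (λ a b → a Sign.* sgn y b) (iterSgn-zero l ℕP.≤-refl) (iterPerm-zero l ℕP.≤-refl))
      (trans (cong (λ z → (s Sign.* iterSgn x l i) Sign.* proj₁ z) last) (cancel (iterSgn x l i) _)) ,
    λ m m<l eq → FinP.0≢1+n (sym (trans (sym (iterPerm-zero m (ℕP.≤-pred m<l))) eq)))
    where
    last : lookup y (Fin.suc (iterPerm x l i)) ≡ (sgn x (iterPerm x l i) Sign.* s , Fin.zero)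
    last = lookup-suc-≡ (iterPerm x l i) (proj₁ isT)
    cancel : ∀ a b → (s Sign.* a) Sign.* (b Sign.* s) ≡ a Sign.* b
    cancel a b = begin
      (s Sign.* a) Sign.* (b Sign.* s) ≡⟨ SignP.*-assoc s a _ ⟩
      s Sign.* (a Sign.* (b Sign.* s)) ≡⟨ cong (s Sign.*_) (SignP.*-assoc a b s) ⟨
      s Sign.* ((a Sign.* b) Sign.* s) ≡⟨ cong (s Sign.*_) (SignP.*-comm (a Sign.* b) s) ⟩
      s Sign.* (s Sign.* (a Sign.* b)) ≡⟨ SignP.*-assoc s s _ ⟨
      (s Sign.* s) Sign.* (a Sign.* b) ≡⟨ cong (Sign._* (a Sign.* b)) (SignP.s*s≡+ s) ⟩
      a Sign.* b ∎
      where open ≡-Reasoning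

  ∈-orbit⁺ : ∀ j → j ∈ orbit x i → Fin.suc j ∈ orbit y Fin.zero
  ∈-orbit⁺ j m with ∈P.∈-map⁻ (λ q → iterPerm x q i) {xs = upTo (suc (proj₁ (type x i)))} m
  ... | q , q∈ , refl = subst (_∈ orbit y Fin.zero) (iterPerm-zero q (ℕP.≤-pred (∈P.∈-upTo⁻ q∈))) (∈-orbit {x = y} gy Fin.zero (suc q))

  ∈-orbit⁻ : ∀ j → Fin.suc j ∈ orbit y Fin.zero → j ∈ orbit x i
  ∈-orbit⁻ j m with ∈P.∈-map⁻ (λ q → iterPerm y q Fin.zero) {xs = upTo (suc (proj₁ (type y Fin.zero)))} m
  ... | zero , _ , ()
  ... | suc q , q∈ , eq = subst (_∈ orbit x i) (sym (FinP.suc-injective (trans eq (iterPerm-zero q q≤l)))) (∈-orbit {x = x} g i q)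
    where
    q≤l : q ≤ l
    q≤l = ℕP.≤-pred (ℕP.≤-pred (subst (suc q <_) (cong (λ t → suc (proj₁ t)) type-zero) (∈P.∈-upTo⁻ q∈)))

  module _ (j : Fin n) (j∉ : ¬ j ∈ orbit x i) where
    -- A letter that reached `i` would lie on the cycle of `i`. So letters outside it never meet the
    -- diverted arrow, and their types stay as they were.
    avoids : ∀ m → iterPerm x (suc m) j ≢ i
    avoids m eq with reverse-orbit {x = x} g i j (suc m) eq
    ... | b , eq' = j∉ (subst (_∈ orbit x i) eq' (∈-orbit {x = x} g i b))

    iterPerm-suc-∉ : ∀ m → iterPerm y m (Fin.suc j) ≡ Fin.suc (iterPerm x m j)
    iterPerm-suc-∉ zero = refl
    iterPerm-suc-∉ (suc m) = trans (cong (perm y) (iterPerm-suc-∉ m)) (cong proj₂ (lookup-suc-≢ (iterPerm x m j) (avoids m)))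

    iterSgn-suc-∉ : ∀ m → iterSgn y m (Fin.suc j) ≡ iterSgn x m j
    iterSgn-suc-∉ zero = refl
    iterSgn-suc-∉ (suc m) = trans (cong₂ (λ a b → a Sign.* sgn y b) (iterSgn-suc-∉ m) (iterPerm-suc-∉ m))
      (cong (λ z → iterSgn x m j Sign.* proj₁ z) (lookup-suc-≢ (iterPerm x m j) (avoids m)))

    type-suc-∉ : type y (Fin.suc j) ≡ type x j
    type-suc-∉ = type-≡ {x = y} gy {t = type x j} (trans (iterPerm-suc-∉ (suc (proj₁ (type x j)))) (cong Fin.suc (proj₁ isTj)) ,
      trans (iterSgn-suc-∉ (suc (proj₁ (type x j)))) (proj₁ (proj₂ isTj)) ,
      λ m m<l eq → proj₂ (proj₂ isTj) m m<l (FinP.suc-injective (trans (sym (iterPerm-suc-∉ (suc m))) eq)))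
      where isTj = type-isType {x = x} g j

  otherTypes-zero : otherTypes y Fin.zero ≡ otherTypes x i
  otherTypes-zero = trans (cong (λ xs → map (type y) (filter P? xs)) (allFin-suc n))
    (map-filter-map P? (λ j → ¬? (j ∈ᶠ? orbit x i)) Fin.suc (type y) (type x)
      (λ j ¬m m → ¬m (∈-orbit⁺ j m)) (λ j ¬m m → ¬m (∈-orbit⁻ j m)) (λ j ¬m → type-suc-∉ j ¬m) (allFin n))
    where P? = λ j → ¬? (j ∈ᶠ? orbit y Fin.zero)

  types-insertHead : types y ↭ replicate (2 ℕ.+ l) (suc l , ε) ++ otherTypes x i
  types-insertHead = subst₂ (λ t u → types y ↭ replicate (suc (proj₁ t)) t ++ u) type-zero otherTypes-zero (types-split {x = y} gy Fin.zero)

-- The characters χ' and χ χ'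

negOnePow-+ : ∀ a b → negOnePow (a ℕ.+ b) ≡ negOnePow a ℤ.* negOnePow b
negOnePow-+ zero b = sym (ℤP.*-identityˡ _)
negOnePow-+ (suc a) b = trans (cong ℤ.-_ (negOnePow-+ a b)) (ℤP.neg-distribˡ-* (negOnePow a) (negOnePow b))

-- The two functions χ' and χ χ' differ only in the parity of twist.
record Character : Set where
  field
    value : ∀ {n} → SPerm n → ℤ
    twist : Sign → ℕ
    value-empty : value [] ≡ ℤ.+ 1
    value-fixHead : ∀ {n} s (x : SPerm n) → value (fixHead s x) ≡ negOnePow (twist s) ℤ.* value x
    value-insertHead : ∀ {n} s i {x : SPerm n} → Good x → value (insertHead s i x) ≡ ℤ.- value x

∑-replicate : ∀ {A : Set} m (a : A) (f : A → ℚ) → ∑ (replicate m a) f ≡ fromℕ m * f a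
∑-replicate zero a f = sym (trans (cong (_* f a) fromℕ-0) (ℚP.*-zeroˡ (f a)))
∑-replicate (suc m) a f = trans (cong (f a +_) (∑-replicate m a f))
  (sym (trans (cong (_* f a) (fromℕ-suc m)) (trans (ℚP.*-distribʳ-+ (f a) 1ℚ (fromℕ m)) (cong (_+ fromℕ m * f a) (ℚP.*-identityˡ (f a))))))

-- The exponent of -1 in the value at x is spread evenly over the letters of each cycle, so that it becomes
-- a function of the multiset types x.
module ClassFunction (c : Character) where
  open Character c

  abstract
    -- A cycle of l + 1 letters is a product of l transpositions, which gives the exponent
    -- `l + twist ε`; each of its l + 1 letters receives an equal share.
    letterWeight : Type → ℚ
    letterWeight (l , ε) = fromℕ (l ℕ.+ twist ε) * recip (suc l)

    cycleWeight : ∀ l ε → fromℕ (suc l) * letterWeight (l , ε) ≡ fromℕ (l ℕ.+ twist ε)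
    cycleWeight l ε = trans (ℚP.*-comm (fromℕ (suc l)) _) (trans (ℚP.*-assoc (fromℕ (l ℕ.+ twist ε)) (recip (suc l)) _)
      (trans (cong (fromℕ (l ℕ.+ twist ε) *_) (recip-inverse (suc l) (s≤s z≤n))) (ℚP.*-identityʳ _)))

    letterWeight-0 : ∀ s → letterWeight (0 , s) ≡ fromℕ (twist s)
    letterWeight-0 s = ℚP.*-identityʳ (fromℕ (twist s))

  -- Induction along `decode`. A new one-letter cycle adds `twist s`; an insertion reverses the
  -- value and raises the exponent of one cycle by one. The shares are fractions, but summed over
  -- whole cycles they give the natural number ν.
  value-exponent : ∀ {n} {x : SPerm n} → Good x → ∃ λ ν → value x ≡ negOnePow ν × fromℕ ν ≡ ∑ (types x) letterWeight
  value-exponent {zero} {[]} g = 0 , value-empty , fromℕ-0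
  value-exponent {suc n} {y} g with decode-surjective {y = y} g
  ... | (s , Fin.zero , x) , refl with value-exponent {x = x} (Good-decode⁻ s Fin.zero {x} g)
  ...   | ν , e , eν = twist s ℕ.+ ν ,
          trans (value-fixHead s x) (trans (cong (negOnePow (twist s) ℤ.*_) e) (sym (negOnePow-+ (twist s) ν))) ,
          trans (fromℕ-+ (twist s) ν) (trans (cong₂ _+_ (sym (letterWeight-0 s)) eν)
            (sym (cong (λ ts → ∑ ts letterWeight) (FixHead.types-fixHead s {x} (Good-decode⁻ s Fin.zero {x} g)))))
  value-exponent {suc n} {y} g | (s , Fin.suc i , x) , refl with value-exponent {x = x} (Good-decode⁻ s (Fin.suc i) {x} g)
  ...   | ν , e , eν = suc ν ,
          trans (value-insertHead s i {x} gx) (cong ℤ.-_ e) , (begin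
            fromℕ (suc ν) ≡⟨ fromℕ-suc ν ⟩
            1ℚ + fromℕ ν ≡⟨ cong (1ℚ +_) (trans eν (trans (∑-↭ letterWeight (types-split {x = x} gx i)) (∑-++ (replicate (suc l) (type x i)) U letterWeight))) ⟩
            1ℚ + (∑ (replicate (suc l) (l , ε)) letterWeight + ∑ U letterWeight) ≡⟨ ℚP.+-assoc 1ℚ (∑ (replicate (suc l) (l , ε)) letterWeight) _ ⟨
            (1ℚ + ∑ (replicate (suc l) (l , ε)) letterWeight) + ∑ U letterWeight ≡⟨ cong (λ z → (1ℚ + z) + ∑ U letterWeight) (trans (∑-replicate (suc l) (l , ε) letterWeight) (cycleWeight l ε)) ⟩
            (1ℚ + fromℕ (l ℕ.+ twist ε)) + ∑ U letterWeight ≡⟨ cong (_+ ∑ U letterWeight) (trans (sym (fromℕ-suc (l ℕ.+ twist ε))) (sym (trans (∑-replicate (suc (suc l)) (suc l , ε) letterWeight) (cycleWeight (suc l) ε)))) ⟩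
            ∑ (replicate (2 ℕ.+ l) (suc l , ε)) letterWeight + ∑ U letterWeight ≡⟨ ∑-++ (replicate (2 ℕ.+ l) (suc l , ε)) U letterWeight ⟨
            ∑ (replicate (2 ℕ.+ l) (suc l , ε) ++ U) letterWeight ≡⟨ ∑-↭ letterWeight (InsertHead.types-insertHead s i {x} gx) ⟨
            ∑ (types (insertHead s i x)) letterWeight ∎)
    where
    open ≡-Reasoning
    gx : Good x
    gx = Good-decode⁻ s (Fin.suc i) {x} g
    l = proj₁ (type x i)
    ε = proj₂ (type x i)
    U = otherTypes x i

  value-types : ∀ {x y : SPerm n} → Good x → Good y → types x ↭ types y → value x ≡ value y
  value-types {x = x} {y} gx gy p with value-exponent {x = x} gx | value-exponent {x = y} gy
  ... | ν , e , eν | ν' , e' , eν' = trans e (trans (cong negOnePow (fromℕ-injective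
    (trans eν (trans (∑-↭ letterWeight p) (sym eν'))))) (sym e'))

-- Inversions and signs under insertion of a letter

countBelow : ∀ {n} → Fin n → List (Fin n) → ℕ
countBelow m L = length (filterᵇ (λ y → does (y Fin.<? m)) L)

-- The unsigned effect of `bend` on one-line notation: the entry i becomes 0 and all others go up by
-- one.
bendLetter : Fin n → Fin n → Fin (suc n)
bendLetter i m = if does (m Fin.≟ i) then Fin.zero else Fin.suc m

bendLetter-≡ : ∀ (i : Fin n) {m} → m ≡ i → bendLetter i m ≡ Fin.zero
bendLetter-≡ i {m} eq rewrite dec-true (m Fin.≟ i) eq = refl

bendLetter-≢ : ∀ (i : Fin n) {m} → m ≢ i → bendLetter i m ≡ Fin.suc m
bendLetter-≢ i {m} ne rewrite dec-false (m Fin.≟ i) ne = refl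

indicatorℕ : Bool → ℕ
indicatorℕ b = if b then 1 else 0

indicatorℕ-not : ∀ b → indicatorℕ (not b) ℕ.+ indicatorℕ b ≡ 1
indicatorℕ-not true = refl
indicatorℕ-not false = refl

length-filterᵇ-∷ : ∀ {A : Set} (p : A → Bool) x xs → length (filterᵇ p (x ∷ xs)) ≡ indicatorℕ (p x) ℕ.+ length (filterᵇ p xs)
length-filterᵇ-∷ p x xs with p x
... | true = refl
... | false = refl

below? : Fin n → Fin n → Bool
below? m y = does (y Fin.<? m)

countBelow-∷ : ∀ (m y : Fin n) L → countBelow m (y ∷ L) ≡ indicatorℕ (below? m y) ℕ.+ countBelow m L
countBelow-∷ m y L = length-filterᵇ-∷ (below? m) y L

countBelow-∉ : ∀ (i m : Fin n) L → i ∉ L → countBelow (Fin.suc m) (map (bendLetter i) L) ≡ countBelow m L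
countBelow-∉ i m [] _ = refl
countBelow-∉ i m (y ∷ L) i∉ = begin
  countBelow (Fin.suc m) (bendLetter i y ∷ map (bendLetter i) L)
    ≡⟨ cong (λ z → countBelow (Fin.suc m) (z ∷ map (bendLetter i) L)) (bendLetter-≢ i (λ eq → i∉ (here (sym eq)))) ⟩
  countBelow (Fin.suc m) (Fin.suc y ∷ map (bendLetter i) L) ≡⟨ countBelow-∷ (Fin.suc m) (Fin.suc y) (map (bendLetter i) L) ⟩
  indicatorℕ (below? m y) ℕ.+ countBelow (Fin.suc m) (map (bendLetter i) L) ≡⟨ cong (indicatorℕ (below? m y) ℕ.+_) (countBelow-∉ i m L (i∉ ∘ there)) ⟩
  indicatorℕ (below? m y) ℕ.+ countBelow m L ≡⟨ countBelow-∷ m y L ⟨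
  countBelow m (y ∷ L) ∎
  where open ≡-Reasoning

-- The entry `i`, turned into 0, now lies below everything; this is a gain of one exactly when it
-- was not below `m` before.
countBelow-∈ : ∀ (i m : Fin n) L → Unique L → i ∈ L →
  countBelow (Fin.suc m) (map (bendLetter i) L) ≡ indicatorℕ (not (below? m i)) ℕ.+ countBelow m L
countBelow-∈ i m (_ ∷ L) (i∉ AllPairs.∷ u) (here refl) = begin
  countBelow (Fin.suc m) (bendLetter i i ∷ map (bendLetter i) L)
    ≡⟨ cong (λ z → countBelow (Fin.suc m) (z ∷ map (bendLetter i) L)) (bendLetter-≡ i refl) ⟩
  countBelow (Fin.suc m) (Fin.zero ∷ map (bendLetter i) L) ≡⟨ countBelow-∷ (Fin.suc m) Fin.zero (map (bendLetter i) L) ⟩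
  1 ℕ.+ countBelow (Fin.suc m) (map (bendLetter i) L) ≡⟨ cong suc (countBelow-∉ i m L (λ p → All.lookup i∉ p refl)) ⟩
  1 ℕ.+ countBelow m L ≡⟨ cong (ℕ._+ countBelow m L) (indicatorℕ-not (below? m i)) ⟨
  (indicatorℕ (not (below? m i)) ℕ.+ indicatorℕ (below? m i)) ℕ.+ countBelow m L ≡⟨ ℕP.+-assoc (indicatorℕ (not (below? m i))) _ _ ⟩
  indicatorℕ (not (below? m i)) ℕ.+ (indicatorℕ (below? m i) ℕ.+ countBelow m L) ≡⟨ cong (indicatorℕ (not (below? m i)) ℕ.+_) (countBelow-∷ m i L) ⟨
  indicatorℕ (not (below? m i)) ℕ.+ countBelow m (i ∷ L) ∎
  where open ≡-Reasoning
countBelow-∈ i m (y ∷ L) (y∉ AllPairs.∷ u) (there p) = begin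
  countBelow (Fin.suc m) (bendLetter i y ∷ map (bendLetter i) L)
    ≡⟨ cong (λ z → countBelow (Fin.suc m) (z ∷ map (bendLetter i) L)) (bendLetter-≢ i (All.lookup y∉ p)) ⟩
  countBelow (Fin.suc m) (Fin.suc y ∷ map (bendLetter i) L) ≡⟨ countBelow-∷ (Fin.suc m) (Fin.suc y) (map (bendLetter i) L) ⟩
  β ℕ.+ countBelow (Fin.suc m) (map (bendLetter i) L) ≡⟨ cong (β ℕ.+_) (countBelow-∈ i m L u p) ⟩
  β ℕ.+ (α ℕ.+ countBelow m L) ≡⟨ ℕP.+-assoc β α _ ⟨
  (β ℕ.+ α) ℕ.+ countBelow m L ≡⟨ cong (ℕ._+ countBelow m L) (ℕP.+-comm β α) ⟩
  (α ℕ.+ β) ℕ.+ countBelow m L ≡⟨ ℕP.+-assoc α β _ ⟩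
  α ℕ.+ (β ℕ.+ countBelow m L) ≡⟨ cong (α ℕ.+_) (countBelow-∷ m y L) ⟨
  α ℕ.+ countBelow m (y ∷ L) ∎
  where
  open ≡-Reasoning
  α = indicatorℕ (not (below? m i))
  β = indicatorℕ (below? m y)

countBelow-zero : ∀ {n} (L : List (Fin (suc n))) → countBelow Fin.zero L ≡ 0
countBelow-zero [] = refl
countBelow-zero (y ∷ L) = trans (countBelow-∷ Fin.zero y L) (countBelow-zero L)

inversions-∉ : ∀ (i : Fin n) L → i ∉ L → inversions (map (bendLetter i) L) ≡ inversions L
inversions-∉ i [] _ = refl
inversions-∉ i (m ∷ L) i∉ = trans
  (cong (λ z → countBelow z (map (bendLetter i) L) ℕ.+ inversions (map (bendLetter i) L)) (bendLetter-≢ i (λ eq → i∉ (here (sym eq)))))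
  (cong₂ ℕ._+_ (countBelow-∉ i m L (i∉ ∘ there)) (inversions-∉ i L (i∉ ∘ there)))

-- For m ≠ i both indicators express m < i, so the two signs are equal.
below?-sign : ∀ (i m : Fin n) → m ≢ i → negOnePow (indicatorℕ (below? i m)) ℤ.* negOnePow (indicatorℕ (not (below? m i))) ≡ ℤ.+ 1
below?-sign i m m≢i with FinP.<-cmp m i
... | tri< m<i _ i≮m rewrite dec-true (m Fin.<? i) m<i | dec-false (i Fin.<? m) i≮m = refl
... | tri≈ _ eq _ = contradiction eq m≢i
... | tri> m≮i _ i<m rewrite dec-false (m Fin.<? i) m≮i | dec-true (i Fin.<? m) i<m = refl

-- Turning `i` into 0 creates an inversion with each smaller entry before it and destroys one with
-- each smaller entry after it. The number of affected pairs is the number of entries below `i`.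
inversions-∈ : ∀ (i : Fin n) L → Unique L → i ∈ L →
  negOnePow (countBelow i L) ℤ.* negOnePow (inversions (map (bendLetter i) L)) ≡ negOnePow (inversions L)
inversions-∈ i (_ ∷ L) (i∉ AllPairs.∷ u) (here refl) = begin
  negOnePow (countBelow i (i ∷ L)) ℤ.* negOnePow (countBelow (bendLetter i i) L' ℕ.+ inversions L')
    ≡⟨ cong₂ ℤ._*_ (cong negOnePow (trans (countBelow-∷ i i L) (cong (λ b → indicatorℕ b ℕ.+ countBelow i L) (dec-false (i Fin.<? i) (FinP.<-irrefl refl)))))
         (cong (λ z → negOnePow (countBelow z L' ℕ.+ inversions L')) (bendLetter-≡ i refl)) ⟩
  negOnePow (countBelow i L) ℤ.* negOnePow (countBelow Fin.zero L' ℕ.+ inversions L')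
    ≡⟨ cong (λ z → negOnePow (countBelow i L) ℤ.* negOnePow z) (cong₂ ℕ._+_ (countBelow-zero L') (inversions-∉ i L (λ p → All.lookup i∉ p refl))) ⟩
  negOnePow (countBelow i L) ℤ.* negOnePow (inversions L) ≡⟨ negOnePow-+ (countBelow i L) (inversions L) ⟨
  negOnePow (countBelow i L ℕ.+ inversions L) ∎
  where
  open ≡-Reasoning
  L' = map (bendLetter i) L
inversions-∈ {n} i (m ∷ L) (m∉ AllPairs.∷ u) (there p) = begin
  negOnePow (countBelow i (m ∷ L)) ℤ.* negOnePow (countBelow (bendLetter i m) L' ℕ.+ inversions L')
    ≡⟨ cong₂ ℤ._*_ (cong negOnePow (countBelow-∷ i m L))
         (cong (λ z → negOnePow (countBelow z L' ℕ.+ inversions L')) (bendLetter-≢ i m≢i)) ⟩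
  negOnePow (β ℕ.+ countBelow i L) ℤ.* negOnePow (countBelow (Fin.suc m) L' ℕ.+ inversions L')
    ≡⟨ cong (λ z → negOnePow (β ℕ.+ countBelow i L) ℤ.* negOnePow (z ℕ.+ inversions L')) (countBelow-∈ i m L u p) ⟩
  negOnePow (β ℕ.+ countBelow i L) ℤ.* negOnePow ((α ℕ.+ countBelow m L) ℕ.+ inversions L')
    ≡⟨ cong₂ ℤ._*_ (negOnePow-+ β _) (trans (negOnePow-+ (α ℕ.+ countBelow m L) _) (cong (ℤ._* negOnePow (inversions L')) (negOnePow-+ α _))) ⟩
  (negOnePow β ℤ.* negOnePow (countBelow i L)) ℤ.* ((negOnePow α ℤ.* negOnePow (countBelow m L)) ℤ.* negOnePow (inversions L'))
    ≡⟨ rearrange (negOnePow β) (negOnePow (countBelow i L)) (negOnePow α) (negOnePow (countBelow m L)) (negOnePow (inversions L')) ⟩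
  (negOnePow β ℤ.* negOnePow α) ℤ.* (negOnePow (countBelow m L) ℤ.* (negOnePow (countBelow i L) ℤ.* negOnePow (inversions L')))
    ≡⟨ cong₂ (λ a b → a ℤ.* (negOnePow (countBelow m L) ℤ.* b)) (below?-sign i m m≢i) (inversions-∈ i L u p) ⟩
  ℤ.+ 1 ℤ.* (negOnePow (countBelow m L) ℤ.* negOnePow (inversions L)) ≡⟨ ℤP.*-identityˡ _ ⟩
  negOnePow (countBelow m L) ℤ.* negOnePow (inversions L) ≡⟨ negOnePow-+ (countBelow m L) (inversions L) ⟨
  negOnePow (countBelow m L ℕ.+ inversions L) ∎
  where
  open ≡-Reasoning
  L' = map (bendLetter i) L
  m≢i : m ≢ i
  m≢i = All.lookup m∉ p
  α = indicatorℕ (not (below? m i))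
  β = indicatorℕ (below? i m)
  rearrange : ∀ β c d e v → (β ℤ.* c) ℤ.* ((d ℤ.* e) ℤ.* v) ≡ (β ℤ.* d) ℤ.* (e ℤ.* (c ℤ.* v))
  rearrange = solve 5 (λ β c d e v → (β :* c) :* ((d :* e) :* v) := (β :* d) :* (e :* (c :* v))) refl
    where open ℤS.+-*-Solver

toList-lookup : ∀ {A : Set} (v : Vec A n) → toList v ≡ List.tabulate (lookup v)
toList-lookup [] = refl
toList-lookup (a ∷ v) = cong (a ∷_) (toList-lookup v)

absList : SPerm n → List (Fin n)
absList x = toList (absPerm x)

absList-unique : ∀ {x : SPerm n} → Good x → Unique (absList x)
absList-unique {x = x} g = subst Unique (sym (toList-lookup (absPerm x)))
  (UniqueP.tabulate⁺ (λ {i} {j} eq → g (trans (sym (VecP.lookup-map i proj₂ x)) (trans eq (VecP.lookup-map j proj₂ x)))))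

∈-absList : ∀ {x : SPerm n} → Good x → ∀ i → i ∈ absList x
∈-absList {x = x} g i = subst₂ _∈_ (trans (VecP.lookup-map _ proj₂ x) (proj₁ (type-isType {x = x} g i))) (sym (toList-lookup (absPerm x)))
  (∈P.∈-tabulate⁺ {f = lookup (absPerm x)} (iterPerm x (proj₁ (type x i)) i))

absList-fixHead : ∀ s (x : SPerm n) → absList (fixHead s x) ≡ Fin.zero ∷ map Fin.suc (absList x)
absList-fixHead s x = cong (Fin.zero ∷_) (go x)
  where
  go : ∀ {m} (v : Vec (Sign × Fin m) n) → toList (Vec.map proj₂ (Vec.map (λ p → proj₁ p , Fin.suc (proj₂ p)) v)) ≡ map Fin.suc (toList (Vec.map proj₂ v))
  go [] = refl
  go (p ∷ v) = cong (_ ∷_) (go v)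

bend-proj₂ : ∀ s (i : Fin n) p → proj₂ (bend s i p) ≡ bendLetter i (proj₂ p)
bend-proj₂ s i (r , m) with m Fin.≟ i
... | yes _ = refl
... | no _ = refl

absList-insertHead : ∀ s i (x : SPerm n) → absList (insertHead s i x) ≡ Fin.suc i ∷ map (bendLetter i) (absList x)
absList-insertHead s i x = cong (Fin.suc i ∷_) (go x)
  where
  go : ∀ {m} (v : Vec (Sign × Fin _) m) → toList (Vec.map proj₂ (Vec.map (bend s i) v)) ≡ map (bendLetter i) (toList (Vec.map proj₂ v))
  go [] = refl
  go (p ∷ v) = cong₂ _∷_ (bend-proj₂ s i p) (go v)

inversions-map-suc : ∀ (L : List (Fin n)) → inversions (map Fin.suc L) ≡ inversions L
inversions-map-suc [] = refl
inversions-map-suc (m ∷ L) = cong₂ ℕ._+_ (count L) (inversions-map-suc L)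
  where
  count : ∀ L → countBelow (Fin.suc m) (map Fin.suc L) ≡ countBelow m L
  count [] = refl
  count (y ∷ L) = trans (countBelow-∷ (Fin.suc m) (Fin.suc y) (map Fin.suc L))
    (trans (cong (indicatorℕ (below? m y) ℕ.+_) (count L)) (sym (countBelow-∷ m y L)))

χ'-fixHead : ∀ s (x : SPerm n) → χ' (fixHead s x) ≡ χ' x
χ'-fixHead s x = cong negOnePow (trans (cong inversions (absList-fixHead s x))
  (cong₂ ℕ._+_ (countBelow-zero (map Fin.suc (absList x))) (inversions-map-suc (absList x))))

-- The head is larger than the old entries below `i` and also than the new 0. The former cancel the
-- parity change of `inversions-∈`; the latter leaves the factor -1.
χ'-insertHead : ∀ s i {x : SPerm n} → Good x → χ' (insertHead s i x) ≡ ℤ.- χ' x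
χ'-insertHead s i {x} g = begin
  negOnePow (inversions (absList (insertHead s i x))) ≡⟨ cong (negOnePow ∘ inversions) (absList-insertHead s i x) ⟩
  negOnePow (countBelow (Fin.suc i) (map (bendLetter i) L) ℕ.+ inv) ≡⟨ cong (λ z → negOnePow (z ℕ.+ inv)) (countBelow-∈ i i L u p) ⟩
  negOnePow (indicatorℕ (not (below? i i)) ℕ.+ countBelow i L ℕ.+ inv) ≡⟨ cong (λ z → negOnePow (indicatorℕ (not z) ℕ.+ countBelow i L ℕ.+ inv)) (dec-false (i Fin.<? i) (FinP.<-irrefl refl)) ⟩
  ℤ.- negOnePow (countBelow i L ℕ.+ inv) ≡⟨ cong ℤ.-_ (trans (negOnePow-+ (countBelow i L) inv) (inversions-∈ i L u p)) ⟩
  ℤ.- negOnePow (inversions L) ∎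
  where
  open ≡-Reasoning
  L = absList x
  u = absList-unique {x = x} g
  p = ∈-absList {x = x} g i
  inv = inversions (map (bendLetter i) L)

signProduct : ∀ {m} → Vec (Sign × Fin n) m → Sign
signProduct v = Vec.foldr _ Sign._*_ Sign.+ (Vec.map proj₁ v)

signProduct-fixHead : ∀ {m} (v : Vec (Sign × Fin n) m) → signProduct (Vec.map (λ p → proj₁ p , Fin.suc (proj₂ p)) v) ≡ signProduct v
signProduct-fixHead [] = refl
signProduct-fixHead (p ∷ v) = cong (proj₁ p Sign.*_) (signProduct-fixHead v)

signProduct-bend-∉ : ∀ {m} s i (v : Vec (Sign × Fin n) m) → i ∉ toList (Vec.map proj₂ v) → signProduct (Vec.map (bend s i) v) ≡ signProduct v
signProduct-bend-∉ s i [] _ = refl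
signProduct-bend-∉ s i ((r , m) ∷ v) i∉ with m Fin.≟ i
... | yes refl = contradiction (here refl) i∉
... | no _ = cong (r Sign.*_) (signProduct-bend-∉ s i v (i∉ ∘ there))

signProduct-bend-∈ : ∀ {m} s i (v : Vec (Sign × Fin n) m) → Unique (toList (Vec.map proj₂ v)) → i ∈ toList (Vec.map proj₂ v) →
  signProduct (Vec.map (bend s i) v) ≡ s Sign.* signProduct v
signProduct-bend-∈ s i ((r , m) ∷ v) (m∉ AllPairs.∷ u) (here refl) with i Fin.≟ i
... | no ne = contradiction refl ne
... | yes _ = trans (cong₂ Sign._*_ (SignP.*-comm r s) (signProduct-bend-∉ s i v (λ p → All.lookup m∉ p refl))) (SignP.*-assoc s r _)
signProduct-bend-∈ s i ((r , m) ∷ v) (m∉ AllPairs.∷ u) (there p) with m Fin.≟ i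
... | yes refl = contradiction refl (All.lookup m∉ p)
... | no _ = trans (cong (r Sign.*_) (signProduct-bend-∈ s i v u p))
  (trans (sym (SignP.*-assoc r s _)) (trans (cong (Sign._* signProduct v) (SignP.*-comm r s)) (SignP.*-assoc s r _)))

signℤ-* : ∀ s t → signℤ (s Sign.* t) ≡ signℤ s ℤ.* signℤ t
signℤ-* Sign.+ Sign.+ = refl
signℤ-* Sign.+ Sign.- = refl
signℤ-* Sign.- Sign.+ = refl
signℤ-* Sign.- Sign.- = refl

χ-fixHead : ∀ s (x : SPerm n) → χ (fixHead s x) ≡ signℤ s ℤ.* χ x
χ-fixHead s x = trans (signℤ-* s _) (cong (λ z → signℤ s ℤ.* signℤ z) (signProduct-fixHead x))

-- The sign `s` occurs twice, in the head and in the one diverted entry.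
χ-insertHead : ∀ s i {x : SPerm n} → Good x → χ (insertHead s i x) ≡ χ x
χ-insertHead s i {x} g = cong signℤ (trans (cong (s Sign.*_) (signProduct-bend-∈ s i x (absList-unique {x = x} g) (∈-absList {x = x} g i)))
  (trans (sym (SignP.*-assoc s s _)) (cong (Sign._* signProduct x) (SignP.s*s≡+ s))))

χ'-character : Character
χ'-character = record
  { value = χ'
  ; twist = λ _ → 0
  ; value-empty = refl
  ; value-fixHead = λ s x → trans (χ'-fixHead s x) (sym (ℤP.*-identityˡ _))
  ; value-insertHead = χ'-insertHead
  }

χχ'-character : Character
χχ'-character = record
  { value = λ x → χ x ℤ.* χ' x
  ; twist = twist
  ; value-empty = refl
  ; value-fixHead = λ s x → trans (cong₂ ℤ._*_ (χ-fixHead s x) (χ'-fixHead s x))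
      (trans (ℤP.*-assoc (signℤ s) (χ x) (χ' x)) (cong (ℤ._* (χ x ℤ.* χ' x)) (signℤ-twist s)))
  ; value-insertHead = λ s i {x} g → trans (cong₂ ℤ._*_ (χ-insertHead s i {x} g) (χ'-insertHead s i {x} g)) (sym (ℤP.neg-distribʳ-* (χ x) (χ' x)))
  }
  where
  twist : Sign → ℕ
  twist Sign.+ = 0
  twist Sign.- = 1
  signℤ-twist : ∀ s → signℤ s ≡ negOnePow (twist s)
  signℤ-twist Sign.+ = refl
  signℤ-twist Sign.- = refl

-- Conjugacy of elements with the same cycle type

data SumView (m n : ℕ) : Fin (m ℕ.+ n) → Set where
  left : ∀ i → SumView m n (i Fin.↑ˡ n)
  right : ∀ j → SumView m n (m Fin.↑ʳ j)

sumView : ∀ m n a → SumView m n a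
sumView m n a with Fin.splitAt m a in eq
... | inj₁ i = subst (SumView m n) (FinP.splitAt⁻¹-↑ˡ eq) (left i)
... | inj₂ j = subst (SumView m n) (FinP.splitAt⁻¹-↑ʳ eq) (right j)

↑ˡ≢↑ʳ : ∀ {m n} (i : Fin m) (j : Fin n) → i Fin.↑ˡ n ≢ m Fin.↑ʳ j
↑ˡ≢↑ʳ {m} {n} i j eq with trans (sym (FinP.splitAt-↑ˡ m i n)) (trans (cong (Fin.splitAt m) eq) (FinP.splitAt-↑ʳ m n j))
... | ()

block : ∀ j' → Sign → SPerm (suc j')
block j' θ = tabulate (blockEntry {j'} θ)

module Block (j' : ℕ) (θ : Sign) where
  private
    b = block j' θ

  lookup-last : ∀ i → j' ≡ toℕ i → lookup b i ≡ (θ , Fin.zero)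
  lookup-last i eq = trans (VecP.lookup∘tabulate (blockEntry θ) i) last
    where
    last : blockEntry θ i ≡ (θ , Fin.zero)
    last with j' ℕ.≟ toℕ i
    ... | yes _ = refl
    ... | no ne = contradiction eq ne

  lookup-next : ∀ i → j' ≢ toℕ i → sgn b i ≡ Sign.+ × toℕ (perm b i) ≡ suc (toℕ i)
  lookup-next i ne = trans (cong proj₁ (VecP.lookup∘tabulate (blockEntry θ) i)) (proj₁ next) , trans (cong (toℕ ∘ proj₂) (VecP.lookup∘tabulate (blockEntry θ) i)) (proj₂ next)
    where
    next : proj₁ (blockEntry θ i) ≡ Sign.+ × toℕ (proj₂ (blockEntry θ i)) ≡ suc (toℕ i)
    next with j' ℕ.≟ toℕ i
    ... | yes eq = contradiction eq ne
    ... | no ne' = refl , cong suc (FinP.toℕ-lower₁ i ne')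

  good : Good b
  good {i} {j} eq with j' ℕ.≟ toℕ i | j' ℕ.≟ toℕ j
  ... | yes p | yes q = FinP.toℕ-injective (trans (sym p) q)
  ... | yes p | no q = contradiction (trans (cong (toℕ ∘ proj₂) (sym (lookup-last i p))) (trans (cong toℕ eq) (proj₂ (lookup-next j q)))) λ ()
  ... | no p | yes q = contradiction (trans (cong (toℕ ∘ proj₂) (sym (lookup-last j q))) (trans (cong toℕ (sym eq)) (proj₂ (lookup-next i p)))) λ ()
  ... | no p | no q = FinP.toℕ-injective (ℕP.suc-injective (trans (sym (proj₂ (lookup-next i p))) (trans (cong toℕ eq) (proj₂ (lookup-next j q)))))

  iter-zero : ∀ m → m ≤ j' → toℕ (iterPerm b m Fin.zero) ≡ m × iterSgn b m Fin.zero ≡ Sign.+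
  iter-zero zero _ = refl , refl
  iter-zero (suc m) m<j' with iter-zero m (ℕP.<⇒≤ m<j')
  ... | p , s with lookup-next (iterPerm b m Fin.zero) (λ eq → ℕP.<-irrefl (trans (sym p) (sym eq)) m<j')
  ...   | s' , p' = trans p' (cong suc p) , cong₂ Sign._*_ s s'

  type-zero : type b Fin.zero ≡ (j' , θ)
  type-zero = type-≡ {x = b} good (cong proj₂ last , trans (cong₂ Sign._*_ (proj₂ (iter-zero j' ℕP.≤-refl)) (cong proj₁ last)) refl ,
    λ m m<j' eq → contradiction (trans (sym (proj₁ (iter-zero (suc m) m<j'))) (cong toℕ eq)) λ ())
    where last = lookup-last (iterPerm b j' Fin.zero) (sym (proj₁ (iter-zero j' ℕP.≤-refl)))

  type-block : ∀ i → type b i ≡ (j' , θ)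
  type-block i = trans (cong (type b) (sym (FinP.toℕ-injective (proj₁ (iter-zero (toℕ i) (ℕP.≤-pred (FinP.toℕ<n i)))))))
    (trans (type-iterPerm {x = b} good Fin.zero (toℕ i)) type-zero)

-- Passes from a list of cycles to the list of letter types, the form in which `types` records them.
expand : List Type → List Type
expand = concatMap (λ t → replicate (suc (proj₁ t)) t)

module RepCons (j' : ℕ) (θ : Sign) (cs : List Type) where
  private
    S = size cs
    R = rep ((j' , θ) ∷ cs)

  lookup-left : ∀ i → lookup R (i Fin.↑ˡ S) ≡ (sgn (block j' θ) i , perm (block j' θ) i Fin.↑ˡ S)
  lookup-left i = trans (VecP.lookup-++ˡ (Vec.map _ (block j' θ)) _ i) (VecP.lookup-map i _ (block j' θ))

  lookup-right : ∀ i → lookup R (suc j' Fin.↑ʳ i) ≡ (sgn (rep cs) i , suc j' Fin.↑ʳ perm (rep cs) i)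
  lookup-right i = trans (VecP.lookup-++ʳ (Vec.map (λ sp → proj₁ sp , proj₂ sp Fin.↑ˡ S) (block j' θ)) _ i) (VecP.lookup-map i _ (rep cs))

Good-rep : ∀ cs → Good (rep cs)
Good-rep [] {()}
Good-rep ((j' , θ) ∷ cs) {a} {b} eq with sumView (suc j') (size cs) a | sumView (suc j') (size cs) b
... | left i | left i' = cong (Fin._↑ˡ size cs) (Block.good j' θ (FinP.↑ˡ-injective (size cs) _ _
  (trans (sym (cong proj₂ (lookup-left i))) (trans eq (cong proj₂ (lookup-left i'))))))
  where open RepCons j' θ cs
... | left i | right k = contradiction (trans (sym (cong proj₂ (RepCons.lookup-left j' θ cs i))) (trans eq (cong proj₂ (RepCons.lookup-right j' θ cs k)))) (↑ˡ≢↑ʳ _ _)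
... | right k | left i = contradiction (trans (sym (cong proj₂ (RepCons.lookup-left j' θ cs i))) (trans (sym eq) (cong proj₂ (RepCons.lookup-right j' θ cs k)))) (↑ˡ≢↑ʳ _ _)
... | right k | right k' = cong (suc j' Fin.↑ʳ_) (Good-rep cs (FinP.↑ʳ-injective (suc j') _ _
  (trans (sym (cong proj₂ (lookup-right k))) (trans eq (cong proj₂ (lookup-right k'))))))
  where open RepCons j' θ cs

allFin-+ : ∀ m n → allFin (m ℕ.+ n) ≡ map (Fin._↑ˡ n) (allFin m) ++ map (m Fin.↑ʳ_) (allFin n)
allFin-+ zero n = sym (ListP.map-id (allFin n))
allFin-+ (suc m) n = trans (allFin-suc (m ℕ.+ n)) (trans (cong (λ xs → Fin.zero ∷ map Fin.suc xs) (allFin-+ m n))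
  (trans (cong (Fin.zero ∷_) (trans (ListP.map-++ Fin.suc (map (Fin._↑ˡ n) (allFin m)) _)
    (cong₂ _++_ (trans (sym (ListP.map-∘ (allFin m))) (ListP.map-∘ (allFin m))) (sym (ListP.map-∘ (allFin n))))))
    (cong (λ xs → map (Fin._↑ˡ n) xs ++ map (suc m Fin.↑ʳ_) (allFin n)) (sym (allFin-suc m)))))

types-rep : ∀ cs → types (rep cs) ≡ expand cs
types-rep [] = refl
types-rep ((j' , θ) ∷ cs) = trans (cong (map (type R)) (allFin-+ (suc j') (size cs)))
  (trans (ListP.map-++ (type R) (map (Fin._↑ˡ size cs) (allFin (suc j'))) _)
    (cong₂ _++_ (trans (sym (ListP.map-∘ (allFin (suc j')))) (trans (map-const-∈ _ (j' , θ) (allFin (suc j')) (λ i _ → type-left i))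
                  (cong (λ q → replicate q (j' , θ)) (ListP.length-tabulate {n = suc j'} id))))
      (trans (sym (ListP.map-∘ (allFin (size cs)))) (trans (ListP.map-cong type-right (allFin (size cs))) (types-rep cs)))))
  where
  R = rep ((j' , θ) ∷ cs)
  gR : Good R
  gR = Good-rep ((j' , θ) ∷ cs)
  open RepCons j' θ cs
  type-left : ∀ i → type R (i Fin.↑ˡ size cs) ≡ (j' , θ)
  type-left i = trans (type-≡ {x = R} gR (isType-intertwined R (block j' θ) (Fin._↑ˡ size cs) (λ _ → Sign.+)
    (λ i → cong proj₂ (lookup-left i)) (λ i → trans (cong proj₁ (lookup-left i)) (sym (SignP.*-identityʳ _)))
    (FinP.↑ˡ-injective (size cs) _ _) (type-isType {x = block j' θ} (Block.good j' θ) i))) (Block.type-block j' θ i)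
  type-right : ∀ i → type R (suc j' Fin.↑ʳ i) ≡ type (rep cs) i
  type-right i = type-≡ {x = R} gR (isType-intertwined R (rep cs) (suc j' Fin.↑ʳ_) (λ _ → Sign.+)
    (λ i → cong proj₂ (lookup-right i)) (λ i → trans (cong proj₁ (lookup-right i)) (sym (SignP.*-identityʳ _)))
    (FinP.↑ʳ-injective (suc j') _ _) (type-isType {x = rep cs} (Good-rep cs) i))

-- A conjugator under construction: a signed injection of the letters of the representative into the
-- part `L` of the letters of `z`, compatible with both actions. For `L` all letters it is an
-- element of Bₙ.
record Embedding {n} (z : SPerm n) (cs : List Type) (L : List (Fin n)) : Set where
  field
    g : Vec (Sign × Fin n) (size cs)
    range : ∀ a → proj₂ (lookup g a) ∈ L
    injective : ∀ {a b} → proj₂ (lookup g a) ≡ proj₂ (lookup g b) → a ≡ b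
    intertwines : ∀ a → act z (lookup g a) ≡ (sgn (rep cs) a Sign.* proj₁ (lookup g (perm (rep cs) a)) , proj₂ (lookup g (perm (rep cs) a)))

module EmbeddingStep {n : ℕ} {z : SPerm n} (gz : Good z) (j' : ℕ) (θ : Sign) (cs : List Type) {i : Fin n} (isT : IsType z i (j' , θ))
  {L L' : List (Fin n)} (orbit⊆L : ∀ m → iterPerm z m i ∈ L) (L'⊆ : ∀ j → j ∈ L' → j ∈ L × (∀ m → iterPerm z m i ≢ j))
  (E : Embedding z cs L') where
  open Embedding E
  open RepCons j' θ cs

  -- The m-th letter of the new block goes to the m-th iterate of `i` with the sign collected on the
  -- way. Inside the block no sign is then left over, as in the representative.
  entry : ℕ → Sign × Fin n
  entry m = iterSgn z m i , iterPerm z m i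

  extended : Vec (Sign × Fin n) (suc j' ℕ.+ size cs)
  extended = tabulate {n = suc j'} (λ a → entry (toℕ a)) Vec.++ g

  extended-left : ∀ a → lookup extended (a Fin.↑ˡ size cs) ≡ entry (toℕ a)
  extended-left a = trans (VecP.lookup-++ˡ (tabulate (λ a → entry (toℕ a))) g a) (VecP.lookup∘tabulate (λ a → entry (toℕ a)) a)

  extended-right : ∀ a → lookup extended (suc j' Fin.↑ʳ a) ≡ lookup g a
  extended-right a = VecP.lookup-++ʳ (tabulate {n = suc j'} (λ a → entry (toℕ a))) g a

  extended-range : ∀ a → SumView (suc j') (size cs) a → proj₂ (lookup extended a) ∈ L
  extended-range _ (left b) = subst (λ w → proj₂ w ∈ L) (sym (extended-left b)) (orbit⊆L (toℕ b))
  extended-range _ (right b) = subst (λ w → proj₂ w ∈ L) (sym (extended-right b)) (proj₁ (L'⊆ _ (range b)))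

  cross : ∀ b c → proj₂ (lookup extended (b Fin.↑ˡ size cs)) ≢ proj₂ (lookup extended (suc j' Fin.↑ʳ c))
  cross b c eq = proj₂ (L'⊆ _ (range c)) (toℕ b) (trans (sym (cong proj₂ (extended-left b))) (trans eq (cong proj₂ (extended-right c))))

  entry-distinct : ∀ a b → a < b → b ≤ j' → iterPerm z a i ≢ iterPerm z b i
  entry-distinct a b a<b b≤j' eq = proj₂ (proj₂ isT) (b ∸ suc a)
    (ℕP.≤-trans (subst (suc (b ∸ suc a) ≤_) ad (ℕP.m≤n+m (suc (b ∸ suc a)) a)) b≤j')
    (iterPerm-injective {x = z} gz a (trans (sym (iterPerm-+ z a (suc (b ∸ suc a)) i)) (trans (cong (λ q → iterPerm z q i) ad) (sym eq))))
    where
    ad : a ℕ.+ suc (b ∸ suc a) ≡ b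
    ad = trans (ℕP.+-suc a _) (ℕP.m+[n∸m]≡n a<b)

  entry-injective : ∀ (c d : Fin (suc j')) → iterPerm z (toℕ c) i ≡ iterPerm z (toℕ d) i → c ≡ d
  entry-injective c d e with ℕP.<-cmp (toℕ c) (toℕ d)
  ... | tri< lt _ _ = contradiction e (entry-distinct _ _ lt (ℕP.≤-pred (FinP.toℕ<n d)))
  ... | tri≈ _ e' _ = FinP.toℕ-injective e'
  ... | tri> _ _ gt = contradiction (sym e) (entry-distinct _ _ gt (ℕP.≤-pred (FinP.toℕ<n c)))

  extended-injective : ∀ {a b} → SumView (suc j') (size cs) a → SumView (suc j') (size cs) b →
    proj₂ (lookup extended a) ≡ proj₂ (lookup extended b) → a ≡ b
  extended-injective (left c) (right d) eq = contradiction eq (cross c d)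
  extended-injective (right c) (left d) eq = contradiction (sym eq) (cross d c)
  extended-injective (right c) (right d) eq = cong (suc j' Fin.↑ʳ_) (injective (trans (sym (cong proj₂ (extended-right c))) (trans eq (cong proj₂ (extended-right d)))))
  extended-injective (left c) (left d) eq = cong (Fin._↑ˡ size cs) (entry-injective c d (trans (sym (cong proj₂ (extended-left c))) (trans eq (cong proj₂ (extended-left d)))))

  twisted : Sign × Fin (size ((j' , θ) ∷ cs)) → Sign × Fin n
  twisted (s , b) = s Sign.* proj₁ (lookup extended b) , proj₂ (lookup extended b)

  entry-suc : ∀ b → Dec (j' ≡ toℕ b) →
    entry (suc (toℕ b)) ≡ (sgn (block j' θ) b Sign.* proj₁ (entry (toℕ (perm (block j' θ) b))) , proj₂ (entry (toℕ (perm (block j' θ) b))))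
  -- The last letter of the block: the next iterate is `i` again, and the sign of the whole turn is
  -- the class θ that the block puts on its closing arrow.
  entry-suc b (yes eq) = trans (cong entry (cong suc (sym eq))) (trans (cong₂ _,_ (proj₁ (proj₂ isT)) (proj₁ isT))
    (sym (trans (cong (λ w → proj₁ w Sign.* proj₁ (entry (toℕ (proj₂ w))) , proj₂ (entry (toℕ (proj₂ w)))) (Block.lookup-last j' θ b eq))
      (cong (_, i) (SignP.*-identityʳ θ)))))
  entry-suc b (no ne) = sym (cong₂ (λ s q → s Sign.* proj₁ (entry q) , proj₂ (entry q)) (proj₁ (Block.lookup-next j' θ b ne)) (proj₂ (Block.lookup-next j' θ b ne)))

  extended-intertwines : ∀ {a} → SumView (suc j') (size cs) a → act z (lookup extended a) ≡ twisted (lookup (rep ((j' , θ) ∷ cs)) a)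
  extended-intertwines (right b) = trans (cong (act z) (extended-right b)) (trans (intertwines b)
    (sym (trans (cong twisted (lookup-right b)) (cong (λ w → sgn (rep cs) b Sign.* proj₁ w , proj₂ w) (extended-right (perm (rep cs) b))))))
  extended-intertwines (left b) = trans (cong (act z) (extended-left b)) (trans (entry-suc b (j' ℕ.≟ toℕ b))
    (sym (trans (cong twisted (lookup-left b)) (cong (λ w → sgn (block j' θ) b Sign.* proj₁ w , proj₂ w) (extended-left (perm (block j' θ) b))))))

  step : Embedding z ((j' , θ) ∷ cs) L
  step = record
    { g = extended
    ; range = λ a → extended-range a (sumView _ _ a)
    ; injective = λ {a} {b} → extended-injective (sumView _ _ a) (sumView _ _ b)
    ; intertwines = λ a → extended-intertwines (sumView _ _ a)
    }

module _ {n : ℕ} {z : SPerm n} (gz : Good z) where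

  iterates-closed : ∀ {L} → (∀ j → j ∈ L → perm z j ∈ L) → ∀ {i} → i ∈ L → ∀ m → iterPerm z m i ∈ L
  iterates-closed closed i∈ zero = i∈
  iterates-closed closed i∈ (suc m) = closed _ (iterates-closed closed i∈ m)

  ∈-orbit⁻ : ∀ i j → j ∈ orbit z i → ∃ λ q → iterPerm z q i ≡ j
  ∈-orbit⁻ i j m with ∈P.∈-map⁻ (λ q → iterPerm z q i) {xs = upTo (suc (proj₁ (type z i)))} m
  ... | q , _ , eq = q , sym eq

  -- If the image of `j` lay on the orbit of `i`, then `j` would reach `i`, and going on around the
  -- cycle would lead from `i` back to `j`.
  outside-closed : ∀ i j → j ∉ orbit z i → perm z j ∉ orbit z i
  outside-closed i j j∉ m with ∈-orbit⁻ i (perm z j) m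
  ... | q , eq with reverse-orbit {x = z} gz (perm z j) i q eq
  ...   | b , eq' with reverse-orbit {x = z} gz i j (suc b) (trans (iterPerm-suc z b j) eq')
  ...     | c , eq'' = j∉ (subst (_∈ orbit z i) eq'' (∈-orbit {x = z} gz i c))

  outside : Fin n → List (Fin n) → List (Fin n)
  outside i = filter (λ j → ¬? (j ∈ᶠ? orbit z i))

  ∈-outside⁻ : ∀ i L j → j ∈ outside i L → j ∈ L × j ∉ orbit z i
  ∈-outside⁻ i L j m = ∈P.∈-filter⁻ (λ j → ¬? (j ∈ᶠ? orbit z i)) {xs = L} m

  outside-types : ∀ {i t cs L} → type z i ≡ t → Unique L → (∀ m → iterPerm z m i ∈ L) →
    map (type z) L ↭ expand (t ∷ cs) → map (type z) (outside i L) ↭ expand cs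
  outside-types {i} {t} {cs} {L} ti u orbit⊆L p = ++-cancelˡ-↭ (replicate (suc (proj₁ t)) t)
    (↭-trans (↭.↭-reflexive (cong (_++ map (type z) (outside i L))
       (sym (trans (orbit-types {x = z} gz i) (cong (λ t → replicate (suc (proj₁ t)) t) ti)))))
     (↭-trans (↭.↭-reflexive (sym (ListP.map-++ (type z) (orbit z i) (outside i L))))
       (↭-trans (↭P.map⁺ (type z) (↭-sym (↭-trans (↭-filter-¬ (_∈ᶠ? orbit z i) L) (↭P.++⁺ʳ (outside i L) inside)))) p)))
    where
    inside : filter (_∈ᶠ? orbit z i) L ↭ orbit z i
    inside = unique∧set⇒↭ (UniqueP.filter⁺ (_∈ᶠ? orbit z i) u) (orbit-unique {x = z} gz i)
      (λ j m → proj₂ (∈P.∈-filter⁻ (_∈ᶠ? orbit z i) {xs = L} m))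
      (λ j m → ∈P.∈-filter⁺ (_∈ᶠ? orbit z i) (subst (_∈ L) (proj₂ (∈-orbit⁻ i j m)) (orbit⊆L (proj₁ (∈-orbit⁻ i j m)))) m)

  -- The induction on `cs` runs over stable sets `L` of letters still available: a letter of the
  -- type of the first cycle is found in `L`, and its orbit is removed before the next step.
  embedding : ∀ cs L → Unique L → (∀ j → j ∈ L → perm z j ∈ L) → map (type z) L ↭ expand cs → Embedding z cs L
  embedding [] L u closed p = record { g = [] ; range = λ () ; injective = λ { {()} } ; intertwines = λ () }
  embedding ((j' , θ) ∷ cs) L u closed p = EmbeddingStep.step gz j' θ cs
    (subst (IsType z i) (sym ti) (type-isType {x = z} gz i))
    {L' = outside i L} orbit⊆L
    (λ j m → proj₁ (∈-outside⁻ i L j m) , λ q eq → proj₂ (∈-outside⁻ i L j m) (subst (_∈ orbit z i) eq (∈-orbit {x = z} gz i q)))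
    (embedding cs (outside i L) (UniqueP.filter⁺ (λ j → ¬? (j ∈ᶠ? orbit z i)) u)
      (λ j m → ∈P.∈-filter⁺ (λ j → ¬? (j ∈ᶠ? orbit z i)) (closed j (proj₁ (∈-outside⁻ i L j m))) (outside-closed i j (proj₂ (∈-outside⁻ i L j m))))
      (outside-types {i} {j' , θ} {cs} {L} (sym ti) u orbit⊆L p))
    where
    found : ∃ λ i → i ∈ L × (j' , θ) ≡ type z i
    found = ∈P.∈-map⁻ (type z) (↭P.∈-resp-↭ (↭-sym p) (here refl))
    i = proj₁ found
    ti = proj₂ (proj₂ found)
    orbit⊆L : ∀ m → iterPerm z m i ∈ L
    orbit⊆L = iterates-closed closed (proj₁ (proj₂ found))

conjugate-to-rep : ∀ cs {z : SPerm (size cs)} → Good z → types z ↭ types (rep cs) → ∃ λ (g : SPerm (size cs)) → Good g × z ∘B g ≡ g ∘B rep cs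
conjugate-to-rep cs {z} gz p = g , injective , ≡-lookup (λ a → trans (lookup-∘B z g a) (trans (intertwines a) (sym (lookup-∘B g (rep cs) a))))
  where open Embedding (embedding {z = z} gz cs (allFin (size cs)) (UniqueP.allFin⁺ (size cs)) (λ j _ → ∈P.∈-allFin (perm z j)) (subst (types z ↭_) (types-rep cs) p))

-- Double counting

Bn-reindex : (ϕ : SPerm n → SPerm n) → (∀ {x y} → ϕ x ≡ ϕ y → x ≡ y) → (∀ x → Good x → Good (ϕ x)) →
  (∀ y → Good y → ∃ λ x → Good x × ϕ x ≡ y) → map ϕ (Bn n) ↭ Bn n
Bn-reindex {n} ϕ inj good onto = unique∧set⇒↭ (UniqueP.map⁺ inj (Bn-unique n)) (Bn-unique n) to from
  where
  to : ∀ y → y ∈ map ϕ (Bn n) → y ∈ Bn n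
  to y m with ∈P.∈-map⁻ ϕ m
  ... | x , m' , refl = ∈-Bn {x = ϕ x} (good x (Good-Bn {x = x} m'))
  from : ∀ y → y ∈ Bn n → y ∈ map ϕ (Bn n)
  from y m with onto y (Good-Bn {x = y} m)
  ... | x , gx , refl = ∈P.∈-map⁺ ϕ (∈-Bn {x = x} gx)

∑-reindex : (ϕ : SPerm n → SPerm n) → map ϕ (Bn n) ↭ Bn n → (F : SPerm n → ℚ) → ∑ (Bn n) F ≡ ∑ (Bn n) (F ∘ ϕ)
∑-reindex {n} ϕ p F = trans (sym (∑-↭ F p)) (∑-map ϕ (Bn n) F)

translate-↭ : ∀ {g : SPerm n} → Good g → map (g ∘B_) (Bn n) ↭ Bn n
translate-↭ {g = g} gg = Bn-reindex (g ∘B_) (∘B-cancelˡ {x = g} gg) (λ x gx → Good-∘B {x = g} {x} gg gx)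
  (λ y gy → inverse g ∘B y , Good-∘B {x = inverse g} {y} (Good-inverse {x = g} gg) gy ,
    trans (sym (∘B-assoc g (inverse g) y)) (trans (cong (_∘B y) (inverseʳ {x = g} gg)) (∘B-identityˡ y)))

∘B-cancelʳ : ∀ {g : SPerm n} → Good g → ∀ {x y} → x ∘B g ≡ y ∘B g → x ≡ y
∘B-cancelʳ {g = g} gg {x} {y} eq = trans (sym (undo x)) (trans (cong (_∘B inverse g) eq) (undo y))
  where
  undo : ∀ w → (w ∘B g) ∘B inverse g ≡ w
  undo w = trans (∘B-assoc w g (inverse g)) (trans (cong (w ∘B_) (inverseʳ {x = g} gg)) (∘B-identityʳ w))

conj : SPerm n → SPerm n → SPerm n
conj g x = (g ∘B x) ∘B inverse g

conj-∘B : ∀ {g : SPerm n} → Good g → ∀ x → conj g x ∘B g ≡ g ∘B x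
conj-∘B {g = g} gg x = trans (∘B-assoc (g ∘B x) (inverse g) g) (trans (cong ((g ∘B x) ∘B_) (inverseˡ {x = g} gg)) (∘B-identityʳ _))

Good-conj : ∀ {g x : SPerm n} → Good g → Good x → Good (conj g x)
Good-conj {g = g} {x} gg gx = Good-∘B {x = g ∘B x} {inverse g} (Good-∘B {x = g} {x} gg gx) (Good-inverse {x = g} gg)

conj-↭ : ∀ {g : SPerm n} → Good g → map (conj g) (Bn n) ↭ Bn n
conj-↭ {g = g} gg = Bn-reindex (conj g) (λ {x} {y} eq → ∘B-cancelˡ {x = g} gg (∘B-cancelʳ {g = inverse g} (Good-inverse {x = g} gg) eq))
  (λ x gx → Good-conj {g = g} {x} gg gx)
  (λ y gy → (inverse g ∘B y) ∘B g ,
    Good-∘B {x = inverse g ∘B y} {g} (Good-∘B {x = inverse g} {y} (Good-inverse {x = g} gg) gy) gg ,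
    ∘B-cancelʳ {g = g} gg (trans (conj-∘B {g = g} gg _) (trans (sym (∘B-assoc g (inverse g ∘B y) g))
      (cong (_∘B g) (trans (sym (∘B-assoc g (inverse g) y)) (trans (cong (_∘B y) (inverseʳ {x = g} gg)) (∘B-identityˡ y)))))))

^B-intertwined : ∀ (z g y : SPerm n) → z ∘B g ≡ g ∘B y → ∀ k → (z ^B k) ∘B g ≡ g ∘B (y ^B k)
^B-intertwined z g y eq zero = trans (∘B-identityˡ g) (sym (∘B-identityʳ g))
^B-intertwined z g y eq (suc k) = begin
  (z ∘B (z ^B k)) ∘B g ≡⟨ ∘B-assoc z (z ^B k) g ⟩
  z ∘B ((z ^B k) ∘B g) ≡⟨ cong (z ∘B_) (^B-intertwined z g y eq k) ⟩
  z ∘B (g ∘B (y ^B k)) ≡⟨ ∘B-assoc z g (y ^B k) ⟨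
  (z ∘B g) ∘B (y ^B k) ≡⟨ cong (_∘B (y ^B k)) eq ⟩
  (g ∘B y) ∘B (y ^B k) ≡⟨ ∘B-assoc g y (y ^B k) ⟩
  g ∘B (y ∘B (y ^B k)) ∎
  where open ≡-Reasoning

module DoubleCount (c : Character) (k : ℕ) where
  open Character c
  open ClassFunction c

  rootSum : SPerm n → ℚ
  rootSum {n} y = ∑ (Bn n) (λ x → ⟦ does ((x ^B k) ≟B y) ⟧ * toℚ (value x))

  rootSum-rootsWith : ∀ (y : SPerm n) → toℚ (rootsWith value k y) ≡ rootSum y
  rootSum-rootsWith {n} y = trans (toℚ-sumℤ (filterᵇ (λ x → does ((x ^B k) ≟B y)) (Bn n)) value) (∑-filterᵇ (λ x → does ((x ^B k) ≟B y)) (Bn n) (toℚ ∘ value))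

  -- Substitution of g x g⁻¹ for x, under which the class function is constant. Written as x^k g = g
  -- y, the condition can be read for fixed x as one on g.
  rootSum-conjugate : ∀ {g : SPerm n} → Good g → ∀ y →
    rootSum y ≡ ∑ (Bn n) (λ x → ⟦ does (((x ^B k) ∘B g) ≟B (g ∘B y)) ⟧ * toℚ (value x))
  rootSum-conjugate {n} {g} gg y = sym (trans (∑-reindex (conj g) (conj-↭ {g = g} gg) _) (∑-cong-∈ (Bn n) (λ x m → cong₂ (λ b v → ⟦ b ⟧ * toℚ v)
    (does-cong (((conj g x ^B k) ∘B g) ≟B (g ∘B y)) ((x ^B k) ≟B y)
      (λ eq → ∘B-cancelˡ {x = g} gg (trans (sym (power x)) eq)) (λ eq → trans (power x) (cong (g ∘B_) eq)))
    (value-types {x = conj g x} {x} (Good-conj {g = g} {x} gg (Good-Bn {x = x} m)) (Good-Bn {x = x} m)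
      (types-conjugate {z = conj g x} {g} {x} (Good-conj {g = g} {x} gg (Good-Bn {x = x} m)) gg (Good-Bn {x = x} m) (conj-∘B {g = g} gg x))))))
    where
    power : ∀ x → (conj g x ^B k) ∘B g ≡ g ∘B (x ^B k)
    power x = ^B-intertwined (conj g x) g x (conj-∘B {g = g} gg x) k

  -- For fixed z = x^k, the g with z g = g y form a coset of the centralizer of y if z and y have
  -- the same cycle type, and there are none otherwise. `I` is the indicator of the first case, left
  -- abstract so that a coefficient of a monomial can take its place.
  double-count : ∀ cs (I : SPerm (size cs) → ℚ) →
    (∀ z → Good z → (types z ↭ types (rep cs) × I z ≡ 1ℚ) ⊎ (¬ (types z ↭ types (rep cs)) × I z ≡ 0ℚ)) →
    fromℕ (length (Bn (size cs))) * toℚ (rootsWith value k (rep cs))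
      ≡ fromℕ (centralizerOrder (rep cs)) * ∑ (Bn (size cs)) (λ x → I (x ^B k) * toℚ (value x))
  double-count cs I h = begin
    fromℕ (length 𝔹) * toℚ (rootsWith value k y) ≡⟨ cong (fromℕ (length 𝔹) *_) (rootSum-rootsWith y) ⟩
    fromℕ (length 𝔹) * rootSum y ≡⟨ ∑-length 𝔹 (rootSum y) ⟨
    ∑ 𝔹 (λ _ → rootSum y) ≡⟨ ∑-cong-∈ 𝔹 (λ g m → rootSum-conjugate {g = g} (Good-Bn {x = g} m) y) ⟩
    ∑ 𝔹 (λ g → ∑ 𝔹 (λ x → ⟦ does (((x ^B k) ∘B g) ≟B (g ∘B y)) ⟧ * toℚ (value x))) ≡⟨ ∑-swap 𝔹 𝔹 _ ⟩
    ∑ 𝔹 (λ x → ∑ 𝔹 (λ g → ⟦ does (((x ^B k) ∘B g) ≟B (g ∘B y)) ⟧ * toℚ (value x))) ≡⟨ ∑-cong-∈ 𝔹 (λ x m → trans (∑-*ʳ 𝔹 (toℚ (value x)) _) (cong (_* toℚ (value x)) (intertwiners (x ^B k) (Good-^B {x = x} (Good-Bn {x = x} m) k)))) ⟩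
    ∑ 𝔹 (λ x → (Z * I (x ^B k)) * toℚ (value x)) ≡⟨ ∑-cong 𝔹 (λ x → ℚP.*-assoc Z _ _) ⟩
    ∑ 𝔹 (λ x → Z * (I (x ^B k) * toℚ (value x))) ≡⟨ ∑-*ˡ 𝔹 Z _ ⟩
    Z * ∑ 𝔹 (λ x → I (x ^B k) * toℚ (value x)) ∎
    where
    open ≡-Reasoning
    y = rep cs
    𝔹 = Bn (size cs)
    Z = fromℕ (centralizerOrder y)
    gy : Good y
    gy = Good-rep cs
    centralizer-sum : ∑ 𝔹 (λ x → ⟦ does ((x ∘B y) ≟B (y ∘B x)) ⟧) ≡ Z
    centralizer-sum = sym (trans (sym (ℚP.*-identityʳ Z)) (trans (sym (∑-length (filterᵇ (λ x → does ((x ∘B y) ≟B (y ∘B x))) 𝔹) 1ℚ))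
      (trans (∑-filterᵇ (λ x → does ((x ∘B y) ≟B (y ∘B x))) 𝔹 (λ _ → 1ℚ)) (∑-cong 𝔹 (λ x → ℚP.*-identityʳ _)))))
    intertwiners : ∀ z → Good z → ∑ 𝔹 (λ g → ⟦ does ((z ∘B g) ≟B (g ∘B y)) ⟧) ≡ Z * I z
    intertwiners z gz with h z gz
    ... | inj₂ (¬p , Iz) = trans (∑-zero-∈ 𝔹 (λ g m → cong ⟦_⟧ (dec-false ((z ∘B g) ≟B (g ∘B y))
            (λ eq → ¬p (types-conjugate {z = z} {g} {y} gz (Good-Bn {x = g} m) gy eq)))))
            (sym (trans (cong (Z *_) Iz) (ℚP.*-zeroʳ Z)))
    ... | inj₁ (p , Iz) with conjugate-to-rep cs {z} gz p
    -- Translation by one intertwiner `g₀` turns the set of all of them into the centralizer.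
    ...   | g₀ , gg₀ , eq₀ = trans (∑-reindex (g₀ ∘B_) (translate-↭ {g = g₀} gg₀) _)
            (trans (∑-cong 𝔹 (λ g → cong ⟦_⟧ (does-cong ((z ∘B (g₀ ∘B g)) ≟B ((g₀ ∘B g) ∘B y)) ((g ∘B y) ≟B (y ∘B g))
               (λ eq → sym (∘B-cancelˡ {x = g₀} gg₀ (trans (sym (push g)) (trans eq (∘B-assoc g₀ g y)))))
               (λ eq → trans (push g) (trans (cong (g₀ ∘B_) (sym eq)) (sym (∘B-assoc g₀ g y)))))))
              (trans centralizer-sum (sym (trans (cong (Z *_) Iz) (ℚP.*-identityʳ Z)))))
      where
      push : ∀ g → z ∘B (g₀ ∘B g) ≡ g₀ ∘B (y ∘B g)
      push g = trans (sym (∘B-assoc z g₀ g)) (trans (cong (_∘B g) eq₀) (∘B-assoc g₀ y g))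

-- The recursion for the sums over Bₙ

-- Division of a monomial by the variable of index j + 1 and class θ, `nothing` if it does not
-- divide. Variables beyond the first N never divide, which amounts to setting them to zero.
dec : Type → Mon N → Maybe (Mon N)
dec (j , θ) [] = nothing
dec (zero , Sign.+) ((zero , b) ∷ e) = nothing
dec (zero , Sign.+) ((suc a , b) ∷ e) = just ((a , b) ∷ e)
dec (zero , Sign.-) ((a , zero) ∷ e) = nothing
dec (zero , Sign.-) ((a , suc b) ∷ e) = just ((a , b) ∷ e)
dec (suc j , θ) (p ∷ e) = Maybe.map (p ∷_) (dec (j , θ) e)

decs : Type → ℕ → Mon N → Maybe (Mon N)
decs t zero e = just e
decs t (suc m) e = dec t e >>= decs t m

-- With `dec t e` as second argument, the coefficient of `e` in the product of the variable t with
-- the series.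
apply : Ser N → Maybe (Mon N) → ℚ
apply X = maybe′ X 0ℚ

-- The coefficient of `e` in the product of the variables listed: 1 if the list consists of the
-- letters of `e` in some order, and 0 otherwise.
weight : List Type → Ser N
weight [] e = oneS e
weight (t ∷ ts) e = apply (weight ts) (dec t e)

dec-comm : ∀ t u (e : Mon N) → (dec t e >>= dec u) ≡ (dec u e >>= dec t)
dec-comm t u [] = refl
dec-comm (zero , Sign.+) (zero , Sign.+) (_ ∷ e) = refl
dec-comm (zero , Sign.-) (zero , Sign.-) (_ ∷ e) = refl
dec-comm (zero , Sign.+) (zero , Sign.-) ((zero , zero) ∷ e) = refl
dec-comm (zero , Sign.+) (zero , Sign.-) ((zero , suc b) ∷ e) = refl
dec-comm (zero , Sign.+) (zero , Sign.-) ((suc a , zero) ∷ e) = refl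
dec-comm (zero , Sign.+) (zero , Sign.-) ((suc a , suc b) ∷ e) = refl
dec-comm (zero , Sign.-) (zero , Sign.+) ((zero , zero) ∷ e) = refl
dec-comm (zero , Sign.-) (zero , Sign.+) ((zero , suc b) ∷ e) = refl
dec-comm (zero , Sign.-) (zero , Sign.+) ((suc a , zero) ∷ e) = refl
dec-comm (zero , Sign.-) (zero , Sign.+) ((suc a , suc b) ∷ e) = refl
dec-comm (zero , Sign.+) (suc j , θ) ((zero , b) ∷ e) with dec (j , θ) e
... | just _ = refl
... | nothing = refl
dec-comm (zero , Sign.+) (suc j , θ) ((suc a , b) ∷ e) with dec (j , θ) e
... | just _ = refl
... | nothing = refl
dec-comm (zero , Sign.-) (suc j , θ) ((a , zero) ∷ e) with dec (j , θ) e
... | just _ = refl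
... | nothing = refl
dec-comm (zero , Sign.-) (suc j , θ) ((a , suc b) ∷ e) with dec (j , θ) e
... | just _ = refl
... | nothing = refl
dec-comm (suc j , θ) (zero , Sign.+) ((zero , b) ∷ e) with dec (j , θ) e
... | just _ = refl
... | nothing = refl
dec-comm (suc j , θ) (zero , Sign.+) ((suc a , b) ∷ e) with dec (j , θ) e
... | just _ = refl
... | nothing = refl
dec-comm (suc j , θ) (zero , Sign.-) ((a , zero) ∷ e) with dec (j , θ) e
... | just _ = refl
... | nothing = refl
dec-comm (suc j , θ) (zero , Sign.-) ((a , suc b) ∷ e) with dec (j , θ) e
... | just _ = refl
... | nothing = refl
dec-comm (suc j , θ) (suc j' , θ') (p ∷ e) = trans (push (dec (j , θ) e) (j' , θ'))
  (trans (cong (Maybe.map (p ∷_)) (dec-comm (j , θ) (j' , θ') e)) (sym (push (dec (j' , θ') e) (j , θ))))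
  where
  push : ∀ m u → (Maybe.map (p ∷_) m >>= dec (suc (proj₁ u) , proj₂ u)) ≡ Maybe.map (p ∷_) (m >>= dec u)
  push nothing u = refl
  push (just _) u = refl

apply->>= : ∀ (X : Ser N) (k : Mon N → Maybe (Mon N)) m → apply X (m >>= k) ≡ apply (λ e → apply X (k e)) m
apply->>= X k nothing = refl
apply->>= X k (just e) = refl

apply-cong : ∀ {X Y : Ser N} → (∀ e → X e ≡ Y e) → ∀ m → apply X m ≡ apply Y m
apply-cong h nothing = refl
apply-cong h (just e) = h e

weight-↭ : ∀ {ts us} → ts ↭ us → ∀ (e : Mon N) → weight ts e ≡ weight us e
weight-↭ ↭.refl e = refl
weight-↭ (↭.prep t p) e = apply-cong (weight-↭ p) (dec t e)
weight-↭ (↭.swap {ts} {us} t u p) e = begin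
  apply (weight (u ∷ ts)) (dec t e) ≡⟨ apply->>= (weight ts) (dec u) (dec t e) ⟨
  apply (weight ts) (dec t e >>= dec u) ≡⟨ cong (apply (weight ts)) (dec-comm t u e) ⟩
  apply (weight ts) (dec u e >>= dec t) ≡⟨ apply-cong (weight-↭ p) (dec u e >>= dec t) ⟩
  apply (weight us) (dec u e >>= dec t) ≡⟨ apply->>= (weight us) (dec t) (dec u e) ⟩
  apply (weight (t ∷ us)) (dec u e) ∎
  where open ≡-Reasoning
weight-↭ (↭.trans p q) e = trans (weight-↭ p e) (weight-↭ q e)

weight-replicate : ∀ m t ts (e : Mon N) → weight (replicate m t ++ ts) e ≡ apply (weight ts) (decs t m e)
weight-replicate zero t ts e = refl
weight-replicate (suc m) t ts e = trans (apply-cong (weight-replicate m t ts) (dec t e)) (sym (apply->>= (weight ts) (decs t m) (dec t e)))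

lengthen : Type → Type
lengthen (l , ε) = suc l , ε

Good-idB : Good (idB {n})
Good-idB {n} {i} {j} eq = trans (sym (cong proj₂ (lookup-idB i))) (trans eq (cong proj₂ (lookup-idB j)))

-- Some element that takes 0 to `i`; conjugation by it makes all letters equivalent.
moveZero : Fin (suc n) → SPerm (suc n)
moveZero i = decode (Sign.+ , i , idB)

Good-moveZero : ∀ (i : Fin (suc n)) → Good (moveZero i)
Good-moveZero i = Good-decode Sign.+ i {idB} Good-idB

perm-moveZero : ∀ (i : Fin (suc n)) → perm (moveZero i) Fin.zero ≡ i
perm-moveZero Fin.zero = refl
perm-moveZero (Fin.suc i) = refl

∑-neg : ∀ {A : Set} (xs : List A) (f : A → ℚ) → ∑ xs (λ x → - f x) ≡ - ∑ xs f
∑-neg [] f = refl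
∑-neg (x ∷ xs) f = trans (cong (- f x +_) (∑-neg xs f)) (sym (ℚP.neg-distrib-+ (f x) (∑ xs f)))

cardB : ℕ → ℕ
cardB n = length (Bn n)

length-cartesianProduct : ∀ {A B : Set} (xs : List A) (ys : List B) → length (cartesianProduct xs ys) ≡ length xs ℕ.* length ys
length-cartesianProduct [] ys = refl
length-cartesianProduct (x ∷ xs) ys = trans (ListP.length-++ (map (x ,_) ys)) (cong₂ ℕ._+_ (ListP.length-map _ ys) (length-cartesianProduct xs ys))

cardB-suc : ∀ n → cardB (suc n) ≡ 2 ℕ.* (suc n ℕ.* cardB n)
cardB-suc n = trans (↭P.↭-length (Bn-decode n)) (trans (ListP.length-map decode (cartesianProduct Z2 (cartesianProduct (allFin (suc n)) (Bn n))))
  (trans (length-cartesianProduct Z2 (cartesianProduct (allFin (suc n)) (Bn n))) (cong (2 ℕ.*_) (trans (length-cartesianProduct (allFin (suc n)) (Bn n)) (cong (ℕ._* cardB n) (ListP.length-tabulate {n = suc n} id))))))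

cardB-positive : ∀ n → 1 ≤ cardB n
cardB-positive zero = s≤s z≤n
cardB-positive (suc n) = subst (1 ≤_) (sym (cardB-suc n)) (ℕP.*-mono-≤ {1} {2} (s≤s z≤n) (ℕP.*-mono-≤ {1} {suc n} (s≤s z≤n) (cardB-positive n)))

-- Stripping the cycle of the letter 0

module HeadRecursion (c : Character) where
  open Character c
  open ClassFunction c

  ϕ : Sign → ℚ
  ϕ s = toℚ (negOnePow (twist s))

  typeSum : ℕ → (List Type → ℚ) → ℚ
  typeSum n ψ = ∑ (Bn n) (λ x → toℚ (value x) * ψ (types x))

  -- `Ψ` tests the cycle through `i` together with the remaining letters. It is arbitrary because
  -- each removal of a letter replaces it by its composite with `lengthen`.
  letterSum : ∀ {n} → Fin n → (Type → List Type → ℚ) → ℚ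
  letterSum {n} i Ψ = ∑ (Bn n) (λ x → toℚ (value x) * Ψ (type x i) (otherTypes x i))

  headSum : ℕ → (Type → List Type → ℚ) → ℚ
  headSum n Ψ = letterSum {suc n} Fin.zero Ψ

  Invariant : (Type → List Type → ℚ) → Set
  Invariant Ψ = ∀ t {U V} → U ↭ V → Ψ t U ≡ Ψ t V

  letterSum-headSum : ∀ {Ψ} → Invariant Ψ → ∀ {n} (i : Fin (suc n)) → letterSum i Ψ ≡ headSum n Ψ
  letterSum-headSum {Ψ} inv {n} i = trans (∑-reindex (conj g) (conj-↭ {g = g} gg) _) (∑-cong-∈ (Bn (suc n)) (λ x m →
    cong₂ _*_ (cong toℚ (value-types {x = conj g x} {x} (gc x m) (Good-Bn {x = x} m) (types-conjugate {z = conj g x} {g} {x} (gc x m) gg (Good-Bn {x = x} m) (conj-∘B {g = g} gg x))))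
      (trans (cong₂ Ψ (trans (cong (type (conj g x)) (sym (perm-moveZero i))) (type-conjugate {z = conj g x} {g} {x} (gc x m) gg (Good-Bn {x = x} m) (conj-∘B {g = g} gg x) Fin.zero))
               (cong (otherTypes (conj g x)) (sym (perm-moveZero i))))
        (inv _ (otherTypes-conjugate {z = conj g x} {g} {x} (gc x m) gg (Good-Bn {x = x} m) (conj-∘B {g = g} gg x) Fin.zero)))))
    where
    g = moveZero i
    gg : Good g
    gg = Good-moveZero i
    gc : ∀ x → x ∈ Bn (suc n) → Good (conj g x)
    gc x m = Good-conj {g = g} {x} gg (Good-Bn {x = x} m)

  -- Either 0 is a cycle by itself, with factor ϕ(s), or it stands in front of some `i`. Then its
  -- removal reverses the value and shortens the cycle by one, so `Ψ` sees the cycle of `i`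
  -- lengthened.
  headSum-decode : ∀ {Ψ} → Invariant Ψ → ∀ n → headSum n Ψ ≡
    ∑ Z2 (λ s → ϕ s * typeSum n (Ψ (0 , s)) + ∑ (allFin n) (λ i → - letterSum i (Ψ ∘ lengthen)))
  headSum-decode {Ψ} inv n = begin
    headSum n Ψ ≡⟨ ∑-↭ F (Bn-decode n) ⟩
    ∑ (map decode (cartesianProduct Z2 (cartesianProduct (allFin (suc n)) (Bn n)))) F ≡⟨ ∑-map decode (cartesianProduct Z2 (cartesianProduct (allFin (suc n)) (Bn n))) F ⟩
    ∑ (cartesianProduct Z2 (cartesianProduct (allFin (suc n)) (Bn n))) (F ∘ decode) ≡⟨ ∑-cartesianProductWith _,_ Z2 (cartesianProduct (allFin (suc n)) (Bn n)) (F ∘ decode) ⟩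
    ∑ Z2 (λ s → ∑ (cartesianProduct (allFin (suc n)) (Bn n)) (λ p → F (decode (s , p)))) ≡⟨ ∑-cong Z2 (λ s → begin
      ∑ (cartesianProduct (allFin (suc n)) (Bn n)) (λ p → F (decode (s , p))) ≡⟨ ∑-cartesianProductWith _,_ (allFin (suc n)) (Bn n) (λ p → F (decode (s , p))) ⟩
      ∑ (allFin (suc n)) (λ i → ∑ (Bn n) (λ x → F (decode (s , i , x)))) ≡⟨ cong (λ xs → ∑ xs (λ i → ∑ (Bn n) (λ x → F (decode (s , i , x))))) (allFin-suc n) ⟩
      ∑ (Bn n) (λ x → F (fixHead s x)) + ∑ (map Fin.suc (allFin n)) (λ i → ∑ (Bn n) (λ x → F (decode (s , i , x))))
        ≡⟨ cong₂ _+_ (fixed s) (trans (∑-map Fin.suc (allFin n) _) (∑-cong (allFin n) (λ i → inserted s i))) ⟩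
      ϕ s * typeSum n (Ψ (0 , s)) + ∑ (allFin n) (λ i → - letterSum i (Ψ ∘ lengthen)) ∎) ⟩
    _ ∎
    where
    open ≡-Reasoning
    F : SPerm (suc n) → ℚ
    F x = toℚ (value x) * Ψ (type x Fin.zero) (otherTypes x Fin.zero)
    fixed : ∀ s → ∑ (Bn n) (λ x → F (fixHead s x)) ≡ ϕ s * typeSum n (Ψ (0 , s))
    fixed s = trans (∑-cong-∈ (Bn n) (λ x m → trans
        (cong₂ _*_ (trans (cong toℚ (value-fixHead s x)) (toℚ-* (negOnePow (twist s)) (value x)))
          (inv (0 , s) (FixHead.otherTypes-zero s {x} (Good-Bn {x = x} m))))
        (ℚP.*-assoc (ϕ s) (toℚ (value x)) _)))
      (∑-*ˡ (Bn n) (ϕ s) _)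
    inserted : ∀ s i → ∑ (Bn n) (λ x → F (insertHead s i x)) ≡ - letterSum i (Ψ ∘ lengthen)
    inserted s i = trans (∑-cong-∈ (Bn n) (λ x m → trans
        (cong₂ _*_ (trans (cong toℚ (value-insertHead s i {x} (Good-Bn {x = x} m))) (toℚ-neg (value x)))
          (cong₂ Ψ (InsertHead.type-zero s i {x} (Good-Bn {x = x} m)) (InsertHead.otherTypes-zero s i {x} (Good-Bn {x = x} m))))
        (sym (ℚP.neg-distribˡ-* (toℚ (value x)) _))))
      (∑-neg (Bn n) _)

  headSum-zero : ∀ {Ψ} → Invariant Ψ → headSum 0 Ψ ≡ ∑ Z2 (λ s → ϕ s * typeSum 0 (Ψ (0 , s)))
  headSum-zero {Ψ} inv = trans (headSum-decode {Ψ} inv 0) (∑-cong Z2 (λ s → ℚP.+-identityʳ (ϕ s * typeSum 0 (Ψ (0 , s)))))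

  -- All n + 1 letters and both signs contribute equally, whence the factor 2 (n + 1).
  headSum-suc : ∀ {Ψ} → Invariant Ψ → ∀ n → headSum (suc n) Ψ ≡
    ∑ Z2 (λ s → ϕ s * typeSum (suc n) (Ψ (0 , s))) + - (fromℕ (2 ℕ.* suc n) * headSum n (Ψ ∘ lengthen))
  headSum-suc {Ψ} inv n = trans (headSum-decode {Ψ} inv (suc n)) (trans (∑-+ Z2 (λ s → ϕ s * typeSum (suc n) (Ψ (0 , s))) (λ _ → ∑ (allFin (suc n)) (λ i → - letterSum i (Ψ ∘ lengthen)))) (cong (∑ Z2 (λ s → ϕ s * typeSum (suc n) (Ψ (0 , s))) +_) (begin
    ∑ Z2 (λ s → ∑ (allFin (suc n)) (λ i → - letterSum i (Ψ ∘ lengthen))) ≡⟨ ∑-cong Z2 (λ _ → ∑-cong (allFin (suc n)) (λ i → cong -_ (letterSum-headSum {Ψ ∘ lengthen} (λ t → inv (lengthen t)) i))) ⟩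
    ∑ Z2 (λ s → ∑ (allFin (suc n)) (λ i → - H)) ≡⟨ ∑-cong Z2 (λ _ → trans (∑-length (allFin (suc n)) (- H)) (cong (λ q → fromℕ q * - H) (ListP.length-tabulate {n = suc n} id))) ⟩
    ∑ Z2 (λ s → fromℕ (suc n) * - H) ≡⟨ ∑-length Z2 _ ⟩
    fromℕ 2 * (fromℕ (suc n) * - H) ≡⟨ ℚP.*-assoc (fromℕ 2) (fromℕ (suc n)) (- H) ⟨
    (fromℕ 2 * fromℕ (suc n)) * - H ≡⟨ cong (_* - H) (fromℕ-* 2 (suc n)) ⟨
    fromℕ (2 ℕ.* suc n) * - H ≡⟨ ℚP.neg-distribʳ-* (fromℕ (2 ℕ.* suc n)) H ⟨
    - (fromℕ (2 ℕ.* suc n) * H) ∎)))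
    where
    open ≡-Reasoning
    H = headSum n (Ψ ∘ lengthen)

  typeSum-headSum : ∀ {ψ} → (∀ {ts us} → ts ↭ us → ψ ts ≡ ψ us) → ∀ n →
    typeSum (suc n) ψ ≡ headSum n (λ t U → ψ (replicate (suc (proj₁ t)) t ++ U))
  typeSum-headSum {ψ} inv n = ∑-cong-∈ (Bn (suc n)) (λ x m → cong (toℚ (value x) *_) (inv (types-split {x = x} (Good-Bn {x = x} m) Fin.zero)))

lengthenBy : ℕ → Type → Type
lengthenBy zero t = t
lengthenBy (suc r) t = lengthenBy r (lengthen t)

lengthenBy-≡ : ∀ r l s → lengthenBy r (l , s) ≡ (l ℕ.+ r , s)
lengthenBy-≡ zero l s = cong (_, s) (sym (ℕP.+-identityʳ l))
lengthenBy-≡ (suc r) l s = trans (lengthenBy-≡ r (suc l) s) (cong (_, s) (sym (ℕP.+-suc l r)))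

∑-apply : ∀ {A : Set} (xs : List A) (f : A → ℚ) (X : A → Ser N) m → ∑ xs (λ x → f x * apply (X x) m) ≡ apply (λ e → ∑ xs (λ x → f x * X x e)) m
∑-apply xs f X nothing = trans (∑-cong xs (λ x → ℚP.*-zeroʳ (f x))) (∑-zero xs)
∑-apply xs f X (just e) = refl

apply-* : ∀ c (X : Ser N) m → apply (λ e → c * X e) m ≡ c * apply X m
apply-* c X nothing = sym (ℚP.*-zeroʳ c)
apply-* c X (just e) = refl

∑-upTo-suc : ∀ n (f : ℕ → ℚ) → ∑ (upTo (suc n)) f ≡ f 0 + ∑ (upTo n) (f ∘ suc)
∑-upTo-suc n f = trans (cong (λ xs → f 0 + ∑ xs f) (sym (ListP.map-upTo suc n))) (cong (f 0 +_) (∑-map suc (upTo n) f))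

signℚ : ℕ → ℚ
signℚ l = toℚ (negOnePow l)

signℚ-suc : ∀ l → signℚ (suc l) ≡ - signℚ l
signℚ-suc l = toℚ-neg (negOnePow l)

module WeightRecursion (c : Character) (k : ℕ) where
  open Character c
  open HeadRecursion c

  weightSum : ℕ → Ser N
  weightSum n e = typeSum n (λ ts → weight (map (powerType k) ts) e)

  -- The average over Bₙ of the character times the monomial of the k-th power; this is what both
  -- sides are compared with.
  density : ℕ → Ser N
  density n e = recip (cardB n) * weightSum n e

  density-weightSum : ∀ n (e : Mon N) → weightSum n e ≡ fromℕ (cardB n) * density n e
  density-weightSum n e = sym (trans (sym (ℚP.*-assoc (fromℕ (cardB n)) (recip (cardB n)) (weightSum n e)))
    (trans (cong (_* weightSum n e) (trans (ℚP.*-comm (fromℕ (cardB n)) (recip (cardB n))) (recip-inverse (cardB n) (cardB-positive n)))) (ℚP.*-identityˡ _)))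

  module _ (e : Mon N) where
    contribution : ℕ → Type → ℚ
    contribution m (l , s) = apply (density m) (decs (powerType k (l , s)) (suc l) e)

    ψ : List Type → ℚ
    ψ ts = weight (map (powerType k) ts) e

    ψ-↭ : ∀ {ts us} → ts ↭ us → ψ ts ≡ ψ us
    ψ-↭ p = weight-↭ (↭P.map⁺ (powerType k) p) e

    Ψ : Type → List Type → ℚ
    Ψ t U = ψ (replicate (suc (proj₁ t)) t ++ U)

    Ψ-invariant : Invariant Ψ
    Ψ-invariant t p = ψ-↭ (↭P.++⁺ˡ (replicate (suc (proj₁ t)) t) p)

    typeSum-Ψ : ∀ m t → typeSum m (Ψ t) ≡ fromℕ (cardB m) * contribution m t
    typeSum-Ψ m t@(l , s) = begin
      ∑ (Bn m) (λ x → toℚ (value x) * ψ (replicate (suc l) t ++ types x)) ≡⟨ ∑-cong (Bn m) (λ x → cong (toℚ (value x) *_) (unfold (types x))) ⟩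
      ∑ (Bn m) (λ x → toℚ (value x) * apply (weight (map (powerType k) (types x))) D) ≡⟨ ∑-apply (Bn m) (toℚ ∘ value) (λ x → weight (map (powerType k) (types x))) D ⟩
      apply (weightSum m) D ≡⟨ apply-cong (density-weightSum m) D ⟩
      apply (λ e → fromℕ (cardB m) * density m e) D ≡⟨ apply-* (fromℕ (cardB m)) (density m) D ⟩
      fromℕ (cardB m) * contribution m t ∎
      where
      open ≡-Reasoning
      D = decs (powerType k t) (suc l) e
      unfold : ∀ ts → ψ (replicate (suc l) t ++ ts) ≡ apply (weight (map (powerType k) ts)) D
      unfold ts = trans (cong (λ us → weight us e) (trans (ListP.map-++ (powerType k) (replicate (suc l) t) ts)
        (cong (_++ map (powerType k) ts) (ListP.map-replicate (powerType k) (suc l) t)))) (weight-replicate (suc l) (powerType k t) (map (powerType k) ts) e)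

    -- The terms in which the head cycle ends up with l + 1 letters while `m` letters remain outside
    -- it.
    closing : ℕ → ℕ → ℚ
    closing m l = ∑ Z2 (λ s → ϕ s * contribution m (l , s))

    closing-typeSum : ∀ m r → ∑ Z2 (λ s → ϕ s * typeSum m (Ψ (lengthenBy r (0 , s)))) ≡ fromℕ (cardB m) * closing m r
    closing-typeSum m r = trans (∑-cong Z2 (λ s → trans (cong (ϕ s *_) (trans (cong (typeSum m ∘ Ψ) (lengthenBy-≡ r 0 s)) (typeSum-Ψ m (r , s))))
      (*-exchange (ϕ s) (fromℕ (cardB m)) _))) (∑-*ˡ Z2 (fromℕ (cardB m)) (λ s → ϕ s * contribution m (r , s)))

    -- The recursion unrolled, `r` being the number of letters already stripped. The factor 2 (n +
    -- 1) of each step is the quotient of consecutive group orders, so after normalisation a head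
    -- cycle keeps only the sign produced by its insertions.
    headSum-Ψ : ∀ n r → headSum n (Ψ ∘ lengthenBy r) ≡
      fromℕ (cardB n) * ∑ (upTo (suc n)) (λ l → signℚ l * closing (n ∸ l) (l ℕ.+ r))
    headSum-Ψ zero r = trans (headSum-zero {Ψ ∘ lengthenBy r} (λ t → Ψ-invariant (lengthenBy r t))) (trans (closing-typeSum 0 r)
      (cong (fromℕ (cardB 0) *_) (sym (trans (ℚP.+-identityʳ _) (ℚP.*-identityˡ _)))))
    headSum-Ψ (suc n) r = begin
      headSum (suc n) (Ψ ∘ lengthenBy r) ≡⟨ headSum-suc {Ψ ∘ lengthenBy r} (λ t → Ψ-invariant (lengthenBy r t)) n ⟩
      ∑ Z2 (λ s → ϕ s * typeSum (suc n) (Ψ (lengthenBy r (0 , s)))) + - (fromℕ (2 ℕ.* suc n) * headSum n (Ψ ∘ lengthenBy (suc r)))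
        ≡⟨ cong₂ (λ a b → a + - (fromℕ (2 ℕ.* suc n) * b)) (closing-typeSum (suc n) r) (headSum-Ψ n (suc r)) ⟩
      C' * closing (suc n) r + - (fromℕ (2 ℕ.* suc n) * (fromℕ (cardB n) * S)) ≡⟨ cong (λ z → C' * closing (suc n) r + - z) (trans (sym (ℚP.*-assoc (fromℕ (2 ℕ.* suc n)) (fromℕ (cardB n)) S)) (cong (_* S) (sym card))) ⟩
      C' * closing (suc n) r + - (C' * S) ≡⟨ factor C' (closing (suc n) r) S ⟩
      C' * (1ℚ * closing (suc n) r + - S) ≡⟨ cong (λ z → C' * (1ℚ * closing (suc n) r + z)) negated ⟩
      C' * (1ℚ * closing (suc n) r + ∑ (upTo (suc n)) (λ l → signℚ (suc l) * closing (n ∸ l) (suc l ℕ.+ r)))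
        ≡⟨ cong (C' *_) (∑-upTo-suc (suc n) (λ l → signℚ l * closing (suc n ∸ l) (l ℕ.+ r))) ⟨
      C' * ∑ (upTo (suc (suc n))) (λ l → signℚ l * closing (suc n ∸ l) (l ℕ.+ r)) ∎
      where
      open ≡-Reasoning
      C' = fromℕ (cardB (suc n))
      S = ∑ (upTo (suc n)) (λ l → signℚ l * closing (n ∸ l) (l ℕ.+ suc r))
      card : C' ≡ fromℕ (2 ℕ.* suc n) * fromℕ (cardB n)
      card = trans (cong fromℕ (trans (cardB-suc n) (sym (ℕP.*-assoc 2 (suc n) (cardB n))))) (fromℕ-* (2 ℕ.* suc n) (cardB n))
      factor : ∀ c x y → c * x + - (c * y) ≡ c * (1ℚ * x + - y)
      factor = solve 3 (λ c x y → c :* x :+ (:- (c :* y)) := c :* (con 1ℚ :* x :+ (:- y))) refl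
        where open ℚS.+-*-Solver
      negated : - S ≡ ∑ (upTo (suc n)) (λ l → signℚ (suc l) * closing (n ∸ l) (suc l ℕ.+ r))
      negated = trans (sym (∑-neg (upTo (suc n)) (λ l → signℚ l * closing (n ∸ l) (l ℕ.+ suc r)))) (∑-cong (upTo (suc n)) (λ l → trans (ℚP.neg-distribˡ-* (signℚ l) _)
        (cong₂ _*_ (sym (signℚ-suc l)) (cong (closing (n ∸ l)) (ℕP.+-suc l r)))))

    -- The left factor is again a quotient of group orders: the left sum runs over a group one
    -- letter larger than the one that normalises the right.
    density-recursion : ∀ n → fromℕ (2 ℕ.* suc n) * density (suc n) e ≡ ∑ (upTo (suc n)) (λ l → signℚ l * closing (n ∸ l) l)
    density-recursion n = *-cancelˡ (cardB n) (cardB-positive n) (begin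
      fromℕ (cardB n) * (fromℕ (2 ℕ.* suc n) * density (suc n) e) ≡⟨ ℚP.*-assoc (fromℕ (cardB n)) _ _ ⟨
      (fromℕ (cardB n) * fromℕ (2 ℕ.* suc n)) * density (suc n) e ≡⟨ cong (_* density (suc n) e) card ⟩
      fromℕ (cardB (suc n)) * density (suc n) e ≡⟨ density-weightSum (suc n) e ⟨
      typeSum (suc n) ψ ≡⟨ typeSum-headSum {ψ} ψ-↭ n ⟩
      headSum n Ψ ≡⟨ headSum-Ψ n 0 ⟩
      fromℕ (cardB n) * ∑ (upTo (suc n)) (λ l → signℚ l * closing (n ∸ l) (l ℕ.+ 0)) ≡⟨ cong (fromℕ (cardB n) *_) (∑-cong (upTo (suc n)) (λ l → cong (λ q → signℚ l * closing (n ∸ l) q) (ℕP.+-identityʳ l))) ⟩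
      fromℕ (cardB n) * ∑ (upTo (suc n)) (λ l → signℚ l * closing (n ∸ l) l) ∎)
      where
      open ≡-Reasoning
      card : fromℕ (cardB n) * fromℕ (2 ℕ.* suc n) ≡ fromℕ (cardB (suc n))
      card = trans (sym (fromℕ-* (cardB n) (2 ℕ.* suc n))) (cong fromℕ (trans (ℕP.*-comm (cardB n) (2 ℕ.* suc n))
        (trans (ℕP.*-assoc 2 (suc n) (cardB n)) (sym (cardB-suc n)))))

-- The exponential series

leqᵇ : Mon N → Mon N → Bool
leqᵇ [] [] = true
leqᵇ ((p , q) ∷ m) ((a , b) ∷ e) = does (p ℕ.≤? a) ∧ (does (q ℕ.≤? b) ∧ leqᵇ m e)

⟦⟧-∧ : ∀ x y → ⟦ x ∧ y ⟧ ≡ ⟦ x ⟧ * ⟦ y ⟧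
⟦⟧-∧ true y = sym (ℚP.*-identityˡ ⟦ y ⟧)
⟦⟧-∧ false y = sym (ℚP.*-zeroˡ ⟦ y ⟧)

∑-upTo-pick : ∀ p a (f : ℕ → ℚ) → ∑ (upTo (suc a)) (λ a' → ⟦ does (p ℕ.≟ a') ⟧ * f a') ≡ ⟦ does (p ℕ.≤? a) ⟧ * f p
∑-upTo-pick p a f = pick (p ℕ.≤? a)
  where
  off : ∀ x → x ≢ p → ⟦ does (p ℕ.≟ x) ⟧ * f x ≡ 0ℚ
  off x x≢p = trans (cong (λ b → ⟦ b ⟧ * f x) (dec-false (p ℕ.≟ x) (x≢p ∘ sym))) (ℚP.*-zeroˡ (f x))
  pick : ∀ (d : Dec (p ≤ a)) → ∑ (upTo (suc a)) (λ a' → ⟦ does (p ℕ.≟ a') ⟧ * f a') ≡ ⟦ does d ⟧ * f p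
  pick (yes p≤a) = trans (∑-single (λ a' → ⟦ does (p ℕ.≟ a') ⟧ * f a') (UniqueP.upTo⁺ (suc a)) (∈P.∈-upTo⁺ (s≤s p≤a)) (λ x _ → off x))
    (cong (λ b → ⟦ b ⟧ * f p) (dec-true (p ℕ.≟ p) refl))
  pick (no p≰a) = trans (∑-zero-∈ (upTo (suc a)) (λ x x∈ → off x (λ { refl → p≰a (ℕP.≤-pred (∈P.∈-upTo⁻ x∈)) }))) (sym (ℚP.*-zeroˡ (f p)))

∑-below-∷ : ∀ a b (e : Mon N) (f : Mon (suc N) → ℚ) →
  ∑ (below ((a , b) ∷ e)) f ≡ ∑ (upTo (suc a)) (λ a' → ∑ (upTo (suc b)) (λ b' → ∑ (below e) (λ d → f ((a' , b') ∷ d))))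
∑-below-∷ a b e f = trans (∑-concatMap (λ a' → concatMap (λ b' → map ((a' , b') ∷_) (below e)) (upTo (suc b))) (upTo (suc a)) f)
  (∑-cong (upTo (suc a)) (λ a' → trans (∑-concatMap (λ b' → map ((a' , b') ∷_) (below e)) (upTo (suc b)) f)
    (∑-cong (upTo (suc b)) (λ b' → ∑-map ((a' , b') ∷_) (below e) f))))

does-≟M-∷ : ∀ p q (m : Mon N) a b d →
  does (((p , q) ∷ m) ≟M ((a , b) ∷ d)) ≡ (does (p ℕ.≟ a) ∧ does (q ℕ.≟ b)) ∧ does (m ≟M d)
does-≟M-∷ p q m a b d = does-cong (((p , q) ∷ m) ≟M ((a , b) ∷ d)) (((p ℕ.≟ a) ×-dec (q ℕ.≟ b)) ×-dec (m ≟M d))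
  (λ { refl → (refl , refl) , refl }) (λ { ((refl , refl) , refl) → refl })

∑-below-pick : ∀ (m e : Mon N) (Y : Mon N → ℚ) → ∑ (below e) (λ d → ⟦ does (m ≟M d) ⟧ * Y d) ≡ ⟦ leqᵇ m e ⟧ * Y m
∑-below-pick [] [] Y = ℚP.+-identityʳ (1ℚ * Y [])
∑-below-pick ((p , q) ∷ m) ((a , b) ∷ e) Y = begin
  ∑ (below ((a , b) ∷ e)) (λ d → ⟦ does (((p , q) ∷ m) ≟M d) ⟧ * Y d) ≡⟨ ∑-below-∷ a b e _ ⟩
  ∑ (upTo (suc a)) (λ a' → ∑ (upTo (suc b)) (λ b' → ∑ (below e) (λ d → ⟦ does (((p , q) ∷ m) ≟M ((a' , b') ∷ d)) ⟧ * Y ((a' , b') ∷ d))))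
    ≡⟨ ∑-cong (upTo (suc a)) (λ a' → ∑-cong (upTo (suc b)) (λ b' → trans (∑-cong (below e) (λ d → split a' b' d)) (trans (∑-*ˡ (below e) (⟦ does (p ℕ.≟ a') ⟧ * ⟦ does (q ℕ.≟ b') ⟧) (λ d → ⟦ does (m ≟M d) ⟧ * Y ((a' , b') ∷ d)))
        (cong (⟦ does (p ℕ.≟ a') ⟧ * ⟦ does (q ℕ.≟ b') ⟧ *_) (∑-below-pick m e (λ d → Y ((a' , b') ∷ d))))))) ⟩
  ∑ (upTo (suc a)) (λ a' → ∑ (upTo (suc b)) (λ b' → (⟦ does (p ℕ.≟ a') ⟧ * ⟦ does (q ℕ.≟ b') ⟧) * (⟦ leqᵇ m e ⟧ * Y ((a' , b') ∷ m))))
    ≡⟨ ∑-cong (upTo (suc a)) (λ a' → trans (∑-cong (upTo (suc b)) (λ b' → ℚP.*-assoc ⟦ does (p ℕ.≟ a') ⟧ _ _)) (trans (∑-*ˡ (upTo (suc b)) ⟦ does (p ℕ.≟ a') ⟧ _)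
        (cong (⟦ does (p ℕ.≟ a') ⟧ *_) (∑-upTo-pick q b (λ b' → ⟦ leqᵇ m e ⟧ * Y ((a' , b') ∷ m)))))) ⟩
  ∑ (upTo (suc a)) (λ a' → ⟦ does (p ℕ.≟ a') ⟧ * (⟦ does (q ℕ.≤? b) ⟧ * (⟦ leqᵇ m e ⟧ * Y ((a' , q) ∷ m))))
    ≡⟨ ∑-upTo-pick p a (λ a' → ⟦ does (q ℕ.≤? b) ⟧ * (⟦ leqᵇ m e ⟧ * Y ((a' , q) ∷ m))) ⟩
  ⟦ does (p ℕ.≤? a) ⟧ * (⟦ does (q ℕ.≤? b) ⟧ * (⟦ leqᵇ m e ⟧ * Y ((p , q) ∷ m))) ≡⟨ cong (⟦ does (p ℕ.≤? a) ⟧ *_) (trans (sym (ℚP.*-assoc ⟦ does (q ℕ.≤? b) ⟧ _ _)) (cong (_* Y ((p , q) ∷ m)) (sym (⟦⟧-∧ (does (q ℕ.≤? b)) (leqᵇ m e))))) ⟩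
  ⟦ does (p ℕ.≤? a) ⟧ * (⟦ does (q ℕ.≤? b) ∧ leqᵇ m e ⟧ * Y ((p , q) ∷ m)) ≡⟨ trans (sym (ℚP.*-assoc ⟦ does (p ℕ.≤? a) ⟧ _ _)) (cong (_* Y ((p , q) ∷ m)) (sym (⟦⟧-∧ (does (p ℕ.≤? a)) _))) ⟩
  ⟦ does (p ℕ.≤? a) ∧ (does (q ℕ.≤? b) ∧ leqᵇ m e) ⟧ * Y ((p , q) ∷ m) ∎
  where
  open ≡-Reasoning
  split : ∀ a' b' d → ⟦ does (((p , q) ∷ m) ≟M ((a' , b') ∷ d)) ⟧ * Y ((a' , b') ∷ d) ≡
    (⟦ does (p ℕ.≟ a') ⟧ * ⟦ does (q ℕ.≟ b') ⟧) * (⟦ does (m ≟M d) ⟧ * Y ((a' , b') ∷ d))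
  split a' b' d = trans (cong (_* Y ((a' , b') ∷ d)) (trans (cong ⟦_⟧ (does-≟M-∷ p q m a' b' d)) (trans (⟦⟧-∧ (does (p ℕ.≟ a') ∧ does (q ℕ.≟ b')) (does (m ≟M d)))
    (cong (_* ⟦ does (m ≟M d) ⟧) (⟦⟧-∧ (does (p ℕ.≟ a')) (does (q ℕ.≟ b'))))))) (ℚP.*-assoc (⟦ does (p ℕ.≟ a') ⟧ * ⟦ does (q ℕ.≟ b') ⟧) _ _)

leqᵇ-zero : ∀ (e : Mon N) → leqᵇ (tabulate (λ _ → 0 , 0)) e ≡ true
leqᵇ-zero [] = refl
leqᵇ-zero (_ ∷ e) = leqᵇ-zero e

monSub-zero : ∀ (e : Mon N) → monSub e (tabulate (λ _ → 0 , 0)) ≡ e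
monSub-zero [] = refl
monSub-zero (p ∷ e) = cong (p ∷_) (monSub-zero e)

decs-suc : ∀ j θ m p (e : Mon N) → decs (suc j , θ) m (p ∷ e) ≡ Maybe.map (p ∷_) (decs (j , θ) m e)
decs-suc j θ zero p e = refl
decs-suc j θ (suc m) p e with dec (j , θ) e
... | nothing = refl
... | just e' = decs-suc j θ m p e'

apply-map : ∀ (X : Ser (suc N)) p m → apply X (Maybe.map (p ∷_) m) ≡ apply (λ e → X (p ∷ e)) m
apply-map X p nothing = refl
apply-map X p (just e) = refl

decs-zero-plus : ∀ (X : Ser (suc N)) m a b e → apply X (decs (0 , Sign.+) m ((a , b) ∷ e)) ≡ ⟦ does (m ℕ.≤? a) ⟧ * X ((a ∸ m , b) ∷ e)
decs-zero-plus X zero a b e = sym (ℚP.*-identityˡ _)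
decs-zero-plus X (suc m) zero b e = sym (ℚP.*-zeroˡ (X ((0 , b) ∷ e)))
decs-zero-plus X (suc m) (suc a) b e = trans (decs-zero-plus X m a b e)
  (cong (λ z → ⟦ z ⟧ * X ((a ∸ m , b) ∷ e)) (does-cong (m ℕ.≤? a) (suc m ℕ.≤? suc a) s≤s ℕP.≤-pred))

decs-zero-minus : ∀ (X : Ser (suc N)) m a b e → apply X (decs (0 , Sign.-) m ((a , b) ∷ e)) ≡ ⟦ does (m ℕ.≤? b) ⟧ * X ((a , b ∸ m) ∷ e)
decs-zero-minus X zero a b e = sym (ℚP.*-identityˡ _)
decs-zero-minus X (suc m) a zero e = sym (ℚP.*-zeroˡ (X ((a , 0) ∷ e)))
decs-zero-minus X (suc m) a (suc b) e = trans (decs-zero-minus X m a b e)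
  (cong (λ z → ⟦ z ⟧ * X ((a , b ∸ m) ∷ e)) (does-cong (m ℕ.≤? b) (suc m ℕ.≤? suc b) s≤s ℕP.≤-pred))

leqᵇ-monSub-varPow : ∀ (X : Ser N) (i : Fin N) θ m e → ⟦ leqᵇ (varPow i θ m) e ⟧ * X (monSub e (varPow i θ m)) ≡ apply X (decs (toℕ i , θ) m e)
leqᵇ-monSub-varPow X Fin.zero Sign.+ m ((a , b) ∷ e) = trans (cong₂ (λ z w → ⟦ does (m ℕ.≤? a) ∧ z ⟧ * X ((a ∸ m , b) ∷ w)) (leqᵇ-zero e) (monSub-zero e))
  (trans (cong (_* X ((a ∸ m , b) ∷ e)) (trans (⟦⟧-∧ (does (m ℕ.≤? a)) true) (ℚP.*-identityʳ ⟦ does (m ℕ.≤? a) ⟧))) (sym (decs-zero-plus X m a b e)))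
leqᵇ-monSub-varPow X Fin.zero Sign.- m ((a , b) ∷ e) = trans (cong₂ (λ z w → ⟦ does (m ℕ.≤? b) ∧ z ⟧ * X ((a , b ∸ m) ∷ w)) (leqᵇ-zero e) (monSub-zero e))
  (trans (cong (_* X ((a , b ∸ m) ∷ e)) (trans (⟦⟧-∧ (does (m ℕ.≤? b)) true) (ℚP.*-identityʳ ⟦ does (m ℕ.≤? b) ⟧))) (sym (decs-zero-minus X m a b e)))
leqᵇ-monSub-varPow X (Fin.suc i) Sign.+ m (p ∷ e) = trans (leqᵇ-monSub-varPow (λ e → X (p ∷ e)) i Sign.+ m e)
  (trans (sym (apply-map X p (decs (toℕ i , Sign.+) m e))) (cong (apply X) (sym (decs-suc (toℕ i) Sign.+ m p e))))
leqᵇ-monSub-varPow X (Fin.suc i) Sign.- m (p ∷ e) = trans (leqᵇ-monSub-varPow (λ e → X (p ∷ e)) i Sign.- m e)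
  (trans (sym (apply-map X p (decs (toℕ i , Sign.-) m e))) (cong (apply X) (sym (decs-suc (toℕ i) Sign.- m p e))))

monoS-⟦⟧ : ∀ c (m e : Mon N) → monoS c m e ≡ ⟦ does (m ≟M e) ⟧ * c
monoS-⟦⟧ c m e with does (m ≟M e)
... | true = sym (ℚP.*-identityˡ c)
... | false = sym (ℚP.*-zeroˡ c)

-- Only one divisor of `e` contributes to the Cauchy product. From here on, multiplication by the
-- exponent series is a sum of shifts, and these commute visibly.
monoS-*S : ∀ c (X : Ser N) (i : Fin N) θ m e → (monoS c (varPow i θ m) *S X) e ≡ c * apply X (decs (toℕ i , θ) m e)
monoS-*S c X i θ m e = trans (∑-cong (below e) (λ d → trans (cong (_* X (monSub e d)) (monoS-⟦⟧ c (varPow i θ m) d)) (ℚP.*-assoc ⟦ does (varPow i θ m ≟M d) ⟧ c _)))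
  (trans (∑-below-pick (varPow i θ m) e (λ d → c * X (monSub e d)))
    (trans (*-exchange ⟦ leqᵇ (varPow i θ m) e ⟧ c _) (cong (c *_) (leqᵇ-monSub-varPow X i θ m e))))

-- In statements of this form `0 ≡ 0` is the trivially true case in which the variable does not
-- divide the monomial.
deg-dec : ∀ t (e : Mon N) → Maybe.maybe′ (λ e' → deg e ≡ suc (deg e')) (0 ≡ 0) (dec t e)
deg-dec t [] = refl
deg-dec (zero , Sign.+) ((zero , b) ∷ e) = refl
deg-dec (zero , Sign.+) ((suc a , b) ∷ e) = refl
deg-dec (zero , Sign.-) ((a , zero) ∷ e) = refl
deg-dec (zero , Sign.-) ((a , suc b) ∷ e) = cong (ℕ._+ deg e) (ℕP.+-suc a b)
deg-dec (suc j , θ) ((a , b) ∷ e) with dec (j , θ) e | deg-dec (j , θ) e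
... | nothing | _ = refl
... | just e' | eq = trans (cong (a ℕ.+ b ℕ.+_) eq) (ℕP.+-suc (a ℕ.+ b) (deg e'))

deg-decs : ∀ t m (e : Mon N) → Maybe.maybe′ (λ e' → deg e ≡ m ℕ.+ deg e') (0 ≡ 0) (decs t m e)
deg-decs t zero e = refl
deg-decs t (suc m) e with dec t e | deg-dec t e
... | nothing | _ = refl
... | just e' | eq with decs t m e' | deg-decs t m e'
...   | nothing | _ = refl
...   | just e'' | eq' = trans eq (cong suc eq')

apply-cong-deg : ∀ {X Y : Ser N} t m e → (∀ e' → deg e ≡ m ℕ.+ deg e' → X e' ≡ Y e') → apply X (decs t m e) ≡ apply Y (decs t m e)
apply-cong-deg t m e h with decs t m e | deg-decs t m e
... | nothing | _ = refl
... | just e' | eq = h e' eq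

decs-dec-comm : ∀ t u m (e : Mon N) → (decs t m e >>= dec u) ≡ (dec u e >>= decs t m)
decs-dec-comm t u zero e with dec u e
... | nothing = refl
... | just _ = refl
decs-dec-comm t u (suc m) e with dec t e in eqt
... | just e' = trans (decs-dec-comm t u m e') (trans (assoc (dec u e') (dec u e) commuted) refl)
  where
  commuted : dec u e' ≡ (dec u e >>= dec t)
  commuted = trans (cong (_>>= dec u) (sym eqt)) (dec-comm t u e)
  assoc : ∀ x y → x ≡ (y >>= dec t) → (x >>= decs t m) ≡ (y >>= decs t (suc m))
  assoc x nothing refl = refl
  assoc x (just _) refl = refl
... | nothing = sym (go (dec u e) (trans (sym (dec-comm t u e)) (cong (_>>= dec u) eqt)))
  where
  go : ∀ y → (y >>= dec t) ≡ nothing → (y >>= decs t (suc m)) ≡ nothing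
  go nothing _ = refl
  go (just e'') eq = cong (_>>= decs t m) eq

decs-comm : ∀ t m u m' (e : Mon N) → (decs t m e >>= decs u m') ≡ (decs u m' e >>= decs t m)
decs-comm t m u zero e with decs t m e
... | nothing = refl
... | just _ = refl
decs-comm t m u (suc m') e = begin
  (decs t m e >>= decs u (suc m')) ≡⟨ assoc (decs t m e) ⟨
  ((decs t m e >>= dec u) >>= decs u m') ≡⟨ cong (_>>= decs u m') (decs-dec-comm t u m e) ⟩
  ((dec u e >>= decs t m) >>= decs u m') ≡⟨ inner (dec u e) ⟩
  ((dec u e >>= decs u m') >>= decs t m) ∎
  where
  open ≡-Reasoning
  assoc : ∀ x → ((x >>= dec u) >>= decs u m') ≡ (x >>= decs u (suc m'))
  assoc nothing = refl
  assoc (just _) = refl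
  inner : ∀ x → ((x >>= decs t m) >>= decs u m') ≡ ((x >>= decs u m') >>= decs t m)
  inner nothing = refl
  inner (just e') = decs-comm t m u m' e'

!-positive : ∀ m → 1 ≤ m !
!-positive zero = s≤s z≤n
!-positive (suc m) = ℕP.*-mono-≤ {1} {suc m} (s≤s z≤n) (!-positive m)

recip-* : ∀ a b → 1 ≤ a → 1 ≤ b → recip (a ℕ.* b) * fromℕ a ≡ recip b
recip-* a b 1≤a 1≤b = *-cancelˡ b 1≤b (begin
  fromℕ b * (recip (a ℕ.* b) * fromℕ a) ≡⟨ *-exchange (fromℕ b) (recip (a ℕ.* b)) (fromℕ a) ⟩
  recip (a ℕ.* b) * (fromℕ b * fromℕ a) ≡⟨ cong (recip (a ℕ.* b) *_) (trans (ℚP.*-comm (fromℕ b) (fromℕ a)) (sym (fromℕ-* a b))) ⟩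
  recip (a ℕ.* b) * fromℕ (a ℕ.* b) ≡⟨ recip-inverse (a ℕ.* b) (ℕP.*-mono-≤ {1} {a} {1} {b} 1≤a 1≤b) ⟩
  1ℚ ≡⟨ recip-inverse b 1≤b ⟨
  recip b * fromℕ b ≡⟨ ℚP.*-comm (recip b) (fromℕ b) ⟩
  fromℕ b * recip b ∎)
  where open ≡-Reasoning

∑-upTo-extend : ∀ a b (f : ℕ → ℚ) → a ≤ b → (∀ m → a ≤ m → f m ≡ 0ℚ) → ∑ (upTo a) f ≡ ∑ (upTo b) f
∑-upTo-extend zero b f _ h = sym (∑-zero-∈ (upTo b) (λ m _ → h m z≤n))
∑-upTo-extend (suc a) (suc b) f (s≤s a≤b) h = trans (∑-upTo-suc a f)
  (trans (cong (f 0 +_) (∑-upTo-extend a b (f ∘ suc) a≤b (λ m a≤m → h (suc m) (s≤s a≤m)))) (sym (∑-upTo-suc b f)))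

deg-zeroMon : ∀ N → deg (zeroMon {N}) ≡ 0
deg-zeroMon zero = refl
deg-zeroMon (suc N) = deg-zeroMon N

oneS-deg : ∀ (e : Mon N) → 1 ≤ deg e → oneS e ≡ 0ℚ
oneS-deg {N} e 1≤ = cong ⟦_⟧ (dec-false (e ≟M zeroMon) (λ { refl → ℕP.<-irrefl refl (subst (1 ≤_) (deg-zeroMon N) 1≤) }))

apply-+ : ∀ (X Y : Ser N) m → apply (λ e → X e + Y e) m ≡ apply X m + apply Y m
apply-+ X Y nothing = refl
apply-+ X Y (just e) = refl

apply-zero : ∀ (m : Maybe (Mon N)) → apply (λ _ → 0ℚ) m ≡ 0ℚ
apply-zero nothing = refl
apply-zero (just _) = refl

*S-distribʳ-∑ : ∀ {A : Set} (xs : List A) (f : A → Ser N) (E X : Ser N) → (∀ e → E e ≡ ∑ xs (λ x → f x e)) →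
  ∀ e → (E *S X) e ≡ ∑ xs (λ x → (f x *S X) e)
*S-distribʳ-∑ xs f E X h e = trans (∑-cong (below e) (λ d → trans (cong (_* X (monSub e d)) (h d)) (sym (∑-*ʳ xs (X (monSub e d)) (λ x → f x d)))))
  (∑-swap (below e) xs (λ d x → f x d * X (monSub e d)))

-- With D the Euler operator (multiplication of the coefficient at e by deg e), D (exp E) = (D E) (exp E);
-- here E and D E act through the commuting partial shifts decs.
module ExpRecursion {A : Set} {N : ℕ} (terms : List A) (coef : A → ℚ) (index : A → Fin N) (sign : A → Sign) (power : A → ℕ)
  (power-positive : ∀ τ → τ ∈ terms → 1 ≤ power τ) (E : Ser N)
  (E-terms : ∀ e → E e ≡ ∑ terms (λ τ → monoS (coef τ) (varPow (index τ) (sign τ) (power τ)) e)) where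

  shiftBy : A → Mon N → Maybe (Mon N)
  shiftBy τ e = decs (toℕ (index τ) , sign τ) (power τ) e

  -- Multiplication by the series whose terms have the coefficients `w`.
  operator : (A → ℚ) → Ser N → Ser N
  operator w X e = ∑ terms (λ τ → w τ * apply X (shiftBy τ e))

  eulerCoef : A → ℚ
  eulerCoef τ = fromℕ (power τ) * coef τ

  mulE : Ser N → Ser N
  mulE = operator coef

  mulDE : Ser N → Ser N
  mulDE = operator eulerCoef

  *S-operator : ∀ X e → (E *S X) e ≡ mulE X e
  *S-operator X e = trans (*S-distribʳ-∑ terms (λ τ → monoS (coef τ) (varPow (index τ) (sign τ) (power τ))) E X E-terms e)
    (∑-cong terms (λ τ → monoS-*S (coef τ) X (index τ) (sign τ) (power τ) e))

  operator-cong : ∀ w {X Y : Ser N} → (∀ e → X e ≡ Y e) → ∀ e → operator w X e ≡ operator w Y e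
  operator-cong w h e = ∑-cong terms (λ τ → cong (w τ *_) (apply-cong h (shiftBy τ e)))

  operator-* : ∀ w a X e → operator w (λ e → a * X e) e ≡ a * operator w X e
  operator-* w a X e = trans (∑-cong terms (λ τ → trans (cong (w τ *_) (apply-* a X (shiftBy τ e))) (*-exchange (w τ) a _))) (∑-*ˡ terms a _)

  operator-comm : ∀ v w X e → operator v (operator w X) e ≡ operator w (operator v X) e
  operator-comm v w X e = trans (expandTwice v w e) (trans (∑-swap terms terms _)
    (trans (∑-cong terms (λ τ' → ∑-cong terms (λ τ → trans (*-exchange (v τ) (w τ') _) (cong (λ m → w τ' * (v τ * apply X m)) (decs-comm _ (power τ) _ (power τ') e)))))
      (sym (expandTwice w v e))))
    where
    expandTwice : ∀ v w e → operator v (operator w X) e ≡ ∑ terms (λ τ → ∑ terms (λ τ' → v τ * (w τ' * apply X (shiftBy τ e >>= shiftBy τ'))))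
    expandTwice v w e = ∑-cong terms (λ τ → trans (cong (v τ *_)
      (trans (sym (∑-apply terms w (λ τ' e' → apply X (shiftBy τ' e')) (shiftBy τ e))) (∑-cong terms (λ τ' → cong (w τ' *_) (sym (apply->>= X (shiftBy τ') (shiftBy τ e)))))))
      (sym (∑-*ˡ terms (v τ) _)))

  euler : Ser N → Ser N
  euler X e = fromℕ (deg e) * X e

  -- The Leibniz rule: the degree of `e` is the power removed by the shift plus the degree of what
  -- is left.
  euler-mulE : ∀ X e → euler (mulE X) e ≡ mulDE X e + mulE (euler X) e
  euler-mulE X e = trans (sym (∑-*ˡ terms (fromℕ (deg e)) _)) (trans (∑-cong terms pointwise) (∑-+ terms _ _))
    where
    open ≡-Reasoning
    pointwise : ∀ τ → fromℕ (deg e) * (coef τ * apply X (shiftBy τ e)) ≡ eulerCoef τ * apply X (shiftBy τ e) + coef τ * apply (euler X) (shiftBy τ e)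
    pointwise τ = begin
      fromℕ (deg e) * (coef τ * apply X (shiftBy τ e)) ≡⟨ *-exchange (fromℕ (deg e)) (coef τ) _ ⟩
      coef τ * (fromℕ (deg e) * apply X (shiftBy τ e)) ≡⟨ cong (coef τ *_) (apply-* (fromℕ (deg e)) X (shiftBy τ e)) ⟨
      coef τ * apply (λ e' → fromℕ (deg e) * X e') (shiftBy τ e) ≡⟨ cong (coef τ *_) (apply-cong-deg _ (power τ) e (λ e' eq →
         trans (cong (_* X e') (trans (cong fromℕ eq) (fromℕ-+ (power τ) (deg e')))) (ℚP.*-distribʳ-+ (X e') (fromℕ (power τ)) (fromℕ (deg e'))))) ⟩
      coef τ * apply (λ e' → fromℕ (power τ) * X e' + euler X e') (shiftBy τ e) ≡⟨ cong (coef τ *_) (apply-+ (λ e' → fromℕ (power τ) * X e') (euler X) (shiftBy τ e)) ⟩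
      coef τ * (apply (λ e' → fromℕ (power τ) * X e') (shiftBy τ e) + apply (euler X) (shiftBy τ e)) ≡⟨ ℚP.*-distribˡ-+ (coef τ) _ _ ⟩
      coef τ * apply (λ e' → fromℕ (power τ) * X e') (shiftBy τ e) + coef τ * apply (euler X) (shiftBy τ e)
        ≡⟨ cong (_+ coef τ * apply (euler X) (shiftBy τ e)) (trans (cong (coef τ *_) (apply-* (fromℕ (power τ)) X (shiftBy τ e)))
             (trans (*-exchange (coef τ) (fromℕ (power τ)) _) (sym (ℚP.*-assoc (fromℕ (power τ)) (coef τ) _)))) ⟩
      eulerCoef τ * apply X (shiftBy τ e) + coef τ * apply (euler X) (shiftBy τ e) ∎

  operator-zero : ∀ w e → operator w (λ _ → 0ℚ) e ≡ 0ℚ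
  operator-zero w e = ∑-zero-∈ terms (λ τ _ → trans (cong (w τ *_) (apply-zero (shiftBy τ e))) (ℚP.*-zeroʳ (w τ)))

  euler-oneS : ∀ (e : Mon N) → euler oneS e ≡ 0ℚ
  euler-oneS e with deg e in eq
  ... | zero = trans (cong (_* oneS e) fromℕ-0) (ℚP.*-zeroˡ (oneS e))
  ... | suc d = trans (cong (fromℕ (suc d) *_) (oneS-deg e (subst (1 ≤_) (sym eq) (s≤s z≤n)))) (ℚP.*-zeroʳ (fromℕ (suc d)))

  -- The power rule. Leibniz yields one new summand at each step, and the commutation of `mulE` with
  -- `mulDE` brings the others into the same form.
  euler-power : ∀ m e → euler (E ^S suc m) e ≡ fromℕ (suc m) * mulDE (E ^S m) e
  euler-power zero e = begin
    fromℕ (deg e) * (E *S oneS) e ≡⟨ cong (fromℕ (deg e) *_) (*S-operator oneS e) ⟩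
    euler (mulE oneS) e ≡⟨ euler-mulE oneS e ⟩
    mulDE oneS e + mulE (euler oneS) e ≡⟨ cong (mulDE oneS e +_) (trans (operator-cong coef euler-oneS e) (operator-zero coef e)) ⟩
    mulDE oneS e + 0ℚ ≡⟨ ℚP.+-identityʳ _ ⟩
    mulDE oneS e ≡⟨ ℚP.*-identityˡ _ ⟨
    1ℚ * mulDE oneS e ≡⟨ cong (_* mulDE oneS e) fromℕ-1 ⟨
    fromℕ 1 * mulDE oneS e ∎
    where open ≡-Reasoning
  euler-power (suc m) e = begin
    fromℕ (deg e) * (E *S (E ^S suc m)) e ≡⟨ cong (fromℕ (deg e) *_) (*S-operator (E ^S suc m) e) ⟩
    euler (mulE (E ^S suc m)) e ≡⟨ euler-mulE (E ^S suc m) e ⟩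
    L + mulE (euler (E ^S suc m)) e ≡⟨ cong (L +_) (operator-cong coef (euler-power m) e) ⟩
    L + mulE (λ e → fromℕ (suc m) * mulDE (E ^S m) e) e ≡⟨ cong (L +_) (operator-* coef (fromℕ (suc m)) (mulDE (E ^S m)) e) ⟩
    L + fromℕ (suc m) * mulE (mulDE (E ^S m)) e ≡⟨ cong (λ z → L + fromℕ (suc m) * z) (trans (operator-comm coef eulerCoef (E ^S m) e) (operator-cong eulerCoef (λ e → sym (*S-operator (E ^S m) e)) e)) ⟩
    L + fromℕ (suc m) * L ≡⟨ cong (_+ fromℕ (suc m) * L) (ℚP.*-identityˡ L) ⟨
    1ℚ * L + fromℕ (suc m) * L ≡⟨ ℚP.*-distribʳ-+ L 1ℚ (fromℕ (suc m)) ⟨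
    (1ℚ + fromℕ (suc m)) * L ≡⟨ cong (_* L) (fromℕ-suc (suc m)) ⟨
    fromℕ (suc (suc m)) * L ∎
    where
    open ≡-Reasoning
    L = mulDE (E ^S suc m) e

  -- All terms of `E` have positive degree, so m factors need degree at least m. This justifies
  -- cutting the exponential off at the degree.
  power-vanishes : ∀ m e → deg e < m → (E ^S m) e ≡ 0ℚ
  power-vanishes (suc m) e (s≤s deg≤m) = trans (*S-operator (E ^S m) e) (∑-zero-∈ terms (λ τ τ∈ → trans (cong (coef τ *_)
      (trans (apply-cong-deg {X = E ^S m} {λ _ → 0ℚ} _ (power τ) e (λ e' eq → power-vanishes m e'
          (ℕP.≤-trans (subst (suc (deg e') ≤_) (sym eq) (ℕP.+-monoˡ-≤ (deg e') (power-positive τ τ∈))) deg≤m)))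
        (apply-zero (shiftBy τ e)))) (ℚP.*-zeroʳ (coef τ))))

  expTerm : ℕ → Ser N
  expTerm m e = (E ^S m) e * recip (m !)

  -- `expS` is cut off at a bound that varies with the monomial; a common bound `M` allows the sum
  -- to be exchanged with the shifts.
  partial : ℕ → Ser N
  partial M e = ∑ (upTo M) (λ m → expTerm m e)

  partial-expS : ∀ M e → deg e < M → partial M e ≡ expS E e
  partial-expS M e lt = sym (∑-upTo-extend (suc (deg e)) M (λ m → expTerm m e) lt
    (λ m d<m → trans (cong (_* recip (m !)) (power-vanishes m e d<m)) (ℚP.*-zeroˡ (recip (m !)))))

  euler-expTerm : ∀ m e → euler (expTerm (suc m)) e ≡ mulDE (expTerm m) e
  euler-expTerm m e = begin
    fromℕ (deg e) * ((E ^S suc m) e * recip (suc m !)) ≡⟨ ℚP.*-assoc (fromℕ (deg e)) ((E ^S suc m) e) (recip (suc m !)) ⟨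
    euler (E ^S suc m) e * recip (suc m !) ≡⟨ cong (_* recip (suc m !)) (euler-power m e) ⟩
    (fromℕ (suc m) * mulDE (E ^S m) e) * recip (suc m !) ≡⟨ rearrange (fromℕ (suc m)) (mulDE (E ^S m) e) (recip (suc m !)) ⟩
    (recip (suc m !) * fromℕ (suc m)) * mulDE (E ^S m) e ≡⟨ cong (_* mulDE (E ^S m) e) (recip-* (suc m) (m !) (s≤s z≤n) (!-positive m)) ⟩
    recip (m !) * mulDE (E ^S m) e ≡⟨ operator-* eulerCoef (recip (m !)) (E ^S m) e ⟨
    mulDE (λ e → recip (m !) * (E ^S m) e) e ≡⟨ operator-cong eulerCoef (λ e → ℚP.*-comm (recip (m !)) ((E ^S m) e)) e ⟩
    mulDE (expTerm m) e ∎
    where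
    open ≡-Reasoning
    rearrange : ∀ a b c → (a * b) * c ≡ (c * a) * b
    rearrange = solve 3 (λ a b c → (a :* b) :* c := (c :* a) :* b) refl
      where open ℚS.+-*-Solver

  mulDE-partial : ∀ M e → ∑ (upTo M) (λ m → mulDE (expTerm m) e) ≡ mulDE (partial M) e
  mulDE-partial M e = trans (∑-swap (upTo M) terms _) (∑-cong terms (λ τ → trans (∑-*ˡ (upTo M) (eulerCoef τ) _) (cong (eulerCoef τ *_) (sum-apply (shiftBy τ e)))))
    where
    sum-apply : ∀ m → ∑ (upTo M) (λ q → apply (expTerm q) m) ≡ apply (partial M) m
    sum-apply nothing = ∑-zero (upTo M)
    sum-apply (just _) = refl

  expS-recursion : ∀ e → fromℕ (deg e) * expS E e ≡ ∑ terms (λ τ → eulerCoef τ * apply (expS E) (shiftBy τ e))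
  expS-recursion e = begin
    fromℕ (deg e) * partial (suc (deg e)) e ≡⟨ ∑-*ˡ (upTo (suc (deg e))) (fromℕ (deg e)) (λ m → expTerm m e) ⟨
    ∑ (upTo (suc (deg e))) (λ m → euler (expTerm m) e) ≡⟨ ∑-upTo-suc (deg e) (λ m → euler (expTerm m) e) ⟩
    euler (expTerm 0) e + ∑ (upTo (deg e)) (λ m → euler (expTerm (suc m)) e) ≡⟨ cong₂ _+_ first (∑-cong (upTo (deg e)) (λ m → euler-expTerm m e)) ⟩
    0ℚ + ∑ (upTo (deg e)) (λ m → mulDE (expTerm m) e) ≡⟨ ℚP.+-identityˡ _ ⟩
    ∑ (upTo (deg e)) (λ m → mulDE (expTerm m) e) ≡⟨ mulDE-partial (deg e) e ⟩
    -- Each shift lowers the degree strictly, so the terms below `deg e` already make up the whole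
    -- exponential at the shifted monomial.
    mulDE (partial (deg e)) e ≡⟨ ∑-cong-∈ terms (λ τ τ∈ → cong (eulerCoef τ *_) (apply-cong-deg _ (power τ) e (λ e' eq →
        partial-expS (deg e) e' (subst (suc (deg e') ≤_) (sym eq) (ℕP.+-monoˡ-≤ (deg e') (power-positive τ τ∈)))))) ⟩
    mulDE (expS E) e ∎
    where
    open ≡-Reasoning
    first : euler (expTerm 0) e ≡ 0ℚ
    first = trans (sym (ℚP.*-assoc (fromℕ (deg e)) (oneS e) 1ℚ)) (trans (cong (_* 1ℚ) (euler-oneS e)) (ℚP.*-zeroˡ 1ℚ))

-- Comparison of the two recursions

rootIndices : ℕ → ℕ → List ℕ
rootIndices k j = filterᵇ (λ h → does (gcd h j ℕ.≟ 1)) (divisors k)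

rootIndices-unique : ∀ k j → Unique (rootIndices k j)
rootIndices-unique k j = UniqueP.filter⁺ (λ h → Bool.T? (does (gcd h j ℕ.≟ 1)))
  (UniqueP.filter⁺ (λ h → Bool.T? (does (h ∣? k))) (UniqueP.map⁺ ℕP.suc-injective (UniqueP.upTo⁺ k)))

T-does⁻ : ∀ {P : Set} (p : Dec P) → T (does p) → P
T-does⁻ (yes p) _ = p

T-does : ∀ {P : Set} (p : Dec P) → P → T (does p)
T-does (yes _) _ = _
T-does (no ¬p) p = ¬p p

∈-rootIndices : ∀ {k j h} → 1 ≤ k → h ∣ k → gcd h j ≡ 1 → h ∈ rootIndices k j
∈-rootIndices {suc k} {j} {zero} _ h∣k _ = contradiction (Div.0∣⇒≡0 h∣k) λ ()
∈-rootIndices {suc k} {j} {suc h} _ h∣k g = ∈P.∈-filter⁺ (λ h → Bool.T? (does (gcd h j ℕ.≟ 1)))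
  (∈P.∈-filter⁺ (λ h → Bool.T? (does (h ∣? suc k))) (∈P.∈-map⁺ suc (∈P.∈-upTo⁺ (Div.∣⇒≤ h∣k))) (T-does (suc h ∣? suc k) h∣k))
  (T-does (gcd (suc h) j ℕ.≟ 1) g)

∈-rootIndices⁻ : ∀ {k j h} → h ∈ rootIndices k j → h ∣ k × gcd h j ≡ 1
∈-rootIndices⁻ {k} {j} {h} m with ∈P.∈-filter⁻ (λ h → Bool.T? (does (gcd h j ℕ.≟ 1))) {xs = divisors k} m
... | m' , g = T-does⁻ (h ∣? k) (proj₂ (∈P.∈-filter⁻ (λ h → Bool.T? (does (h ∣? k))) {xs = map suc (upTo k)} m')) , T-does⁻ (gcd h j ℕ.≟ 1) g

div-* : ∀ q h → 1 ≤ h → (q ℕ.* h) div h ≡ q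
div-* q (suc h) _ = DivMod.m*n/n≡m q (suc h)

-- The pairs (j , h) with h ∣ k and gcd h j ≡ 1 correspond to the cycle lengths l = j (k / h).
module CycleLengths (k : ℕ) (1≤k : 1 ≤ k) where

  cycleLength : ℕ → ℕ → ℕ
  cycleLength j' h = suc j' ℕ.* (k div h)

  splitIndex : ℕ → ℕ
  splitIndex l = GcdSplit.j' (gcdSplit k l)

  splitRoot : ℕ → ℕ
  splitRoot l = GcdSplit.h (gcdSplit k l)

  root-positive : ∀ {h} → h ∣ k → 1 ≤ h
  root-positive {zero} h∣k = contradiction (subst (1 ≤_) (Div.0∣⇒≡0 h∣k) 1≤k) λ ()
  root-positive {suc h} _ = s≤s z≤n

  splitRoot-∣ : ∀ l → splitRoot l ∣ k
  splitRoot-∣ l = divides (gcd (suc l) k) (trans (GcdSplit.k-eq (gcdSplit k l)) (ℕP.*-comm (splitRoot l) _))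

  splitRoot-∈ : ∀ l → splitRoot l ∈ rootIndices k (suc (splitIndex l))
  splitRoot-∈ l = ∈-rootIndices 1≤k (splitRoot-∣ l)
    (trans (GCD.gcd-comm (splitRoot l) (suc (splitIndex l))) (Coprimality.coprime⇒gcd≡1 (GcdSplit.cop (gcdSplit k l))))

  cycleLength-split : ∀ l → cycleLength (splitIndex l) (splitRoot l) ≡ suc l
  cycleLength-split l = trans (cong (suc (splitIndex l) ℕ.*_) (trans (cong (_div splitRoot l) (trans (GcdSplit.k-eq (gcdSplit k l)) (ℕP.*-comm (splitRoot l) _)))
    (div-* (gcd (suc l) k) (splitRoot l) (root-positive (splitRoot-∣ l))))) (sym (GcdSplit.l-eq (gcdSplit k l)))

  -- With q = k / h the length is j q and k is h q, and j and h are coprime; so the gcd is q and the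
  -- pair can be recovered from the length.
  gcd-cycleLength : ∀ {j' h l} → h ∈ rootIndices k (suc j') → suc l ≡ cycleLength j' h → gcd (suc l) k ≡ k div h
  gcd-cycleLength {j'} {h} {l} m eq with ∈-rootIndices⁻ {k} {suc j'} m
  ... | h∣k@(divides q k≡qh) , coprime = begin
    gcd (suc l) k ≡⟨ cong₂ gcd (trans eq (trans (cong (suc j' ℕ.*_) kh) (ℕP.*-comm (suc j') q))) k≡qh ⟩
    gcd (q ℕ.* suc j') (q ℕ.* h) ≡⟨ GCD.c*gcd[m,n]≡gcd[cm,cn] q (suc j') h ⟨
    q ℕ.* gcd (suc j') h ≡⟨ cong (q ℕ.*_) (trans (GCD.gcd-comm (suc j') h) coprime) ⟩
    q ℕ.* 1 ≡⟨ ℕP.*-identityʳ q ⟩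
    q ≡⟨ kh ⟨
    k div h ∎
    where
    open ≡-Reasoning
    kh : k div h ≡ q
    kh = trans (cong (_div h) k≡qh) (div-* q h (root-positive h∣k))

  quotient-positive : ∀ {h} → h ∣ k → 1 ≤ k div h
  quotient-positive {h} h∣k@(divides zero refl) = contradiction 1≤k λ ()
  quotient-positive {h} h∣k@(divides (suc q) eq) = subst (1 ≤_) (sym (trans (cong (_div h) eq) (div-* (suc q) h (root-positive h∣k)))) (s≤s z≤n)

  split-unique : ∀ {j' h l} → h ∈ rootIndices k (suc j') → suc l ≡ cycleLength j' h → splitIndex l ≡ j' × splitRoot l ≡ h
  split-unique {j'} {h} {l} m eq with ∈-rootIndices⁻ {k} {suc j'} m | gcd-cycleLength {j'} {h} {l} m eq
  ... | h∣k@(divides q k≡qh) , _ | g = ℕP.suc-injective (begin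
      suc (splitIndex l) ≡⟨ GcdSplit.jg (gcdSplit k l) ⟨
      suc l div gcd (suc l) k ≡⟨ cong₂ _div_ eq g ⟩
      (suc j' ℕ.* (k div h)) div (k div h) ≡⟨ div-* (suc j') (k div h) (quotient-positive h∣k) ⟩
      suc j' ∎) , (begin
      splitRoot l ≡⟨ GcdSplit.hg (gcdSplit k l) ⟨
      k div gcd (suc l) k ≡⟨ cong₂ _div_ (trans k≡qh (ℕP.*-comm q h)) (trans g kh) ⟩
      (h ℕ.* q) div q ≡⟨ div-* h q (subst (1 ≤_) kh (quotient-positive h∣k)) ⟩
      h ∎)
    where
    open ≡-Reasoning
    kh : k div h ≡ q
    kh = trans (cong (_div h) k≡qh) (div-* q h (root-positive h∣k))

  -- An indicator of l + 1 = cycle length is inserted and the sums are exchanged; for each l only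
  -- the pair obtained from the gcd can survive. Lengths above `n` are void by `long`. If the index
  -- belonging to l exceeds the N variables, no `i` is left, and `high` makes the right term zero
  -- too.
  ∑-cycleLengths : ∀ N n (G : ℕ → ℕ → ℕ → ℚ) → (∀ j q h → n < q → G j q h ≡ 0ℚ) → (∀ j q h → N ≤ j → 1 ≤ q → G j q h ≡ 0ℚ) →
    ∑ (allFin N) (λ i → ∑ (rootIndices k (suc (toℕ i))) (λ h → G (toℕ i) (cycleLength (toℕ i) h) h))
      ≡ ∑ (upTo n) (λ l → G (splitIndex l) (suc l) (splitRoot l))
  ∑-cycleLengths N n G long high = begin
    ∑ (allFin N) (λ i → ∑ (H i) (λ h → G (toℕ i) (cycleLength (toℕ i) h) h)) ≡⟨ ∑-cong (allFin N) (λ i → ∑-cong-∈ (H i) (λ h m → introduce i h m)) ⟩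
    ∑ (allFin N) (λ i → ∑ (H i) (λ h → ∑ (upTo n) (λ l → δ i h l * G (toℕ i) (suc l) h))) ≡⟨ ∑-cong (allFin N) (λ i → ∑-swap (H i) (upTo n) _) ⟩
    ∑ (allFin N) (λ i → ∑ (upTo n) (λ l → ∑ (H i) (λ h → δ i h l * G (toℕ i) (suc l) h))) ≡⟨ ∑-swap (allFin N) (upTo n) _ ⟩
    ∑ (upTo n) (λ l → ∑ (allFin N) (λ i → ∑ (H i) (λ h → δ i h l * G (toℕ i) (suc l) h))) ≡⟨ ∑-cong (upTo n) (λ l → eliminate l (splitIndex l ℕ.<? N)) ⟩
    ∑ (upTo n) (λ l → G (splitIndex l) (suc l) (splitRoot l)) ∎
    where
    open ≡-Reasoning
    H : Fin N → List ℕ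
    H i = rootIndices k (suc (toℕ i))
    δ : Fin N → ℕ → ℕ → ℚ
    δ i h l = ⟦ does (suc l ℕ.≟ cycleLength (toℕ i) h) ⟧
    δ-zero : ∀ i h l x → suc l ≢ cycleLength (toℕ i) h → δ i h l * x ≡ 0ℚ
    δ-zero i h l x ne = trans (cong (λ b → ⟦ b ⟧ * x) (dec-false (suc l ℕ.≟ cycleLength (toℕ i) h) ne)) (ℚP.*-zeroˡ x)
    δ-one : ∀ i h l x → suc l ≡ cycleLength (toℕ i) h → δ i h l * x ≡ x
    δ-one i h l x eq = trans (cong (λ b → ⟦ b ⟧ * x) (dec-true (suc l ℕ.≟ cycleLength (toℕ i) h) eq)) (ℚP.*-identityˡ x)
    introduce : ∀ i h → h ∈ H i → G (toℕ i) (cycleLength (toℕ i) h) h ≡ ∑ (upTo n) (λ l → δ i h l * G (toℕ i) (suc l) h)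
    introduce i h m = go (cycleLength (toℕ i) h) refl (ℕP.*-mono-≤ {1} {suc (toℕ i)} (s≤s z≤n) (quotient-positive (proj₁ (∈-rootIndices⁻ {k} {suc (toℕ i)} m))))
      where
      go : ∀ q → cycleLength (toℕ i) h ≡ q → 1 ≤ q → G (toℕ i) q h ≡ ∑ (upTo n) (λ l → δ i h l * G (toℕ i) (suc l) h)
      go (suc l₀) eq _ with l₀ ℕ.<? n
      ... | yes l₀<n = sym (trans (∑-single _ (UniqueP.upTo⁺ n) (∈P.∈-upTo⁺ l₀<n) (λ l _ l≢ → δ-zero i h l _ (λ e → l≢ (ℕP.suc-injective (trans e eq)))))
              (δ-one i h l₀ _ (sym eq)))
      ... | no l₀≮n = trans (long _ _ h (s≤s (ℕP.≮⇒≥ l₀≮n))) (sym (∑-zero-∈ (upTo n) (λ l l∈ → δ-zero i h l _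
              (λ e → l₀≮n (subst (_< n) (ℕP.suc-injective (trans e eq)) (∈P.∈-upTo⁻ l∈))))))
    eliminate : ∀ l → Dec (splitIndex l < N) → ∑ (allFin N) (λ i → ∑ (H i) (λ h → δ i h l * G (toℕ i) (suc l) h)) ≡ G (splitIndex l) (suc l) (splitRoot l)
    eliminate l (no j≮N) = trans (∑-zero-∈ (allFin N) (λ i _ → ∑-zero-∈ (H i) (λ h m → δ-zero i h l _
        (λ e → j≮N (subst (_< N) (sym (proj₁ (split-unique m e))) (FinP.toℕ<n i))))))
      (sym (high _ (suc l) _ (ℕP.≮⇒≥ j≮N) (s≤s z≤n)))
    eliminate l (yes j<N) = begin
      ∑ (allFin N) (λ i → ∑ (H i) (λ h → δ i h l * G (toℕ i) (suc l) h))
        ≡⟨ ∑-single (λ i → ∑ (H i) (λ h → δ i h l * G (toℕ i) (suc l) h)) (UniqueP.allFin⁺ N) (∈P.∈-allFin i₀) (λ i _ i≢ → ∑-zero-∈ (H i) (λ h m → δ-zero i h l _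
             (λ e → i≢ (FinP.toℕ-injective (trans (sym (proj₁ (split-unique m e))) (sym ti₀)))))) ⟩
      ∑ (H i₀) (λ h → δ i₀ h l * G (toℕ i₀) (suc l) h)
        ≡⟨ ∑-single (λ h → δ i₀ h l * G (toℕ i₀) (suc l) h) (rootIndices-unique k (suc (toℕ i₀))) (subst (λ q → splitRoot l ∈ rootIndices k (suc q)) (sym ti₀) (splitRoot-∈ l))
             (λ h m h≢ → δ-zero i₀ h l _ (λ e → h≢ (sym (proj₂ (split-unique m e))))) ⟩
      δ i₀ (splitRoot l) l * G (toℕ i₀) (suc l) (splitRoot l) ≡⟨ δ-one i₀ (splitRoot l) l _ (sym (trans (cong (λ q → cycleLength q (splitRoot l)) ti₀) (cycleLength-split l))) ⟩
      G (toℕ i₀) (suc l) (splitRoot l) ≡⟨ cong (λ q → G q (suc l) (splitRoot l)) ti₀ ⟩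
      G (splitIndex l) (suc l) (splitRoot l) ∎
      where
      i₀ : Fin N
      i₀ = Fin.fromℕ< j<N
      ti₀ : toℕ i₀ ≡ splitIndex l
      ti₀ = FinP.toℕ-fromℕ< j<N

decs-high : ∀ j θ m (e : Mon N) → N ≤ j → 1 ≤ m → decs (j , θ) m e ≡ nothing
decs-high {N} j θ (suc m) e N≤j _ = cong (_>>= decs (j , θ) m) (dec-high j e N≤j)
  where
  dec-high : ∀ {N} j (e : Mon N) → N ≤ j → dec (j , θ) e ≡ nothing
  dec-high j [] _ = refl
  dec-high (suc j) (p ∷ e) (s≤s N≤j) = cong (Maybe.map (p ∷_)) (dec-high j e N≤j)

deg-zero : ∀ (e : Mon N) → deg e ≡ 0 → e ≡ zeroMon
deg-zero [] _ = refl
deg-zero ((zero , zero) ∷ e) eq = cong ((0 , 0) ∷_) (deg-zero e eq)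

-- `r-spec` says that `r h θ` counts the h-th roots of θ among the signs, weighted by ϕ; both
-- identities become instances of one argument.
module Comparison (c : Character) (k : ℕ) (1≤k : 1 ≤ k) (r : ℕ → Sign → ℤ)
  (r-spec : ∀ h θ → toℚ (r h θ) ≡ ∑ Z2 (λ ε → ⟦ does (signPow ε h Sign.≟ θ) ⟧ * HeadRecursion.ϕ c ε)) where
  open HeadRecursion c using (ϕ)
  open WeightRecursion c k
  open CycleLengths k 1≤k

  module _ {N : ℕ} where
    Index : Set
    Index = Fin N × Sign × ℕ

    power : Index → ℕ
    power (i , _ , h) = cycleLength (toℕ i) h

    numerator : Index → ℚ
    numerator τ@(_ , θ , h) = toℚ (ℤ.- (negOnePow (power τ) ℤ.* r h θ))

    signedRow : Fin N → Sign → List Index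
    signedRow i θ = map (λ h → i , θ , h) (rootIndices k (suc (toℕ i)))

    row : Fin N → List Index
    row i = concatMap (signedRow i) Z2

    terms : List Index
    terms = concatMap row (allFin N)

    ∑-terms : ∀ (f : Index → ℚ) → ∑ terms f ≡ ∑ (allFin N) (λ i → ∑ Z2 (λ θ → ∑ (rootIndices k (suc (toℕ i))) (λ h → f (i , θ , h))))
    ∑-terms f = trans (∑-concatMap row (allFin N) f) (∑-cong (allFin N) (λ i → trans (∑-concatMap (signedRow i) Z2 f)
      (∑-cong Z2 (λ θ → ∑-map (λ h → i , θ , h) (rootIndices k (suc (toℕ i))) f))))

    power-positive : ∀ τ → τ ∈ terms → 1 ≤ power τ
    power-positive τ m with ∈P.∈-concat⁻′ (map row (allFin N)) m
    ... | _ , m₁ , m₂ with ∈P.∈-map⁻ row {xs = allFin N} m₂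
    ...   | i , _ , refl with ∈P.∈-concat⁻′ (map (signedRow i) Z2) m₁
    ...     | _ , m₃ , m₄ with ∈P.∈-map⁻ (signedRow i) {xs = Z2} m₄
    ...       | θ , _ , refl with ∈P.∈-map⁻ (λ h → i , θ , h) {xs = rootIndices k (suc (toℕ i))} m₃
    ...         | h , m₅ , refl = ℕP.*-mono-≤ {1} {suc (toℕ i)} (s≤s z≤n) (quotient-positive (proj₁ (∈-rootIndices⁻ {k} {suc (toℕ i)} m₅)))

    F : Ser N
    F = expS (exponentS r k)

    open ExpRecursion {Index} {N} terms (λ τ → numerator τ * recip (2 ℕ.* power τ)) proj₁ (proj₁ ∘ proj₂) power power-positive
      (exponentS r k) (λ e → sym (∑-terms _)) using (shiftBy; expS-recursion; eulerCoef) public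

    -- The Euler operator cancels p in the denominator 2 p; the remaining 2 is the one in front of
    -- the degree in the recursion over Bₙ.
    double-eulerCoef : ∀ τ → τ ∈ terms → fromℕ 2 * eulerCoef τ ≡ numerator τ
    double-eulerCoef τ m = begin
      fromℕ 2 * (fromℕ p * (numerator τ * recip (2 ℕ.* p))) ≡⟨ rearrange (fromℕ 2) (fromℕ p) (numerator τ) (recip (2 ℕ.* p)) ⟩
      numerator τ * (recip (2 ℕ.* p) * (fromℕ 2 * fromℕ p)) ≡⟨ cong (λ z → numerator τ * (recip (2 ℕ.* p) * z)) (fromℕ-* 2 p) ⟨
      numerator τ * (recip (2 ℕ.* p) * fromℕ (2 ℕ.* p)) ≡⟨ cong (numerator τ *_) (recip-inverse (2 ℕ.* p) (ℕP.*-mono-≤ {1} {2} (s≤s z≤n) (power-positive τ m))) ⟩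
      numerator τ * 1ℚ ≡⟨ ℚP.*-identityʳ (numerator τ) ⟩
      numerator τ ∎
      where
      open ≡-Reasoning
      p = power τ
      rearrange : ∀ a b c d → a * (b * (c * d)) ≡ c * (d * (a * b))
      rearrange = solve 4 (λ a b c d → a :* (b :* (c :* d)) := c :* (d :* (a :* b))) refl
        where open ℚS.+-*-Solver

    module _ (e : Mon N) where
      -- The contribution of cycles of length `q` and arbitrary class ε, whose powers have index j +
      -- 1 and class ε^h; the prefactor is (-1)^(q-1).
      G : ℕ → ℕ → ℕ → ℚ
      G j q h = - signℚ q * ∑ Z2 (λ ε → ϕ ε * apply F (decs (j , signPow ε h) q e))

      -- A sum over θ of the weighted number of roots of θ is a sum over the roots ε themselves,
      -- with θ = ε^h.
      ∑-numerator : ∀ i h → ∑ Z2 (λ θ → numerator (i , θ , h) * apply F (shiftBy (i , θ , h) e)) ≡ G (toℕ i) (cycleLength (toℕ i) h) h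
      ∑-numerator i h = begin
        ∑ Z2 (λ θ → numerator (i , θ , h) * shifted θ) ≡⟨ ∑-cong Z2 (λ θ → trans (cong (_* shifted θ) (numerator-≡ θ)) (trans (ℚP.*-assoc (- signℚ q) _ (shifted θ)) (cong (- signℚ q *_) (trans (sym (∑-*ʳ Z2 (shifted θ) (λ ε → δ ε θ * ϕ ε))) (∑-cong Z2 (λ ε → rearrange (δ ε θ) (ϕ ε) (shifted θ))))))) ⟩
        ∑ Z2 (λ θ → - signℚ q * ∑ Z2 (λ ε → ϕ ε * (δ ε θ * shifted θ))) ≡⟨ ∑-*ˡ Z2 (- signℚ q) (λ θ → ∑ Z2 (λ ε → ϕ ε * (δ ε θ * shifted θ))) ⟩
        - signℚ q * ∑ Z2 (λ θ → ∑ Z2 (λ ε → ϕ ε * (δ ε θ * shifted θ))) ≡⟨ cong (- signℚ q *_) (trans (∑-swap Z2 Z2 (λ θ ε → ϕ ε * (δ ε θ * shifted θ))) (∑-cong Z2 (λ ε → trans (∑-*ˡ Z2 (ϕ ε) (λ θ → δ ε θ * shifted θ)) (cong (ϕ ε *_) (pick ε))))) ⟩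
        - signℚ q * ∑ Z2 (λ ε → ϕ ε * shifted (signPow ε h)) ∎
        where
        open ≡-Reasoning
        q = cycleLength (toℕ i) h
        shifted : Sign → ℚ
        shifted θ = apply F (decs (toℕ i , θ) q e)
        δ : Sign → Sign → ℚ
        δ ε θ = ⟦ does (signPow ε h Sign.≟ θ) ⟧
        numerator-≡ : ∀ θ → numerator (i , θ , h) ≡ - signℚ q * ∑ Z2 (λ ε → δ ε θ * ϕ ε)
        numerator-≡ θ = trans (toℚ-neg (negOnePow q ℤ.* r h θ)) (trans (cong -_ (trans (toℚ-* (negOnePow q) (r h θ)) (cong (signℚ q *_) (r-spec h θ)))) (ℚP.neg-distribˡ-* (signℚ q) _))
        rearrange : ∀ a b c → (a * b) * c ≡ b * (a * c)
        rearrange = solve 3 (λ a b c → (a :* b) :* c := b :* (a :* c)) refl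
          where open ℚS.+-*-Solver
        pick : ∀ ε → ∑ Z2 (λ θ → δ ε θ * shifted θ) ≡ shifted (signPow ε h)
        pick ε = trans (∑-single (λ θ → δ ε θ * shifted θ) Z2-unique (∈-Z2 (signPow ε h)) (λ θ _ ne → trans (cong (λ b → ⟦ b ⟧ * shifted θ) (dec-false (signPow ε h Sign.≟ θ) (ne ∘ sym))) (ℚP.*-zeroˡ (shifted θ))))
          (trans (cong (λ b → ⟦ b ⟧ * shifted (signPow ε h)) (dec-true (signPow ε h Sign.≟ signPow ε h) refl)) (ℚP.*-identityˡ _))

      G-nothing : ∀ j q h → (∀ ε → apply F (decs (j , signPow ε h) q e) ≡ 0ℚ) → G j q h ≡ 0ℚ
      G-nothing j q h eq = trans (cong (- signℚ q *_) (∑-zero-∈ Z2 (λ ε _ → trans (cong (ϕ ε *_) (eq ε)) (ℚP.*-zeroʳ (ϕ ε))))) (ℚP.*-zeroʳ (- signℚ q))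

      G-long : ∀ j q h → deg e < q → G j q h ≡ 0ℚ
      G-long j q h deg<q = G-nothing j q h (λ ε → trans (apply-cong-deg {X = F} {λ _ → 0ℚ} (j , signPow ε h) q e
        (λ e' eq → contradiction (subst (q ≤_) (sym eq) (ℕP.m≤m+n q (deg e'))) (ℕP.<⇒≱ deg<q))) (apply-zero (decs (j , signPow ε h) q e)))

      G-high : ∀ j q h → N ≤ j → 1 ≤ q → G j q h ≡ 0ℚ
      G-high j q h N≤j 1≤q = G-nothing j q h (λ ε → cong (apply F) (decs-high j (signPow ε h) q e N≤j 1≤q))

      F-recursion : fromℕ 2 * (fromℕ (deg e) * F e) ≡ ∑ (upTo (deg e)) (λ l → G (splitIndex l) (suc l) (splitRoot l))
      F-recursion = begin
        fromℕ 2 * (fromℕ (deg e) * F e) ≡⟨ cong (fromℕ 2 *_) (expS-recursion e) ⟩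
        fromℕ 2 * ∑ terms (λ τ → eulerCoef τ * apply F (shiftBy τ e)) ≡⟨ ∑-*ˡ terms (fromℕ 2) _ ⟨
        ∑ terms (λ τ → fromℕ 2 * (eulerCoef τ * apply F (shiftBy τ e))) ≡⟨ ∑-cong-∈ terms (λ τ m → trans (sym (ℚP.*-assoc (fromℕ 2) (eulerCoef τ) _)) (cong (_* apply F (shiftBy τ e)) (double-eulerCoef τ m))) ⟩
        ∑ terms (λ τ → numerator τ * apply F (shiftBy τ e)) ≡⟨ ∑-terms _ ⟩
        ∑ (allFin N) (λ i → ∑ Z2 (λ θ → ∑ (rootIndices k (suc (toℕ i))) (λ h → numerator (i , θ , h) * apply F (shiftBy (i , θ , h) e))))
          ≡⟨ ∑-cong (allFin N) (λ i → trans (∑-swap Z2 (rootIndices k (suc (toℕ i))) (λ θ h → numerator (i , θ , h) * apply F (shiftBy (i , θ , h) e))) (∑-cong (rootIndices k (suc (toℕ i))) (λ h → ∑-numerator i h))) ⟩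
        ∑ (allFin N) (λ i → ∑ (rootIndices k (suc (toℕ i))) (λ h → G (toℕ i) (cycleLength (toℕ i) h) h)) ≡⟨ ∑-cycleLengths N (deg e) G G-long G-high ⟩
        ∑ (upTo (deg e)) (λ l → G (splitIndex l) (suc l) (splitRoot l)) ∎
        where open ≡-Reasoning

    density-zero : ∀ e → deg e ≡ 0 → density 0 e ≡ F e
    density-zero e eq = begin
      1ℚ * (toℚ (Character.value c []) * oneS e + 0ℚ) ≡⟨ trans (ℚP.*-identityˡ _) (ℚP.+-identityʳ _) ⟩
      toℚ (Character.value c []) * oneS e ≡⟨ trans (cong (λ v → toℚ v * oneS e) (Character.value-empty c)) (ℚP.*-identityˡ (oneS e)) ⟩
      oneS e ≡⟨ trans (ℚP.+-identityʳ _) (ℚP.*-identityʳ (oneS e)) ⟨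
      ∑ (upTo 1) (λ m → (exponentS r k ^S m) e * recip (m !)) ≡⟨ cong (λ d → ∑ (upTo (suc d)) (λ m → (exponentS r k ^S m) e * recip (m !))) eq ⟨
      F e ∎
      where open ≡-Reasoning

    -- Strong induction on the degree: the recursion descends to `n ∸ l`, and the bound `d` makes
    -- the descent structural.
    density-F-bounded : ∀ d n e → n ≤ d → deg e ≡ n → density n e ≡ F e
    density-F-bounded d zero e _ eq = density-zero e eq
    density-F-bounded (suc d) (suc n) e (s≤s n≤d) eq = *-cancelˡ (2 ℕ.* suc n) (s≤s z≤n) (begin
      fromℕ (2 ℕ.* suc n) * density (suc n) e ≡⟨ density-recursion e n ⟩
      -- `signℚ l` is minus `signℚ (suc l)`, the prefactor of `G` at length l + 1.
      ∑ (upTo (suc n)) (λ l → signℚ l * closing e (n ∸ l) l) ≡⟨ ∑-cong-∈ (upTo (suc n)) (λ l m → cong₂ _*_ (sym (trans (sym (toℚ-neg (negOnePow (suc l)))) (cong toℚ (ℤP.neg-involutive (negOnePow l))))) (∑-cong Z2 (λ ε → cong (ϕ ε *_) (term l ε (ℕP.≤-pred (∈P.∈-upTo⁻ m)))))) ⟩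
      ∑ (upTo (suc n)) (λ l → G e (splitIndex l) (suc l) (splitRoot l)) ≡⟨ cong (λ q → ∑ (upTo q) (λ l → G e (splitIndex l) (suc l) (splitRoot l))) eq ⟨
      ∑ (upTo (deg e)) (λ l → G e (splitIndex l) (suc l) (splitRoot l)) ≡⟨ F-recursion e ⟨
      fromℕ 2 * (fromℕ (deg e) * F e) ≡⟨ trans (sym (ℚP.*-assoc (fromℕ 2) (fromℕ (deg e)) (F e))) (cong (_* F e) (trans (sym (fromℕ-* 2 (deg e))) (cong (λ q → fromℕ (2 ℕ.* q)) eq))) ⟩
      fromℕ (2 ℕ.* suc n) * F e ∎)
      where
      open ≡-Reasoning
      term : ∀ l ε → l ≤ n → contribution e (n ∸ l) (l , ε) ≡ apply F (decs (splitIndex l , signPow ε (splitRoot l)) (suc l) e)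
      term l ε l≤n = trans (apply-cong-deg {X = density (n ∸ l)} {F} (powerType k (l , ε)) (suc l) e (λ e' eq' →
          density-F-bounded d (n ∸ l) e' (ℕP.≤-trans (ℕP.m∸n≤m n l) n≤d)
            (trans (sym (ℕP.m+n∸m≡n l (deg e'))) (cong (_∸ l) (ℕP.suc-injective (trans (sym eq') eq))))))
        (cong (λ t → apply F (decs t (suc l) e)) (GcdSplit.pow (gcdSplit k l) ε))

    density-F : ∀ e → density (deg e) e ≡ F e
    density-F e = density-F-bounded (deg e) (deg e) e ℕP.≤-refl refl

-- Cycle types and monomials

raise : Type → Type
raise (j , θ) = suc j , θ

-- The multiset of letter types described by the monomial e.
letters : Mon N → List Type
letters [] = []
letters ((a , b) ∷ e) = replicate a (0 , Sign.+) ++ (replicate b (0 , Sign.-) ++ map raise (letters e))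

letters-dec : ∀ t (e : Mon N) → Maybe.maybe′ (λ e' → t ∷ letters e' ↭ letters e) (0 ≡ 0) (dec t e)
letters-dec t [] = refl
letters-dec (zero , Sign.+) ((zero , b) ∷ e) = refl
letters-dec (zero , Sign.+) ((suc a , b) ∷ e) = ↭-refl
letters-dec (zero , Sign.-) ((a , zero) ∷ e) = refl
letters-dec (zero , Sign.-) ((a , suc b) ∷ e) = ↭-sym (↭P.shift (0 , Sign.-) (replicate a (0 , Sign.+)) (replicate b (0 , Sign.-) ++ map raise (letters e)))
letters-dec (suc j , θ) ((a , b) ∷ e) with dec (j , θ) e | letters-dec (j , θ) e
... | nothing | _ = refl
... | just e' | p = ↭-trans (↭-sym (↭P.shift (suc j , θ) (replicate a (0 , Sign.+)) (replicate b (0 , Sign.-) ++ map raise (letters e'))))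
  (↭P.++⁺ˡ (replicate a (0 , Sign.+)) (↭-trans (↭-sym (↭P.shift (suc j , θ) (replicate b (0 , Sign.-)) (map raise (letters e'))))
    (↭P.++⁺ˡ (replicate b (0 , Sign.-)) (↭P.map⁺ raise p))))

letters-zeroMon : ∀ N → letters (zeroMon {N}) ≡ []
letters-zeroMon zero = refl
letters-zeroMon (suc N) = cong (map raise) (letters-zeroMon N)

oneS-indicator : ∀ (e : Mon N) → oneS e ≡ 0ℚ ⊎ (oneS e ≡ 1ℚ × [] ↭ letters e)
oneS-indicator {N} e with e ≟M zeroMon
... | yes refl = inj₂ (refl , ↭.↭-reflexive (sym (letters-zeroMon N)))
... | no _ = inj₁ refl

weight-indicator : ∀ ts (e : Mon N) → weight ts e ≡ 0ℚ ⊎ (weight ts e ≡ 1ℚ × ts ↭ letters e)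
weight-indicator [] e = oneS-indicator e
weight-indicator (t ∷ ts) e with dec t e | letters-dec t e
... | nothing | _ = inj₁ refl
... | just e' | p with weight-indicator ts e'
...   | inj₁ eq = inj₁ eq
...   | inj₂ (eq , q) = inj₂ (eq , ↭-trans (↭.prep t q) p)

weight-raise : ∀ ts (e : Mon N) → weight (map raise ts) ((0 , 0) ∷ e) ≡ weight ts e
weight-raise {N} [] e = cong ⟦_⟧ (does-cong (((0 , 0) ∷ e) ≟M zeroMon) (e ≟M zeroMon) VecP.∷-injectiveʳ (cong ((0 , 0) ∷_)))
weight-raise (t ∷ ts) e with dec t e
... | nothing = refl
... | just e' = weight-raise ts e'

weight-letters : ∀ (e : Mon N) → weight (letters e) e ≡ 1ℚ
weight-letters [] = refl
weight-letters ((suc a , b) ∷ e) = weight-letters ((a , b) ∷ e)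
weight-letters ((zero , suc b) ∷ e) = weight-letters ((zero , b) ∷ e)
weight-letters ((zero , zero) ∷ e) = trans (weight-raise (letters e) e) (weight-letters e)

-- Supplies the indicator required by `double-count`: a weight 0 for a rearrangement of the letters
-- of `e` would contradict `weight-letters`.
weight-dichotomy : ∀ {us} (e : Mon N) → us ↭ letters e → ∀ ts → (ts ↭ us × weight ts e ≡ 1ℚ) ⊎ (¬ (ts ↭ us) × weight ts e ≡ 0ℚ)
weight-dichotomy {us = us} e p ts with weight-indicator ts e
... | inj₂ (eq , q) = inj₁ (↭-trans q (↭-sym p) , eq)
... | inj₁ eq = inj₂ ((λ q → contradiction (trans (sym eq) (trans (weight-↭ (↭-trans q p) e) (weight-letters e))) λ ()) , eq)

replicate-+ : ∀ {A : Set} a b (x : A) → replicate (a ℕ.+ b) x ≡ replicate a x ++ replicate b x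
replicate-+ zero b x = refl
replicate-+ (suc a) b x = cong (x ∷_) (replicate-+ a b x)

expand-replicate : ∀ q t → expand (replicate q t) ≡ replicate (q ℕ.* suc (proj₁ t)) t
expand-replicate zero t = refl
expand-replicate (suc q) t = trans (cong (replicate (suc (proj₁ t)) t ++_) (expand-replicate q t)) (sym (replicate-+ (suc (proj₁ t)) _ t))

expand-concatMap : ∀ {A : Set} (f : A → List Type) (g : A → List Type) xs → (∀ x → expand (f x) ≡ g x) → expand (concatMap f xs) ≡ concatMap g xs
expand-concatMap f g [] h = refl
expand-concatMap f g (x ∷ xs) h = trans (ListP.concatMap-++ _ (f x) (concatMap f xs)) (cong₂ _++_ (h x) (expand-concatMap f g xs h))

lettersAt : Mon N → Fin N → List Type
lettersAt e i = replicate (proj₁ (lookup e i)) (toℕ i , Sign.+) ++ replicate (proj₂ (lookup e i)) (toℕ i , Sign.-)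

concatMap-lettersAt : ∀ (e : Mon N) → concatMap (lettersAt e) (allFin N) ≡ letters e
concatMap-lettersAt [] = refl
concatMap-lettersAt {suc N} ((a , b) ∷ e) = begin
  concatMap (lettersAt ((a , b) ∷ e)) (allFin (suc N)) ≡⟨ cong (concatMap (lettersAt ((a , b) ∷ e))) (allFin-suc N) ⟩
  (R₁ ++ R₂) ++ concatMap (lettersAt ((a , b) ∷ e)) (map Fin.suc (allFin N)) ≡⟨ ListP.++-assoc R₁ R₂ _ ⟩
  R₁ ++ (R₂ ++ concatMap (lettersAt ((a , b) ∷ e)) (map Fin.suc (allFin N))) ≡⟨ cong (λ xs → R₁ ++ (R₂ ++ xs)) (trans (tail (allFin N)) (cong (map raise) (concatMap-lettersAt e))) ⟩
  R₁ ++ (R₂ ++ map raise (letters e)) ∎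
  where
  open ≡-Reasoning
  R₁ = replicate a (0 , Sign.+)
  R₂ = replicate b (0 , Sign.-)
  tail : ∀ is → concatMap (lettersAt ((a , b) ∷ e)) (map Fin.suc is) ≡ map raise (concatMap (lettersAt e) is)
  tail [] = refl
  tail (i ∷ is) = trans (cong₂ _++_ (sym (trans (ListP.map-++ raise (replicate (proj₁ (lookup e i)) (toℕ i , Sign.+)) _)
      (cong₂ _++_ (ListP.map-replicate raise (proj₁ (lookup e i)) (toℕ i , Sign.+)) (ListP.map-replicate raise (proj₂ (lookup e i)) (toℕ i , Sign.-))))) (tail is))
    (sym (ListP.map-++ raise (lettersAt e i) _))

Divisible : Mon N → Set
Divisible {N} e = ∀ (i : Fin N) → suc (toℕ i) ∣ proj₁ (lookup e i) × suc (toℕ i) ∣ proj₂ (lookup e i)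

divisibleᵇ : Mon N → Fin N → Bool
divisibleᵇ e i = does (suc (toℕ i) ∣? proj₁ (lookup e i)) ∧ does (suc (toℕ i) ∣? proj₂ (lookup e i))

all-true : ∀ {A : Set} (p : A → Bool) xs → (∀ x → x ∈ xs → p x ≡ true) → all p xs ≡ true
all-true p [] h = refl
all-true p (x ∷ xs) h rewrite h x (here refl) = all-true p xs (λ y m → h y (there m))

all-true⁻ : ∀ {A : Set} (p : A → Bool) xs → all p xs ≡ true → ∀ x → x ∈ xs → p x ≡ true
all-true⁻ p (x ∷ xs) h y m with p x in eq
all-true⁻ p (x ∷ xs) h y (here refl) | true = eq
all-true⁻ p (x ∷ xs) h y (there m) | true = all-true⁻ p xs h y m

isCycleType⇒Divisible : ∀ (e : Mon N) → isCycleTypeᵇ e ≡ true → Divisible e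
isCycleType⇒Divisible {N} e h i = split (suc (toℕ i) ∣? proj₁ (lookup e i)) (suc (toℕ i) ∣? proj₂ (lookup e i)) (all-true⁻ (divisibleᵇ e) (allFin N) h i (∈P.∈-allFin i))
  where
  split : ∀ {P Q : Set} (p : Dec P) (q : Dec Q) → does p ∧ does q ≡ true → P × Q
  split (yes p) (yes q) _ = p , q

Divisible⇒isCycleType : ∀ (e : Mon N) → Divisible e → isCycleTypeᵇ e ≡ true
Divisible⇒isCycleType {N} e d = all-true (divisibleᵇ e) (allFin N) (λ i _ → cong₂ _∧_ (dec-true (suc (toℕ i) ∣? proj₁ (lookup e i)) (proj₁ (d i))) (dec-true (suc (toℕ i) ∣? proj₂ (lookup e i)) (proj₂ (d i))))

expand-cyclesOf : ∀ (e : Mon N) → Divisible e → expand (cyclesOf e) ≡ letters e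
expand-cyclesOf {N} e d = trans (expand-concatMap _ (lettersAt e) (allFin N) at) (concatMap-lettersAt e)
  where
  at : ∀ i → expand (replicate (proj₁ (lookup e i) ℕ./ suc (toℕ i)) (toℕ i , Sign.+) ++ replicate (proj₂ (lookup e i) ℕ./ suc (toℕ i)) (toℕ i , Sign.-)) ≡ lettersAt e i
  at i = trans (ListP.concatMap-++ _ (replicate (proj₁ (lookup e i) ℕ./ suc (toℕ i)) (toℕ i , Sign.+)) _)
    (cong₂ _++_ (part Sign.+ (proj₁ (d i))) (part Sign.- (proj₂ (d i))))
    where
    part : ∀ θ {a} → suc (toℕ i) ∣ a → expand (replicate (a ℕ./ suc (toℕ i)) (toℕ i , θ)) ≡ replicate a (toℕ i , θ)
    part θ {a} da = trans (expand-replicate (a ℕ./ suc (toℕ i)) (toℕ i , θ)) (cong (λ q → replicate q (toℕ i , θ)) (DivMod.m/n*n≡m da))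

length-letters : ∀ (e : Mon N) → length (letters e) ≡ deg e
length-letters [] = refl
length-letters ((a , b) ∷ e) = trans (ListP.length-++ (replicate a (0 , Sign.+)))
  (trans (cong₂ ℕ._+_ (ListP.length-replicate a) (trans (ListP.length-++ (replicate b (0 , Sign.-))) (cong₂ ℕ._+_ (ListP.length-replicate b) (trans (ListP.length-map raise (letters e)) (length-letters e)))))
    (sym (ℕP.+-assoc a b (deg e))))

length-expand : ∀ cs → length (expand cs) ≡ size cs
length-expand [] = refl
length-expand ((j' , θ) ∷ cs) = trans (ListP.length-++ (replicate (suc j') (j' , θ))) (cong₂ ℕ._+_ (ListP.length-replicate (suc j')) (length-expand cs))

-- Divisible in a form that passes to the tail of e, with o the number of variables already removed.
DivisibleFrom : ℕ → Mon N → Set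
DivisibleFrom o [] = 0 ≡ 0
DivisibleFrom o ((a , b) ∷ e) = (suc o ∣ a × suc o ∣ b) × DivisibleFrom (suc o) e

divisibleFrom⇒ : ∀ o (e : Mon N) → DivisibleFrom o e → ∀ i → suc (o ℕ.+ toℕ i) ∣ proj₁ (lookup e i) × suc (o ℕ.+ toℕ i) ∣ proj₂ (lookup e i)
divisibleFrom⇒ o ((a , b) ∷ e) (d , _) Fin.zero = subst (λ q → suc q ∣ a × suc q ∣ b) (sym (ℕP.+-identityʳ o)) d
divisibleFrom⇒ o (_ ∷ e) (_ , d) (Fin.suc i) = subst (λ q → suc q ∣ proj₁ (lookup e i) × suc q ∣ proj₂ (lookup e i)) (sym (ℕP.+-suc o (toℕ i))) (divisibleFrom⇒ (suc o) e d i)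

divisibleFrom-zero : ∀ o N → DivisibleFrom o (zeroMon {N})
divisibleFrom-zero o zero = refl
divisibleFrom-zero o (suc N) = (suc o Div.∣0 , suc o Div.∣0) , divisibleFrom-zero (suc o) N

decs-plus-exponent : ∀ m a b (e : Mon N) → Maybe.maybe′ (λ e' → ∃ λ a' → a ≡ m ℕ.+ a' × e' ≡ (a' , b) ∷ e) (0 ≡ 0) (decs (0 , Sign.+) m ((a , b) ∷ e))
decs-plus-exponent zero a b e = a , refl , refl
decs-plus-exponent (suc m) zero b e = refl
decs-plus-exponent (suc m) (suc a) b e with decs (0 , Sign.+) m ((a , b) ∷ e) | decs-plus-exponent m a b e
... | nothing | _ = refl
... | just _ | a' , eq , eq' = a' , cong suc eq , eq'

decs-minus-exponent : ∀ m a b (e : Mon N) → Maybe.maybe′ (λ e' → ∃ λ b' → b ≡ m ℕ.+ b' × e' ≡ (a , b') ∷ e) (0 ≡ 0) (decs (0 , Sign.-) m ((a , b) ∷ e))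
decs-minus-exponent zero a b e = b , refl , refl
decs-minus-exponent (suc m) a zero e = refl
decs-minus-exponent (suc m) a (suc b) e with decs (0 , Sign.-) m ((a , b) ∷ e) | decs-minus-exponent m a b e
... | nothing | _ = refl
... | just _ | b' , eq , eq' = b' , cong suc eq , eq'

-- Subtracting a multiple of an index from the exponent of its own variable cannot repair a failure
-- of divisibility.
divisibleFrom-decs : ∀ o j θ m (e : Mon N) → suc (o ℕ.+ j) ∣ m →
  Maybe.maybe′ (λ e' → DivisibleFrom o e' → DivisibleFrom o e) (0 ≡ 0) (decs (j , θ) m e)
divisibleFrom-decs o j θ zero [] d = id
divisibleFrom-decs o j θ (suc m) [] d = refl
divisibleFrom-decs o zero Sign.+ m ((a , b) ∷ e) d with decs (0 , Sign.+) m ((a , b) ∷ e) | decs-plus-exponent m a b e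
... | nothing | _ = refl
... | just _ | a' , refl , refl = λ { ((da , db) , de) → (Div.∣m∣n⇒∣m+n (subst (λ q → suc q ∣ m) (ℕP.+-identityʳ o) d) da , db) , de }
divisibleFrom-decs o zero Sign.- m ((a , b) ∷ e) d with decs (0 , Sign.-) m ((a , b) ∷ e) | decs-minus-exponent m a b e
... | nothing | _ = refl
... | just _ | b' , refl , refl = λ { ((da , db) , de) → (da , Div.∣m∣n⇒∣m+n (subst (λ q → suc q ∣ m) (ℕP.+-identityʳ o) d) db) , de }
divisibleFrom-decs o (suc j) θ m (p ∷ e) d rewrite decs-suc j θ m p e
  with decs (j , θ) m e | divisibleFrom-decs (suc o) j θ m e (subst (λ q → suc q ∣ m) (ℕP.+-suc o j) d)
... | nothing | _ = refl
... | just _ | h = λ { (dp , de) → dp , h de }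

-- Both sides at an arbitrary monomial

module Conclusion (c : Character) (k : ℕ) (1≤k : 1 ≤ k) (r : ℕ → Sign → ℤ)
  (r-spec : ∀ h θ → toℚ (r h θ) ≡ ∑ Z2 (λ ε → ⟦ does (signPow ε h Sign.≟ θ) ⟧ * HeadRecursion.ϕ c ε)) where
  open Character c using (value)
  open WeightRecursion c k
  open Comparison c k 1≤k r r-spec
  open DoubleCount c k

  -- The double count is divided by both group orders, after the types of the powers have been
  -- rewritten as powered types; the centralizer order is positive since it counts the identity.
  cycleType-value : ∀ (e : Mon N) → Divisible e →
    toℚ (rootsWith value k (rep (cyclesOf e))) * recip (centralizerOrder (rep (cyclesOf e))) ≡ density (deg e) e
  cycleType-value e d = *-cancelˡ (cardB (size cs)) (cardB-positive (size cs)) (begin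
    fromℕ (cardB (size cs)) * (toℚ (rootsWith value k y) * recip Z) ≡⟨ ℚP.*-assoc (fromℕ (cardB (size cs))) _ (recip Z) ⟨
    (fromℕ (cardB (size cs)) * toℚ (rootsWith value k y)) * recip Z ≡⟨ cong (_* recip Z) (double-count cs (λ z → weight (types z) e)
        (λ z _ → weight-dichotomy e (↭.↭-reflexive (trans (types-rep cs) expanded)) (types z))) ⟩
    (fromℕ Z * ∑ (Bn (size cs)) (λ x → weight (types (x ^B k)) e * toℚ (value x))) * recip Z ≡⟨ cong (λ q → (fromℕ Z * q) * recip Z) powers ⟩
    (fromℕ Z * weightSum (size cs) e) * recip Z ≡⟨ rearrange (fromℕ Z) (weightSum (size cs) e) (recip Z) ⟩
    (recip Z * fromℕ Z) * weightSum (size cs) e ≡⟨ cong (_* weightSum (size cs) e) (recip-inverse Z Z-positive) ⟩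
    1ℚ * weightSum (size cs) e ≡⟨ ℚP.*-identityˡ _ ⟩
    weightSum (size cs) e ≡⟨ density-weightSum (size cs) e ⟩
    fromℕ (cardB (size cs)) * density (size cs) e ≡⟨ cong (λ q → fromℕ (cardB (size cs)) * density q e) size-deg ⟩
    fromℕ (cardB (size cs)) * density (deg e) e ∎)
    where
    open ≡-Reasoning
    cs = cyclesOf e
    y = rep cs
    Z = centralizerOrder y
    expanded : expand cs ≡ letters e
    expanded = expand-cyclesOf e d
    size-deg : size cs ≡ deg e
    size-deg = trans (sym (length-expand cs)) (trans (cong length expanded) (length-letters e))
    powers : ∑ (Bn (size cs)) (λ x → weight (types (x ^B k)) e * toℚ (value x)) ≡ weightSum (size cs) e
    powers = ∑-cong-∈ (Bn (size cs)) (λ x m → trans (ℚP.*-comm _ (toℚ (value x))) (cong (λ ts → toℚ (value x) * weight ts e)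
      (trans (ListP.map-cong (type-^B {x = x} (Good-Bn {x = x} m) k) (allFin (size cs))) (ListP.map-∘ (allFin (size cs))))))
    rearrange : ∀ a b c → (a * b) * c ≡ (c * a) * b
    rearrange = solve 3 (λ a b c → (a :* b) :* c := (c :* a) :* b) refl
      where open ℚS.+-*-Solver
    Z-positive : 1 ≤ Z
    Z-positive = ∈P.∈-length (∈P.∈-filter⁺ (λ x → Bool.T? (does ((x ∘B y) ≟B (y ∘B x)))) (∈-Bn {x = idB} Good-idB)
      (T-does ((idB ∘B y) ≟B (y ∘B idB)) (trans (∘B-identityˡ y) (sym (∘B-identityʳ y)))))

  -- Every term of the recursion for the exponential leads to a monomial of smaller degree that also
  -- fails divisibility, and the monomial of degree 0 does not fail it. So these coefficients vanish
  -- by induction, again with a bound `d`.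
  nondivisible-bounded : ∀ d n (e : Mon N) → n ≤ d → deg e ≡ n → ¬ DivisibleFrom 0 e → F e ≡ 0ℚ
  nondivisible-bounded {N} d zero e _ eq ¬div = contradiction (subst (DivisibleFrom 0) (sym (deg-zero e eq)) (divisibleFrom-zero 0 N)) ¬div
  nondivisible-bounded {N} (suc d) (suc n) e (s≤s n≤d) eq ¬div = *-cancelˡ (suc n) (s≤s z≤n) (trans (cong (λ q → fromℕ q * F e) (sym eq))
    (trans (expS-recursion e) (trans (∑-zero-∈ terms (λ τ τ∈ → trans (cong (eulerCoef τ *_) (vanish τ τ∈)) (ℚP.*-zeroʳ (eulerCoef τ)))) (sym (ℚP.*-zeroʳ (fromℕ (suc n)))))))
    where
    vanish : ∀ τ → τ ∈ terms → apply F (shiftBy τ e) ≡ 0ℚ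
    vanish τ@(i , θ , h) τ∈ = go (shiftBy τ e) (deg-decs (toℕ i , θ) (power τ) e) (divisibleFrom-decs 0 (toℕ i) θ (power τ) e (divides (k div h) (ℕP.*-comm (suc (toℕ i)) (k div h))))
      where
      go : ∀ m → Maybe.maybe′ (λ e' → deg e ≡ power τ ℕ.+ deg e') (0 ≡ 0) m → Maybe.maybe′ (λ e' → DivisibleFrom 0 e' → DivisibleFrom 0 e) (0 ≡ 0) m → apply F m ≡ 0ℚ
      go nothing _ _ = refl
      go (just e') deg-eq div = nondivisible-bounded d (deg e') e'
        (ℕP.≤-trans (ℕP.≤-pred (ℕP.≤-trans (ℕP.+-monoˡ-≤ (deg e') (power-positive τ τ∈)) (ℕP.≤-reflexive (trans (sym deg-eq) eq)))) n≤d) refl (¬div ∘ div)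

  lhs≡rhs : (f : ∀ {n} → ℕ → SPerm n → ℤ) → (∀ {n} (y : SPerm n) → f k y ≡ rootsWith value k y) → ∀ (e : Mon N) → lhsCoeff f k e ≡ rhsCoeff r k e
  lhs≡rhs f f-value e = by-cases (isCycleTypeᵇ e) refl
    where
    by-cases : ∀ b → isCycleTypeᵇ e ≡ b →
      (if b then toℚ (f k (rep (cyclesOf e))) * recip (centralizerOrder (rep (cyclesOf e))) else 0ℚ) ≡ F e
    by-cases true eq = trans (cong (λ q → toℚ q * recip (centralizerOrder (rep (cyclesOf e)))) (f-value (rep (cyclesOf e))))
      (trans (cycleType-value e (isCycleType⇒Divisible e eq)) (density-F e))
    by-cases false eq = sym (nondivisible-bounded (deg e) (deg e) e ℕP.≤-refl refl
      (λ d → contradiction (trans (sym eq) (Divisible⇒isCycleType e (divisibleFrom⇒ 0 e d))) λ ()))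

rootsZ2-spec : ∀ h θ → toℚ (rootsZ2 h θ) ≡ ∑ Z2 (λ ε → ⟦ does (signPow ε h Sign.≟ θ) ⟧ * HeadRecursion.ϕ χ'-character ε)
rootsZ2-spec h θ = trans (sym (fromℕ-toℚ (length xs))) (trans (sym (ℚP.*-identityʳ _)) (trans (sym (∑-length xs 1ℚ))
  (∑-filterᵇ (λ ε → does (signPow ε h Sign.≟ θ)) Z2 (λ _ → 1ℚ))))
  where xs = filterᵇ (λ ε → does (signPow ε h Sign.≟ θ)) Z2

srootsZ2-spec : ∀ h θ → toℚ (srootsZ2 h θ) ≡ ∑ Z2 (λ ε → ⟦ does (signPow ε h Sign.≟ θ) ⟧ * HeadRecursion.ϕ χχ'-character ε)
srootsZ2-spec h θ = trans (toℚ-sumℤ (filterᵇ (λ ε → does (signPow ε h Sign.≟ θ)) Z2) signℤ)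
  (∑-filterᵇ (λ ε → does (signPow ε h Sign.≟ θ)) Z2 (toℚ ∘ signℤ))

theorem7p9 : (k : ℕ) → 1 ≤ k → (N : ℕ) → (e : Mon N) →
    (lhsCoeff roots' k e ≡ rhsCoeff rootsZ2 k e)
    × (lhsCoeff sroots' k e ≡ rhsCoeff srootsZ2 k e)
theorem7p9 k 1≤k N e =
  Conclusion.lhs≡rhs χ'-character k 1≤k rootsZ2 rootsZ2-spec roots' (λ _ → refl) e ,
  Conclusion.lhs≡rhs χχ'-character k 1≤k srootsZ2 srootsZ2-spec sroots' (λ _ → refl) e
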